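{- Let $(T,T_0,\alpha)$ be a cohomological duality triple, and let $G$ be a profinite group admitting a cover $S\to G$. Let $N$ be a closed normal subgroup of $G$ contained in $T(G)$, and consider: (a) $N\leq T_0(G)$; (b) the inflation map $A(G/N)\to A(G)$ is an isomorphism; (c) the inflation map $H^*_{t,\alpha}(G/N)\to H^*_{t,\alpha}(G)$ is an isomorphism for every $t\geq1$. Then (a)$\Leftrightarrow$(b)$\Rightarrow$(c). Moreover, if there exists $r\geq1$ such that $\bar\alpha^r_G\colon H^r_{r,\alpha}(G)\to A(G)$ is injective and $\bar\alpha^r_{G/N}\colon H^r_{r,\alpha}(G/N)\to A(G/N)$ is surjective, then (a), (b), (c) are equivalent.
   Context: $p$ prime, $q=p^s$; $H^i(G)=H^i(G,\mathbb{Z}/q)$ (continuous, trivial action); $G^{(2)}=G^q[G,G]$. For a profinite group $G$ let $H^{\otimes*}(G)=\bigoplus_{r\ge0}H^1(G)^{\otimes r}$ (tensor products over $\mathbb{Z}/q$), regarded as an abelian group. A cohomological duality triple $(T,T_0,\alpha)$ assigns to each profinite group $G$ closed subgroups $T(G),T_0(G)$ of $G$ and a group homomorphism $\alpha_G\colon H^{\otimes*}(G)\to H^2(G)$, functorially: for each continuous homomorphism $\pi\colon G_1\to G_2$ one has $\pi(T(G_1))\subseteq T(G_2)$, $\pi(T_0(G_1))\subseteq T_0(G_2)$ and $\pi_2^*\circ\alpha_{G_2}=\alpha_{G_1}\circ\pi^*$ (with $\pi^*$ the induced maps on $H^{\otimes *}$ and $H^2$); and for every profinite $G$: (A1) $T(G),T_0(G)$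 are normal in $G$; (A2) $T(G)^q[T(G),G]\le T_0(G)\le T(G)\le G^{(2)}$; (A3) for every epimorphism $\pi\colon G\to\bar G$, $T(\bar G)=\pi(T(G))$ and $T_0(\bar G)=\pi(T_0(G))$; (A4) if $G$ admits a cover then $A(G/T(G))$ is dual to $(T(G),T_0(G))$. Here $A(G)=\mathrm{Img}(\alpha_G)$; a cover of $G$ is an epimorphism $S\to G$ from a profinite group $S$ with $H^2(S)=0$ such that the induced map $S/T(S)\to G/T(G)$ is an isomorphism; and for $T,T_0$ normal in $G$ with $T^q[T,G]\le T_0\le T\le G^{(2)}$, a subgroup $A\le H^2(G/T)$ is dual to $(T,T_0)$ if $\ker(\mathrm{res}\colon H^1(T)^G\to H^1(T_0))=\mathrm{trg}^{ -1}(A)$, where $H^1(T)^G$ is the group of $G$-invariant homomorphisms $T\to\mathbb{Z}/q$ and $\mathrm{trg}\colon H^1(T)^G\to H^2(G/T)$ is the transgression. For $r\ge0,t\ge1$, $C_{r,t}(G)$ is the $\mathbb{Z}/q$-submodule of $H^1(G)^{\otimes r}$ generated by all $\psi_1\otimes\cdots\otimes\psi_r$ such that $\alpha_G(\psi_{i_1}\otimes\cdots\otimes\psi_{i_t})=0$ for some $1\le i_1<\dots<i_t\le r$; $H^r_{t,\alpha}(G)=H^1(G)^{\otimes r}/C_{r,t}(G)$ and $H^*_{t,\alpha}(G)=\bigoplus_r H^r_{t,\alpha}(G)$, a graded ring under tensor product, functorial in $G$ (maps induced from $H^1$). $\bar\alpha^t_G\colon H^t_{t,\alpha}(G)\to A(G)$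 is the map induced by $\alpha_G$ on $H^1(G)^{\otimes t}$. -}

module Defs where

open import Algebra.Bundles using (Group; AbelianGroup; Ring; CommutativeRing; RawGroup; RawRing)
open import Algebra.Module.Bundles using (LeftModule)
open import Algebra.Morphism.Structures using (module GroupMorphisms)
import Algebra.Properties.AbelianGroup as AbelianGroupProperties
import Algebra.Properties.CommutativeMonoid.Sum as Sum
import Algebra.Properties.CommutativeSemigroup as CommutativeSemigroupProperties
import Algebra.Properties.Group as GroupProperties
import Algebra.Properties.Monoid.Mult as Mult
open import Axiom.ExcludedMiddle using (ExcludedMiddle)
open import Data.Fin.Base as Fin using (Fin; toℕ; _↑ˡ_; _↑ʳ_)
import Data.Fin.Properties as Fin
open import Data.Integer.Base as ℤ using (ℤ; +_)
import Data.Integer.Properties as ℤ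
open import Data.Integer.Divisibility.Signed as ℤ∣ using (_∣_)
open import Data.Integer.Tactic.RingSolver using (solve-∀)
open import Data.List.Base using (List) renaming ([] to []ᴸ; _∷_ to _∷ᴸ_)
open import Data.List.Relation.Unary.Any using (Any; here; there)
open import Data.Nat.Base as ℕ using (ℕ; zero; suc)
import Data.Nat.Properties as ℕ
open import Data.Product.Base using (Σ; Σ-syntax; ∃; ∃-syntax; _×_; _,_; proj₁; proj₂)
open import Data.Sum.Base using (inj₁; inj₂)
open import Data.Unit.Polymorphic.Base using (⊤; tt)
open import Data.Vec.Functional using (Vector; _++_)
open import Data.Vec.Functional.Properties using (lookup-++ˡ; lookup-++ʳ)
open import Function.Base using (_∘_; id)
open import Function.Bundles using (_⇔_)
open import Level using (Level; 0ℓ; _⊔_) renaming (suc to lsuc)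
open import Relation.Binary.Core using (Rel)
open import Relation.Binary.Definitions using (_Respects_)
open import Relation.Binary.PropositionalEquality as ≡ using (_≡_; _≢_; subst)
import Relation.Binary.Reasoning.Setoid as SetoidReasoning
open import Relation.Nullary using (¬_; yes; no; contradiction)
open import Relation.Unary using (Pred; _⊆_; _≐_; _∩_; ∁; ⋃)

-- Groups are setoid-based, so a subset of G is a predicate respecting _≈_;
-- open-resp-≈ makes every open set one.

record TopologicalGroup (ℓ : Level) : Set (lsuc (lsuc ℓ)) where
  field
    group : Group ℓ ℓ

  open Group group public

  field
    IsOpen       : Pred Carrier ℓ → Set (lsuc ℓ)
    open-resp-≈  : ∀ {U} → IsOpen U → U Respects _≈_
    open-resp-≐  : ∀ {U V} → U ≐ V → IsOpen U → IsOpen V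
    open-⊤       : IsOpen (λ _ → ⊤)
    open-∩       : ∀ {U V} → IsOpen U → IsOpen V → IsOpen (U ∩ V)
    open-⋃       : {I : Set ℓ} {U : I → Pred Carrier ℓ} → (∀ i → IsOpen (U i)) → IsOpen (⋃ I U)
    ∙-continuous : ∀ {W} → IsOpen W → ∀ {x y} → W (x ∙ y) →
                   Σ[ U ∈ Pred Carrier ℓ ] Σ[ V ∈ Pred Carrier ℓ ]
                     IsOpen U × IsOpen V × U x × V y ×
                     (∀ {x′ y′} → U x′ → V y′ → W (x′ ∙ y′))
    ⁻¹-continuous : ∀ {U} → IsOpen U → IsOpen (λ x → U (x ⁻¹))

  private
    open module P = GroupProperties group using (\\-leftDividesˡ)
    open module ≈-Reasoning = SetoidReasoning setoid

  cancel-mid : ∀ x y z → (x ∙ y) ∙ (y ⁻¹ ∙ z) ≈ x ∙ z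
  cancel-mid x y z = begin
    (x ∙ y) ∙ (y ⁻¹ ∙ z) ≈⟨ assoc x y (y ⁻¹ ∙ z) ⟩
    x ∙ (y ∙ (y ⁻¹ ∙ z)) ≈⟨ ∙-congˡ (\\-leftDividesˡ y z) ⟩
    x ∙ z                ∎

  open-translateʳ : ∀ {U} n → IsOpen U → IsOpen (λ x → U (x ∙ n))
  open-translateʳ {U} n U-open =
    open-resp-≐ ((λ { ((x , ux) , vx) → near-⊆ x ux vx }) , (λ {x} ux → (x , ux) , near-∋ x ux))
                (open-⋃ {I = Σ[ x ∈ Carrier ] U (x ∙ n)} {U = λ { (x , ux) → near x ux }}
                        (λ { (x , ux) → near-open x ux }))
    where
    near : ∀ x → U (x ∙ n) → Pred Carrier ℓ
    near x ux = proj₁ (∙-continuous U-open ux)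
    near-open : ∀ x ux → IsOpen (near x ux)
    near-open x ux = let (_ , _ , o , _) = ∙-continuous U-open ux in o
    near-∋ : ∀ x ux → near x ux x
    near-∋ x ux = let (_ , _ , _ , _ , m , _) = ∙-continuous U-open ux in m
    near-⊆ : ∀ x ux {y} → near x ux y → U (y ∙ n)
    near-⊆ x ux vy = let (_ , _ , _ , _ , _ , m , f) = ∙-continuous U-open ux in f vy m

  open-translateˡ : ∀ {U} n → IsOpen U → IsOpen (λ x → U (n ∙ x))
  open-translateˡ {U} n U-open =
    open-resp-≐ ((λ { ((x , ux) , vx) → near-⊆ x ux vx }) , (λ {x} ux → (x , ux) , near-∋ x ux))
                (open-⋃ {I = Σ[ x ∈ Carrier ] U (n ∙ x)} {U = λ { (x , ux) → near x ux }}
                        (λ { (x , ux) → near-open x ux }))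
    where
    near : ∀ x → U (n ∙ x) → Pred Carrier ℓ
    near x ux = proj₁ (proj₂ (∙-continuous U-open ux))
    near-open : ∀ x ux → IsOpen (near x ux)
    near-open x ux = let (_ , _ , _ , o , _) = ∙-continuous U-open ux in o
    near-∋ : ∀ x ux → near x ux x
    near-∋ x ux = let (_ , _ , _ , _ , _ , m , _) = ∙-continuous U-open ux in m
    near-⊆ : ∀ x ux {y} → near x ux y → U (n ∙ y)
    near-⊆ x ux vy = let (_ , _ , _ , _ , m , _ , f) = ∙-continuous U-open ux in f m vy

record Subgroup {ℓ} (G : TopologicalGroup ℓ) : Set (lsuc ℓ) where
  open TopologicalGroup G
  field
    Mem   : Pred Carrier ℓ
    resp  : Mem Respects _≈_
    ε∈    : Mem ε
    ∙∈    : ∀ {x y} → Mem x → Mem y → Mem (x ∙ y)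
    ⁻¹∈   : ∀ {x} → Mem x → Mem (x ⁻¹)

IsNormal : ∀ {ℓ} {G : TopologicalGroup ℓ} → Subgroup G → Set ℓ
IsNormal {G = G} N = ∀ g {x} → Mem x → Mem ((g ∙ x) ∙ g ⁻¹)
  where open TopologicalGroup G; open Subgroup N

IsClosed : ∀ {ℓ} (G : TopologicalGroup ℓ) → Pred (TopologicalGroup.Carrier G) ℓ → Set (lsuc ℓ)
IsClosed G S = TopologicalGroup.IsOpen G (∁ S)

IsCompact : ∀ {ℓ} → TopologicalGroup ℓ → Set (lsuc ℓ)
IsCompact {ℓ} G =
  {I : Set ℓ} (U : I → Pred Carrier ℓ) → (∀ i → IsOpen (U i)) → (∀ x → ∃[ i ] U i x) →
  Σ[ is ∈ List I ] (∀ x → Any (λ i → U i x) is)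
  where open TopologicalGroup G

IsHausdorff : ∀ {ℓ} → TopologicalGroup ℓ → Set (lsuc ℓ)
IsHausdorff {ℓ} G =
  ∀ x y → ¬ (x ≈ y) →
  Σ[ U ∈ Pred Carrier ℓ ] Σ[ V ∈ Pred Carrier ℓ ]
    IsOpen U × IsOpen V × U x × V y × (∀ {z} → U z → ¬ V z)
  where open TopologicalGroup G

-- A profinite group is a compact Hausdorff topological group whose open
-- subgroups form a base of neighbourhoods of the identity.

record ProfiniteGroup (ℓ : Level) : Set (lsuc (lsuc ℓ)) where
  field
    topologicalGroup : TopologicalGroup ℓ

  open TopologicalGroup topologicalGroup public

  field
    compact        : IsCompact topologicalGroup
    hausdorff      : IsHausdorff topologicalGroup
    open-subgroups : ∀ {U} → IsOpen U → U ε →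
                     Σ[ H ∈ Subgroup topologicalGroup ]
                       IsOpen (Subgroup.Mem H) × Subgroup.Mem H ⊆ U

record ClosedSubgroup {ℓ} (G : ProfiniteGroup ℓ) : Set (lsuc ℓ) where
  open ProfiniteGroup G
  field
    subgroup : Subgroup topologicalGroup
    closed   : IsClosed topologicalGroup (Subgroup.Mem subgroup)

  open Subgroup subgroup public

  Normal : Set ℓ
  Normal = IsNormal subgroup

subspace : ∀ {ℓ} {G : TopologicalGroup ℓ} → Subgroup G → TopologicalGroup ℓ
subspace {ℓ} {G} H = record
  { group = record
    { Carrier = Σ Carrier Mem
    ; _≈_     = λ x y → proj₁ x ≈ proj₁ y
    ; _∙_     = λ (x , hx) (y , hy) → x ∙ y , ∙∈ hx hy
    ; ε       = ε , ε∈
    ; _⁻¹     = λ (x , hx) → x ⁻¹ , ⁻¹∈ hx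
    ; isGroup = record
      { isMonoid = record
        { isSemigroup = record
          { isMagma = record
            { isEquivalence = record { refl = refl ; sym = sym ; trans = trans }
            ; ∙-cong = ∙-cong
            }
          ; assoc = λ x y z → assoc (proj₁ x) (proj₁ y) (proj₁ z)
          }
        ; identity = (λ x → identityˡ (proj₁ x)) , (λ x → identityʳ (proj₁ x))
        }
      ; inverse = (λ x → inverseˡ (proj₁ x)) , (λ x → inverseʳ (proj₁ x))
      ; ⁻¹-cong = ⁻¹-cong
      }
    }
  ; IsOpen = λ U → Σ[ V ∈ Pred Carrier ℓ ] IsOpen V × U ≐ (λ x → V (proj₁ x))
  ; open-resp-≈ = λ (V , V-open , f , g) x≈y ux → g (open-resp-≈ V-open x≈y (f ux))
  ; open-resp-≐ = λ (f′ , g′) (V , V-open , f , g) →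
      V , V-open , (λ x → f (g′ x)) , (λ x → f′ (g x))
  ; open-⊤ = (λ _ → ⊤) , open-⊤ , (λ _ → tt) , (λ _ → tt)
  ; open-∩ = λ (V , V-open , f , g) (V′ , V′-open , f′ , g′) →
      (V ∩ V′) , open-∩ V-open V′-open ,
      (λ (u , u′) → f u , f′ u′) , (λ (v , v′) → g v , g′ v′)
  ; open-⋃ = λ {I} o →
      ⋃ I (λ i → proj₁ (o i)) , open-⋃ (λ i → proj₁ (proj₂ (o i))) ,
      (λ (i , u) → i , proj₁ (proj₂ (proj₂ (o i))) u) ,
      (λ (i , v) → i , proj₂ (proj₂ (proj₂ (o i))) v)
  ; ∙-continuous = λ (W , W-open , f , g) w →
      let (U , V , U-open , V-open , ux , vy , m) = ∙-continuous W-open (f w) in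
      (λ x → U (proj₁ x)) , (λ y → V (proj₁ y)) ,
      (U , U-open , (λ u → u) , (λ u → u)) , (V , V-open , (λ v → v) , (λ v → v)) ,
      ux , vy , (λ u v → g (m u v))
  ; ⁻¹-continuous = λ (V , V-open , f , g) →
      (λ x → V (x ⁻¹)) , ⁻¹-continuous V-open , (λ u → f u) , (λ v → g v)
  }
  where open TopologicalGroup G; open Subgroup H

module _ {ℓ} (G : TopologicalGroup ℓ) (N : Subgroup G) (N-normal : IsNormal N) where
  open TopologicalGroup G
  open Subgroup N
  open GroupProperties group
  open SetoidReasoning setoid

  infix 4 _∼_
  _∼_ : Rel Carrier ℓ
  x ∼ y = Mem (x ⁻¹ ∙ y)

  private
    conj : ∀ g {x} → Mem x → Mem (g ⁻¹ ∙ (x ∙ g))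
    conj g {x} mx = resp
      (trans (∙-congˡ (⁻¹-involutive g)) (assoc (g ⁻¹) x g))
      (N-normal (g ⁻¹) mx)

    ≈⇒∼ : ∀ {x y} → x ≈ y → x ∼ y
    ≈⇒∼ {x} x≈y = resp (trans (sym (inverseˡ x)) (∙-congˡ x≈y)) ε∈

    ∼-sym : ∀ {x y} → x ∼ y → y ∼ x
    ∼-sym {x} {y} m = resp (⁻¹-anti-homo-\\ x y) (⁻¹∈ m)

    ∼-trans : ∀ {x y z} → x ∼ y → y ∼ z → x ∼ z
    ∼-trans {x} {y} {z} m m′ = resp (cancel-mid (x ⁻¹) y z) (∙∈ m m′)

    ∼-∙-cong : ∀ {x y u v} → x ∼ y → u ∼ v → x ∙ u ∼ y ∙ v
    ∼-∙-cong {x} {y} {u} {v} m m′ = resp eq (∙∈ (conj u m) m′)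
      where
      eq : (u ⁻¹ ∙ ((x ⁻¹ ∙ y) ∙ u)) ∙ (u ⁻¹ ∙ v) ≈ (x ∙ u) ⁻¹ ∙ (y ∙ v)
      eq = begin
        (u ⁻¹ ∙ ((x ⁻¹ ∙ y) ∙ u)) ∙ (u ⁻¹ ∙ v) ≈⟨ assoc _ _ _ ⟩
        u ⁻¹ ∙ (((x ⁻¹ ∙ y) ∙ u) ∙ (u ⁻¹ ∙ v)) ≈⟨ ∙-congˡ (cancel-mid _ u v) ⟩
        u ⁻¹ ∙ ((x ⁻¹ ∙ y) ∙ v)                ≈⟨ ∙-congˡ (assoc _ _ _) ⟩
        u ⁻¹ ∙ (x ⁻¹ ∙ (y ∙ v))                ≈⟨ assoc _ _ _ ⟨
        (u ⁻¹ ∙ x ⁻¹) ∙ (y ∙ v)                ≈⟨ ∙-congʳ (⁻¹-anti-homo-∙ x u) ⟨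
        (x ∙ u) ⁻¹ ∙ (y ∙ v)                   ∎

    ∼-⁻¹-cong : ∀ {x y} → x ∼ y → x ⁻¹ ∼ y ⁻¹
    ∼-⁻¹-cong {x} {y} m = resp eq (N-normal x (∼-sym m))
      where
      eq : (x ∙ (y ⁻¹ ∙ x)) ∙ x ⁻¹ ≈ (x ⁻¹) ⁻¹ ∙ y ⁻¹
      eq = begin
        (x ∙ (y ⁻¹ ∙ x)) ∙ x ⁻¹ ≈⟨ assoc _ _ _ ⟩
        x ∙ ((y ⁻¹ ∙ x) ∙ x ⁻¹) ≈⟨ ∙-congˡ (//-rightDividesʳ x (y ⁻¹)) ⟩
        x ∙ y ⁻¹                ≈⟨ ∙-congʳ (⁻¹-involutive x) ⟨
        (x ⁻¹) ⁻¹ ∙ y ⁻¹        ∎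

  quotientGroup : Group ℓ ℓ
  quotientGroup = record
    { Carrier = Carrier
    ; _≈_     = _∼_
    ; _∙_     = _∙_
    ; ε       = ε
    ; _⁻¹     = _⁻¹
    ; isGroup = record
      { isMonoid = record
        { isSemigroup = record
          { isMagma = record
            { isEquivalence = record { refl = ≈⇒∼ refl ; sym = ∼-sym ; trans = ∼-trans }
            ; ∙-cong = ∼-∙-cong
            }
          ; assoc = λ x y z → ≈⇒∼ (assoc x y z)
          }
        ; identity = (λ x → ≈⇒∼ (identityˡ x)) , (λ x → ≈⇒∼ (identityʳ x))
        }
      ; inverse = (λ x → ≈⇒∼ (inverseˡ x)) , (λ x → ≈⇒∼ (inverseʳ x))
      ; ⁻¹-cong = ∼-⁻¹-cong
      }
    }

  -- The saturation U N of U.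
  saturate : Pred Carrier ℓ → Pred Carrier ℓ
  saturate U = ⋃ (Σ Carrier Mem) (λ n x → U (x ∙ proj₁ n))

  saturate-open : ∀ {U} → IsOpen U → IsOpen (saturate U)
  saturate-open U-open = open-⋃ (λ n → open-translateʳ (proj₁ n) U-open)

  ⊆-saturate : ∀ {U} → IsOpen U → U ⊆ saturate U
  ⊆-saturate U-open {x} ux = (ε , ε∈) , open-resp-≈ U-open (sym (identityʳ x)) ux

  saturate-resp : ∀ {U} → IsOpen U → saturate U Respects _∼_
  saturate-resp U-open {x} {y} m ((n , mn) , u) =
    (y ⁻¹ ∙ x ∙ n , ∙∈ (∼-sym m) mn) , open-resp-≈ U-open eq u
    where
    eq : x ∙ n ≈ y ∙ (y ⁻¹ ∙ x ∙ n)
    eq = sym (trans (∙-congˡ (assoc (y ⁻¹) x n)) (\\-leftDividesˡ y (x ∙ n)))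

  ∙n∼ : ∀ x {n} → Mem n → x ∙ n ∼ x
  ∙n∼ x {n} mn = ∼-sym (resp (sym (\\-leftDividesʳ x n)) mn)

  saturate-⊆ : ∀ {U V : Pred Carrier ℓ} → V Respects _∼_ → U ⊆ V → saturate U ⊆ V
  saturate-⊆ V-resp U⊆V {x} ((n , mn) , u) = V-resp (∙n∼ x mn) (U⊆V u)

  -- The open sets of G/N, seen in G, are the N-saturated open sets of G.
  quotientTop : TopologicalGroup ℓ
  quotientTop = record
    { group = quotientGroup
    ; IsOpen = λ U → IsOpen U × U Respects _∼_
    ; open-resp-≈ = proj₂
    ; open-resp-≐ = λ (f , g) (o , r) → open-resp-≐ (f , g) o , (λ m v → f (r m (g v)))
    ; open-⊤ = open-⊤ , (λ _ _ → tt)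
    ; open-∩ = λ (o , r) (o′ , r′) → open-∩ o o′ , (λ m (u , v) → r m u , r′ m v)
    ; open-⋃ = λ o → open-⋃ (λ i → proj₁ (o i)) , (λ m (i , u) → i , proj₂ (o i) m u)
    ; ∙-continuous = λ (W-open , W-resp) w →
        let (U , V , U-open , V-open , ux , vy , f) = ∙-continuous W-open w in
        saturate U , saturate V ,
        (saturate-open U-open , saturate-resp U-open) ,
        (saturate-open V-open , saturate-resp V-open) ,
        ⊆-saturate U-open ux , ⊆-saturate V-open vy ,
        (λ { {x′} {y′} ((n , mn) , u) ((n′ , mn′) , v) →
             W-resp (∼-∙-cong (∙n∼ x′ mn) (∙n∼ y′ mn′)) (f u v) })
    ; ⁻¹-continuous = λ (o , r) → ⁻¹-continuous o , (λ m u → r (∼-⁻¹-cong m) u)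
    }

  saturateSubgroup : (H : Subgroup G) → IsOpen (Subgroup.Mem H) → Subgroup quotientTop
  saturateSubgroup H H-open = record
    { Mem  = saturate H.Mem
    ; resp = saturate-resp H-open
    ; ε∈   = ⊆-saturate H-open H.ε∈
    ; ∙∈   = λ { {x} {y} ((n , mn) , h) ((n′ , mn′) , h′) →
               saturate-resp H-open (∼-∙-cong (∙n∼ x mn) (∙n∼ y mn′))
                 (⊆-saturate H-open (H.∙∈ h h′)) }
    ; ⁻¹∈  = λ { {x} ((n , mn) , h) →
               saturate-resp H-open (∼-⁻¹-cong (∙n∼ x mn)) (⊆-saturate H-open (H.⁻¹∈ h)) }
    }
    where module H = Subgroup H

infixl 7 _/_
_/_ : ∀ {ℓ} (G : ProfiniteGroup ℓ) → Σ (ClosedSubgroup G) ClosedSubgroup.Normal → ProfiniteGroup ℓ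
_/_ {ℓ} G (N , N-normal) = record
  { topologicalGroup = G/N
  ; compact = λ U o → compact U (λ i → proj₁ (o i))
  ; hausdorff = λ x y x≁y →
      let (U , V , U-open , V-open , ux⁻¹ , vy , f) =
            TopologicalGroup.∙-continuous G/N (closed , ∁-resp) {x ⁻¹} {y} x≁y in
      (λ z → U (z ⁻¹)) , V ,
      TopologicalGroup.⁻¹-continuous G/N U-open , V-open , ux⁻¹ , vy ,
      (λ {z} u v → f u v (resp (sym (inverseˡ z)) ε∈))
  ; open-subgroups = λ {U} (U-open , U-resp) uε →
      let (H , H-open , H⊆U) = open-subgroups U-open uε in
      saturateSubgroup Gᵗ subgroup N-normal H H-open ,
      (saturate-open Gᵗ subgroup N-normal H-open , saturate-resp Gᵗ subgroup N-normal H-open) ,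
      saturate-⊆ Gᵗ subgroup N-normal U-resp H⊆U
  }
  where
  open ProfiniteGroup G
  open ClosedSubgroup N
  open GroupProperties group
  open SetoidReasoning setoid
  Gᵗ = topologicalGroup
  G/N = quotientTop Gᵗ subgroup N-normal
  ∁-resp : ∁ Mem Respects _∼_ Gᵗ subgroup N-normal
  ∁-resp {x} {y} m ¬x my =
    ¬x (resp eq (∙∈ my (⁻¹∈ m)))
    where
    eq : y ∙ (x ⁻¹ ∙ y) ⁻¹ ≈ x
    eq = begin
      y ∙ (x ⁻¹ ∙ y) ⁻¹ ≈⟨ ∙-congˡ (⁻¹-anti-homo-\\ x y) ⟩
      y ∙ (y ⁻¹ ∙ x)    ≈⟨ \\-leftDividesˡ y x ⟩
      x                 ∎

record ContinuousHom {ℓ} (G H : TopologicalGroup ℓ) : Set (lsuc ℓ) where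
  private
    module G = TopologicalGroup G
    module H = TopologicalGroup H
  field
    ⟦_⟧        : G.Carrier → H.Carrier
    cong       : ∀ {x y} → x G.≈ y → ⟦ x ⟧ H.≈ ⟦ y ⟧
    homo       : ∀ x y → ⟦ x G.∙ y ⟧ H.≈ ⟦ x ⟧ H.∙ ⟦ y ⟧
    continuous : ∀ {U} → H.IsOpen U → G.IsOpen (λ x → U ⟦ x ⟧)

  ε-homo : ⟦ G.ε ⟧ H.≈ H.ε
  ε-homo = begin
    e                    ≈⟨ \\-leftDividesʳ e e ⟨
    e H.⁻¹ H.∙ (e H.∙ e) ≈⟨ H.∙-congˡ (homo G.ε G.ε) ⟨
    e H.⁻¹ H.∙ ⟦ G.ε G.∙ G.ε ⟧ ≈⟨ H.∙-congˡ (cong (G.identityˡ G.ε)) ⟩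
    e H.⁻¹ H.∙ e         ≈⟨ H.inverseˡ e ⟩
    H.ε                  ∎
    where
    open GroupProperties H.group
    open SetoidReasoning H.setoid
    e = ⟦ G.ε ⟧

  ⁻¹-homo : ∀ x → ⟦ x G.⁻¹ ⟧ H.≈ ⟦ x ⟧ H.⁻¹
  ⁻¹-homo x = GroupProperties.inverseˡ-unique H.group _ _
    (H.trans (H.sym (homo (x G.⁻¹) x)) (H.trans (cong (G.inverseˡ x)) ε-homo))

  IsSurjective : Set ℓ
  IsSurjective = ∀ y → ∃[ x ] ⟦ x ⟧ H.≈ y

  image : Pred G.Carrier ℓ → Pred H.Carrier ℓ
  image S y = ∃[ x ] S x × ⟦ x ⟧ H.≈ y

  record IsIsomorphism : Set (lsuc ℓ) where
    field
      injective  : ∀ {x y} → ⟦ x ⟧ H.≈ ⟦ y ⟧ → x G.≈ y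
      surjective : IsSurjective
      open-map   : ∀ {U} → G.IsOpen U → H.IsOpen (image U)

infix 4 _⇒_
_⇒_ : ∀ {ℓ} → ProfiniteGroup ℓ → ProfiniteGroup ℓ → Set (lsuc ℓ)
G ⇒ H = ContinuousHom (ProfiniteGroup.topologicalGroup G) (ProfiniteGroup.topologicalGroup H)

projection : ∀ {ℓ} (G : ProfiniteGroup ℓ) (N : Σ (ClosedSubgroup G) ClosedSubgroup.Normal) → G ⇒ G / N
projection G N = record
  { ⟦_⟧        = id
  ; cong       = λ x≈y → resp (trans (sym (inverseˡ _)) (∙-congˡ x≈y)) ε∈
  ; homo       = λ x y → ProfiniteGroup.refl (G / N)
  ; continuous = proj₁
  }
  where open ProfiniteGroup G; open ClosedSubgroup (proj₁ N)

inclusion : ∀ {ℓ} {G : TopologicalGroup ℓ} (H K : Subgroup G) → Subgroup.Mem H ⊆ Subgroup.Mem K →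
            ContinuousHom (subspace H) (subspace K)
inclusion {G = G} H K H≤K = record
  { ⟦_⟧        = λ (x , hx) → x , H≤K hx
  ; cong       = id
  ; homo       = λ _ _ → refl
  ; continuous = λ (V , V-open , f , g) → V , V-open , (λ u → f u) , (λ v → g v)
  }
  where open TopologicalGroup G

-- The map G/M → H/N induced by π : G → H with π(M) ⊆ N.
induced : ∀ {ℓ} {G H : ProfiniteGroup ℓ} (π : G ⇒ H)
          (M : Σ (ClosedSubgroup G) ClosedSubgroup.Normal)
          (N : Σ (ClosedSubgroup H) ClosedSubgroup.Normal) →
          (∀ {x} → ClosedSubgroup.Mem (proj₁ M) x →
                   ClosedSubgroup.Mem (proj₁ N) (ContinuousHom.⟦_⟧ π x)) →
          G / M ⇒ H / N
induced {G = G} {H} π M N π[M]⊆N = record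
  { ⟦_⟧        = ⟦_⟧
  ; cong       = λ m → ∼-cong m
  ; homo       = λ x y → resp (H.trans (H.sym (H.inverseˡ _)) (H.∙-congˡ (homo x y))) ε∈
  ; continuous = λ (U-open , U-resp) → continuous U-open , (λ m → U-resp (∼-cong m))
  }
  where
  open ContinuousHom π
  module G = ProfiniteGroup G
  module H = ProfiniteGroup H
  open ClosedSubgroup (proj₁ N)
  ∼-cong : ∀ {x y} → ClosedSubgroup.Mem (proj₁ M) (x G.⁻¹ G.∙ y) → Mem (⟦ x ⟧ H.⁻¹ H.∙ ⟦ y ⟧)
  ∼-cong {x} {y} m = resp (H.trans (homo _ _) (H.∙-congʳ (⁻¹-homo x))) (π[M]⊆N m)

module _ {ℓ} (G : TopologicalGroup ℓ) where
  open TopologicalGroup G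
  open Mult monoid using () renaming (_×_ to _times_)

  data Generated (S : Pred Carrier ℓ) : Pred Carrier ℓ where
    gen  : ∀ {x} → S x → Generated S x
    resp : ∀ {x y} → x ≈ y → Generated S x → Generated S y
    ε∈   : Generated S ε
    ∙∈   : ∀ {x y} → Generated S x → Generated S y → Generated S (x ∙ y)
    ⁻¹∈  : ∀ {x} → Generated S x → Generated S (x ⁻¹)

  closure : Pred Carrier ℓ → Pred Carrier (lsuc ℓ)
  closure S x = ∀ {U} → IsOpen U → U x → ∃[ y ] U y × S y

  -- In this multiplicative notation, q times x is the power x^q.
  data PowersAndCommutators (q : ℕ) (S : Pred Carrier ℓ) : Pred Carrier ℓ where
    power      : ∀ {x} → S x → PowersAndCommutators q S (q times x)
    commutator : ∀ {x} → S x → ∀ g →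
                 PowersAndCommutators q S (((x ⁻¹ ∙ g ⁻¹) ∙ x) ∙ g)

  -- The closed subgroup S^q[S,G] of G.
  powerCommutator : ℕ → Pred Carrier ℓ → Pred Carrier (lsuc ℓ)
  powerCommutator q S = closure (Generated (PowersAndCommutators q S))

  -- G^(2) = G^q[G,G]
  qCentral² : ℕ → Pred Carrier (lsuc ℓ)
  qCentral² q = powerCommutator q (λ _ → ⊤)

infix 4 _≡_[mod_]
record _≡_[mod_] (x y : ℤ) (q : ℕ) : Set where
  constructor mod
  field
    divides : + q ∣ x ℤ.- y

ℤ/_ : ℕ → CommutativeRing 0ℓ 0ℓ
ℤ/ q = record
  { Carrier = ℤ
  ; _≈_ = _≡_[mod q ]
  ; _+_ = ℤ._+_
  ; _*_ = ℤ._*_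
  ; -_  = ℤ.-_
  ; 0#  = + 0
  ; 1#  = + 1
  ; isCommutativeRing = record
    { isRing = record
      { +-isAbelianGroup = record
        { isGroup = record
          { isMonoid = record
            { isSemigroup = record
              { isMagma = record
                { isEquivalence = record
                  { refl  = from-≡ ≡.refl
                  ; sym   = λ {x} {y} (mod d) → mod (subst (+ q ∣_) (sym-eq x y) (ℤ∣.∣m⇒∣-m d))
                  ; trans = λ {x} {y} {z} (mod d) (mod d′) → mod (subst (+ q ∣_) (trans-eq x y z) (ℤ∣.∣m∣n⇒∣m+n d d′))
                  }
                ; ∙-cong = λ {x} {y} {u} {v} (mod d) (mod d′) → mod (subst (+ q ∣_) (+-eq x y u v) (ℤ∣.∣m∣n⇒∣m+n d d′))
                }
              ; assoc = λ x y z → from-≡ (ℤ.+-assoc x y z)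
              }
            ; identity = (λ x → from-≡ (ℤ.+-identityˡ x)) , (λ x → from-≡ (ℤ.+-identityʳ x))
            }
          ; inverse = (λ x → from-≡ (ℤ.+-inverseˡ x)) , (λ x → from-≡ (ℤ.+-inverseʳ x))
          ; ⁻¹-cong = λ {x} {y} (mod d) → mod (subst (+ q ∣_) (neg-eq x y) (ℤ∣.∣m⇒∣-m d))
          }
        ; comm = λ x y → from-≡ (ℤ.+-comm x y)
        }
      ; *-cong = λ {x} {y} {u} {v} (mod d) (mod d′) →
          mod (subst (+ q ∣_) (*-eq x y u v) (ℤ∣.∣m∣n⇒∣m+n (ℤ∣.∣m⇒∣m*n u d) (ℤ∣.∣n⇒∣m*n y d′)))
      ; *-assoc = λ x y z → from-≡ (ℤ.*-assoc x y z)
      ; *-identity = (λ x → from-≡ (ℤ.*-identityˡ x)) , (λ x → from-≡ (ℤ.*-identityʳ x))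
      ; distrib = (λ x y z → from-≡ (ℤ.*-distribˡ-+ x y z)) , (λ x y z → from-≡ (ℤ.*-distribʳ-+ x y z))
      }
    ; *-comm = λ x y → from-≡ (ℤ.*-comm x y)
    }
  }
  where
  from-≡ : ∀ {x y} → x ≡ y → x ≡ y [mod q ]
  from-≡ {x} ≡.refl = mod (subst (+ q ∣_) (≡.sym (ℤ.+-inverseʳ x)) (ℤ∣.divides (+ 0) ≡.refl))
  sym-eq : ∀ x y → ℤ.- (x ℤ.- y) ≡ y ℤ.- x
  sym-eq = solve-∀
  trans-eq : ∀ x y z → (x ℤ.- y) ℤ.+ (y ℤ.- z) ≡ x ℤ.- z
  trans-eq = solve-∀
  +-eq : ∀ x y u v → (x ℤ.- y) ℤ.+ (u ℤ.- v) ≡ (x ℤ.+ u) ℤ.- (y ℤ.+ v)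
  +-eq = solve-∀
  neg-eq : ∀ x y → ℤ.- (x ℤ.- y) ≡ (ℤ.- x) ℤ.- (ℤ.- y)
  neg-eq = solve-∀
  *-eq : ∀ x y u v → (x ℤ.- y) ℤ.* u ℤ.+ y ℤ.* (u ℤ.- v) ≡ x ℤ.* u ℤ.- y ℤ.* v
  *-eq = solve-∀

-- Continuous cohomology of a topological group in degrees 1 and 2 with
-- coefficients in a discrete ring K with trivial action
module Cohomology (K : CommutativeRing 0ℓ 0ℓ) where

  private
    module K = CommutativeRing K
    open K using (_≈_; _+_; _*_; -_; 0#)
    open AbelianGroupProperties K.+-abelianGroup using (⁻¹-∙-comm)
    open CommutativeSemigroupProperties K.+-commutativeSemigroup using (interchange)

  module _ {ℓ} (G : TopologicalGroup ℓ) where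
    private module G = TopologicalGroup G

    -- Continuity of maps into a discrete space.

    LocallyConstant : (G.Carrier → K.Carrier) → Set (lsuc ℓ)
    LocallyConstant f = ∀ x →
      Σ[ U ∈ Pred G.Carrier ℓ ] G.IsOpen U × U x × (∀ {x′} → U x′ → f x′ ≈ f x)

    LocallyConstant₂ : (G.Carrier → G.Carrier → K.Carrier) → Set (lsuc ℓ)
    LocallyConstant₂ f = ∀ x y →
      Σ[ U ∈ Pred G.Carrier ℓ ] Σ[ V ∈ Pred G.Carrier ℓ ]
        G.IsOpen U × G.IsOpen V × U x × V y × (∀ {x′ y′} → U x′ → V y′ → f x′ y′ ≈ f x y)

    record Cochain¹ : Set (lsuc ℓ) where
      no-eta-equality
      field
        fun        : G.Carrier → K.Carrier
        cong       : ∀ {x y} → x G.≈ y → fun x ≈ fun y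
        continuous : LocallyConstant fun

    -- The action being trivial, 1-cocycles are homomorphisms and
    -- 1-coboundaries vanish.
    record Hom¹ : Set (lsuc ℓ) where
      no-eta-equality
      field
        cochain : Cochain¹
      open Cochain¹ cochain public
      field
        homo : ∀ x y → fun (x G.∙ y) ≈ fun x + fun y

    record Cocycle² : Set (lsuc ℓ) where
      no-eta-equality
      field
        fun        : G.Carrier → G.Carrier → K.Carrier
        cong       : ∀ {x y u v} → x G.≈ y → u G.≈ v → fun x u ≈ fun y v
        continuous : LocallyConstant₂ fun
        cocycle    : ∀ x y z → fun y z + fun x (y G.∙ z) ≈ fun (x G.∙ y) z + fun x y

    open Cochain¹
    open Hom¹ using (cochain; homo)
    open Cocycle² using (cocycle)

    ∂ : Cochain¹ → G.Carrier → G.Carrier → K.Carrier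
    ∂ b x y = (fun b y + - fun b (x G.∙ y)) + fun b x

    add¹ : Cochain¹ → Cochain¹ → Cochain¹
    add¹ f g .fun x = fun f x + fun g x
    add¹ f g .cong e = K.+-cong (cong f e) (cong g e)
    add¹ f g .continuous x =
      let (U , Uo , ux , u) = continuous f x
          (V , Vo , vx , v) = continuous g x
      in (U ∩ V) , G.open-∩ Uo Vo , (ux , vx) , (λ (p , p′) → K.+-cong (u p) (v p′))

    zero¹ : Cochain¹
    zero¹ .fun _ = 0#
    zero¹ .cong _ = K.refl
    zero¹ .continuous _ = (λ _ → ⊤) , G.open-⊤ , tt , (λ _ → K.refl)

    neg¹ : Cochain¹ → Cochain¹
    neg¹ f .fun x = - fun f x
    neg¹ f .cong e = K.-‿cong (cong f e)
    neg¹ f .continuous x = let (U , Uo , ux , u) = continuous f x in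
      U , Uo , ux , (λ p → K.-‿cong (u p))

    scale¹ : K.Carrier → Cochain¹ → Cochain¹
    scale¹ c f .fun x = c * fun f x
    scale¹ c f .cong e = K.*-congˡ (cong f e)
    scale¹ c f .continuous x = let (U , Uo , ux , u) = continuous f x in
      U , Uo , ux , (λ p → K.*-congˡ (u p))

    addᴴ : Hom¹ → Hom¹ → Hom¹
    addᴴ f g .cochain = add¹ (cochain f) (cochain g)
    addᴴ f g .homo x y = K.trans (K.+-cong (homo f x y) (homo g x y)) (interchange _ _ _ _)

    zeroᴴ : Hom¹
    zeroᴴ .cochain = zero¹
    zeroᴴ .homo x y = K.sym (K.+-identityˡ 0#)

    negᴴ : Hom¹ → Hom¹
    negᴴ f .cochain = neg¹ (cochain f)
    negᴴ f .homo x y = K.trans (K.-‿cong (homo f x y)) (K.sym (⁻¹-∙-comm _ _))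

    scaleᴴ : K.Carrier → Hom¹ → Hom¹
    scaleᴴ c f .cochain = scale¹ c (cochain f)
    scaleᴴ c f .homo x y = K.trans (K.*-congˡ (homo f x y)) (K.distribˡ _ _ _)

    H¹ : LeftModule K.ring (lsuc ℓ) ℓ
    H¹ = record
      { Carrierᴹ = Hom¹
      ; _≈ᴹ_ = λ f g → ∀ x → fun (cochain f) x ≈ fun (cochain g) x
      ; _+ᴹ_ = addᴴ
      ; _*ₗ_ = scaleᴴ
      ; 0ᴹ   = zeroᴴ
      ; -ᴹ_  = negᴴ
      ; isLeftModule = record
        { isLeftSemimodule = record
          { +ᴹ-isCommutativeMonoid = record
            { isMonoid = record
              { isSemigroup = record
                { isMagma = record
                  { isEquivalence = record
                    { refl  = λ _ → K.refl
                    ; sym   = λ e x → K.sym (e x)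
                    ; trans = λ e e′ x → K.trans (e x) (e′ x)
                    }
                  ; ∙-cong = λ e e′ x → K.+-cong (e x) (e′ x)
                  }
                ; assoc = λ _ _ _ _ → K.+-assoc _ _ _
                }
              ; identity = (λ _ _ → K.+-identityˡ _) , (λ _ _ → K.+-identityʳ _)
              }
            ; comm = λ _ _ _ → K.+-comm _ _
            }
          ; isPreleftSemimodule = record
            { *ₗ-cong      = λ e e′ x → K.*-cong e (e′ x)
            ; *ₗ-zeroˡ     = λ _ _ → K.zeroˡ _
            ; *ₗ-distribʳ  = λ _ _ _ _ → K.distribʳ _ _ _
            ; *ₗ-identityˡ = λ _ _ → K.*-identityˡ _
            ; *ₗ-assoc     = λ _ _ _ _ → K.*-assoc _ _ _
            ; *ₗ-zeroʳ     = λ _ _ → K.zeroʳ _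
            ; *ₗ-distribˡ  = λ _ _ _ _ → K.distribˡ _ _ _
            }
          }
        ; -ᴹ‿cong    = λ e x → K.-‿cong (e x)
        ; -ᴹ‿inverse = (λ _ _ → K.-‿inverseˡ _) , (λ _ _ → K.-‿inverseʳ _)
        }
      }

    -- Cocycles are identified when they differ by the coboundary of a
    -- continuous 1-cochain.
    infix 4 _≈²_
    record _≈²_ (f g : Cocycle²) : Set (lsuc ℓ) where
      constructor cobounds
      field
        b      : Cochain¹
        f≈g+∂b : ∀ x y → Cocycle².fun f x y ≈ Cocycle².fun g x y + ∂ b x y

    private
      ∂-add : ∀ b c x y → ∂ (add¹ b c) x y ≈ ∂ b x y + ∂ c x y
      ∂-add b c x y = begin
        ((fun b y + fun c y) + - (fun b xy + fun c xy)) + (fun b x + fun c x)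
          ≈⟨ K.+-congʳ (K.+-congˡ (⁻¹-∙-comm _ _)) ⟨
        ((fun b y + fun c y) + (- fun b xy + - fun c xy)) + (fun b x + fun c x)
          ≈⟨ K.+-congʳ (interchange _ _ _ _) ⟩
        ((fun b y + - fun b xy) + (fun c y + - fun c xy)) + (fun b x + fun c x)
          ≈⟨ interchange _ _ _ _ ⟩
        ∂ b x y + ∂ c x y ∎
        where
        open SetoidReasoning K.setoid
        xy = x G.∙ y

      ∂-neg : ∀ b x y → ∂ (neg¹ b) x y ≈ - ∂ b x y
      ∂-neg b x y = K.trans (K.+-congʳ (⁻¹-∙-comm _ _)) (⁻¹-∙-comm _ _)

      ∂-zero : ∀ x y → ∂ zero¹ x y ≈ 0#
      ∂-zero x y = K.trans (K.+-identityʳ _) (K.-‿inverseʳ 0#)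

    pointwise : ∀ {f g} → (∀ x y → Cocycle².fun f x y ≈ Cocycle².fun g x y) → f ≈² g
    pointwise e = cobounds zero¹ (λ x y →
      K.trans (e x y) (K.sym (K.trans (K.+-congˡ (∂-zero x y)) (K.+-identityʳ _))))

    private
      ≈²-sym : ∀ {f g} → f ≈² g → g ≈² f
      ≈²-sym {f} {g} (cobounds b e) = cobounds (neg¹ b) λ x y → let open SetoidReasoning K.setoid in begin
        Cocycle².fun g x y                             ≈⟨ K.+-identityʳ _ ⟨
        Cocycle².fun g x y + 0#                        ≈⟨ K.+-congˡ (K.-‿inverseʳ _) ⟨
        Cocycle².fun g x y + (∂ b x y + - ∂ b x y)     ≈⟨ K.+-assoc _ _ _ ⟨
        (Cocycle².fun g x y + ∂ b x y) + - ∂ b x y     ≈⟨ K.+-cong (e x y) (∂-neg b x y) ⟨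
        Cocycle².fun f x y + ∂ (neg¹ b) x y            ∎

      ≈²-trans : ∀ {f g h} → f ≈² g → g ≈² h → f ≈² h
      ≈²-trans {f} {g} {h} (cobounds b e) (cobounds c e′) = cobounds (add¹ c b) λ x y → let open SetoidReasoning K.setoid in begin
        Cocycle².fun f x y                             ≈⟨ e x y ⟩
        Cocycle².fun g x y + ∂ b x y                   ≈⟨ K.+-congʳ (e′ x y) ⟩
        (Cocycle².fun h x y + ∂ c x y) + ∂ b x y       ≈⟨ K.+-assoc _ _ _ ⟩
        Cocycle².fun h x y + (∂ c x y + ∂ b x y)       ≈⟨ K.+-congˡ (∂-add c b x y) ⟨
        Cocycle².fun h x y + ∂ (add¹ c b) x y          ∎

    add² : Cocycle² → Cocycle² → Cocycle²
    add² f g .Cocycle².fun x y = Cocycle².fun f x y + Cocycle².fun g x y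
    add² f g .Cocycle².cong e e′ = K.+-cong (Cocycle².cong f e e′) (Cocycle².cong g e e′)
    add² f g .Cocycle².continuous x y =
      let (U , V , Uo , Vo , ux , vy , k) = Cocycle².continuous f x y
          (U′ , V′ , Uo′ , Vo′ , ux′ , vy′ , k′) = Cocycle².continuous g x y
      in (U ∩ U′) , (V ∩ V′) , G.open-∩ Uo Uo′ , G.open-∩ Vo Vo′ , (ux , ux′) , (vy , vy′) ,
         (λ (u , u′) (v , v′) → K.+-cong (k u v) (k′ u′ v′))
    add² f g .cocycle x y z =
      K.trans (interchange _ _ _ _)
        (K.trans (K.+-cong (cocycle f x y z) (cocycle g x y z)) (interchange _ _ _ _))

    zero² : Cocycle²
    zero² .Cocycle².fun _ _ = 0#
    zero² .Cocycle².cong _ _ = K.refl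
    zero² .Cocycle².continuous _ _ =
      (λ _ → ⊤) , (λ _ → ⊤) , G.open-⊤ , G.open-⊤ , tt , tt , (λ _ _ → K.refl)
    zero² .cocycle _ _ _ = K.refl

    neg² : Cocycle² → Cocycle²
    neg² f .Cocycle².fun x y = - Cocycle².fun f x y
    neg² f .Cocycle².cong e e′ = K.-‿cong (Cocycle².cong f e e′)
    neg² f .Cocycle².continuous x y =
      let (U , V , Uo , Vo , ux , vy , k) = Cocycle².continuous f x y in
      U , V , Uo , Vo , ux , vy , (λ u v → K.-‿cong (k u v))
    neg² f .cocycle x y z =
      K.trans (⁻¹-∙-comm _ _) (K.trans (K.-‿cong (cocycle f x y z)) (K.sym (⁻¹-∙-comm _ _)))

    H² : AbelianGroup (lsuc ℓ) (lsuc ℓ)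
    H² = record
      { Carrier = Cocycle²
      ; _≈_ = _≈²_
      ; _∙_ = add²
      ; ε   = zero²
      ; _⁻¹ = neg²
      ; isAbelianGroup = record
        { isGroup = record
          { isMonoid = record
            { isSemigroup = record
              { isMagma = record
                { isEquivalence = record
                  { refl  = pointwise (λ _ _ → K.refl)
                  ; sym   = ≈²-sym
                  ; trans = ≈²-trans
                  }
                ; ∙-cong = λ (cobounds b e) (cobounds c e′) → cobounds (add¹ b c) λ x y →
                    K.trans (K.+-cong (e x y) (e′ x y))
                      (K.trans (interchange _ _ _ _) (K.+-congˡ (K.sym (∂-add b c x y))))
                }
              ; assoc = λ f g h →
                  pointwise (λ _ _ → K.+-assoc _ _ _)
              }
            ; identity = (λ f → pointwise (λ _ _ → K.+-identityˡ _))
                       , (λ f → pointwise (λ _ _ → K.+-identityʳ _))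
            }
          ; inverse = (λ f → pointwise (λ _ _ → K.-‿inverseˡ _))
                    , (λ f → pointwise (λ _ _ → K.-‿inverseʳ _))
          ; ⁻¹-cong = λ (cobounds b e) → cobounds (neg¹ b) λ x y →
              K.trans (K.-‿cong (e x y))
                (K.trans (K.sym (⁻¹-∙-comm _ _)) (K.+-congˡ (K.sym (∂-neg b x y))))
          }
        ; comm = λ f g → pointwise (λ _ _ → K.+-comm _ _)
        }
      }

  module _ {ℓ} {G H : TopologicalGroup ℓ} (π : ContinuousHom G H) where
    private
      module π = ContinuousHom π
      module H = TopologicalGroup H

    Cochain¹-map : Cochain¹ H → Cochain¹ G
    Cochain¹-map b .Cochain¹.fun x = Cochain¹.fun b π.⟦ x ⟧
    Cochain¹-map b .Cochain¹.cong e = Cochain¹.cong b (π.cong e)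
    Cochain¹-map b .Cochain¹.continuous x =
      let (U , Uo , ux , u) = Cochain¹.continuous b π.⟦ x ⟧ in
      (λ x → U π.⟦ x ⟧) , π.continuous Uo , ux , (λ p → u p)

    H¹-map : Hom¹ H → Hom¹ G
    H¹-map f .Hom¹.cochain = Cochain¹-map (Hom¹.cochain f)
    H¹-map f .Hom¹.homo x y = K.trans (Hom¹.cong f (π.homo x y)) (Hom¹.homo f _ _)

    H²-map : Cocycle² H → Cocycle² G
    H²-map f .Cocycle².fun x y = Cocycle².fun f π.⟦ x ⟧ π.⟦ y ⟧
    H²-map f .Cocycle².cong e e′ = Cocycle².cong f (π.cong e) (π.cong e′)
    H²-map f .Cocycle².continuous x y =
      let (U , V , Uo , Vo , ux , vy , k) = Cocycle².continuous f π.⟦ x ⟧ π.⟦ y ⟧ in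
      (λ x → U π.⟦ x ⟧) , (λ y → V π.⟦ y ⟧) , π.continuous Uo , π.continuous Vo ,
      ux , vy , (λ u v → k u v)
    H²-map f .Cocycle².cocycle x y z =
      K.trans (K.+-congˡ (Cocycle².cong f H.refl (π.homo y z)))
        (K.trans (Cocycle².cocycle f _ _ _) (K.+-congʳ (Cocycle².cong f (H.sym (π.homo x y)) H.refl)))

    H²-map-cong : ∀ {f g} → _≈²_ H f g → _≈²_ G (H²-map f) (H²-map g)
    H²-map-cong (cobounds b e) = cobounds (Cochain¹-map b)
      (λ x y → K.trans (e _ _) (K.+-congˡ (K.+-congʳ (K.+-congˡ (K.-‿cong
        (Cochain¹.cong b (H.sym (π.homo x y))))))))

    H²-map-zero : _≈²_ G (H²-map (zero² H)) (zero² G)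
    H²-map-zero = pointwise G (λ _ _ → K.refl)

module TensorPower {k ℓk} (K : CommutativeRing k ℓk) where

  private
    module K = CommutativeRing K
    open K using (_+_; _*_; 0#; 1#)

  module _ {m ℓm} (M : LeftModule K.ring m ℓm) where
    private module M = LeftModule M

    infixl 6 _⊕_
    infixr 7 _·_
    infixr 8 ⊖_

    -- Formal K-linear combinations of pure tensors.
    data Tensor (r : ℕ) : Set (k ⊔ m) where
      pure : Vector M.Carrierᴹ r → Tensor r
      _⊕_  : Tensor r → Tensor r → Tensor r
      _·_  : K.Carrier → Tensor r → Tensor r
      𝟘    : Tensor r
      ⊖_   : Tensor r → Tensor r

  module _ {m ℓm} (M : LeftModule K.ring m ℓm) where
    private module M = LeftModule M

    -- The least congruence making Tensor M r a K-module and pure multilinear.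
    infix 4 _≈⊗_
    data _≈⊗_ {r : ℕ} : Rel (Tensor M r) (k ⊔ ℓk ⊔ m ⊔ ℓm) where
      refl⊗       : ∀ {x} → x ≈⊗ x
      sym⊗        : ∀ {x y} → x ≈⊗ y → y ≈⊗ x
      trans⊗      : ∀ {x y z} → x ≈⊗ y → y ≈⊗ z → x ≈⊗ z

      ⊕-cong      : ∀ {x y u v} → x ≈⊗ y → u ≈⊗ v → x ⊕ u ≈⊗ y ⊕ v
      ⊕-assoc     : ∀ x y z → (x ⊕ y) ⊕ z ≈⊗ x ⊕ (y ⊕ z)
      ⊕-comm      : ∀ x y → x ⊕ y ≈⊗ y ⊕ x
      ⊕-identityˡ : ∀ x → 𝟘 ⊕ x ≈⊗ x
      ⊖-cong      : ∀ {x y} → x ≈⊗ y → ⊖ x ≈⊗ ⊖ y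
      ⊖-inverseˡ  : ∀ x → ⊖ x ⊕ x ≈⊗ 𝟘

      ·-cong      : ∀ {a b x y} → a K.≈ b → x ≈⊗ y → a · x ≈⊗ b · y
      ·-assoc     : ∀ a b x → (a * b) · x ≈⊗ a · (b · x)
      ·-identityˡ : ∀ x → 1# · x ≈⊗ x
      ·-distribʳ  : ∀ x a b → (a + b) · x ≈⊗ a · x ⊕ b · x
      ·-distribˡ  : ∀ a x y → a · (x ⊕ y) ≈⊗ a · x ⊕ a · y
      ·-zeroˡ     : ∀ x → 0# · x ≈⊗ 𝟘
      ·-zeroʳ     : ∀ a → a · 𝟘 ≈⊗ 𝟘

      pure-cong   : ∀ {u v} → (∀ i → u i M.≈ᴹ v i) → pure u ≈⊗ pure v
      pure-+      : ∀ {u v w} i → u i M.≈ᴹ v i M.+ᴹ w i →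
                    (∀ j → j ≢ i → u j M.≈ᴹ v j × u j M.≈ᴹ w j) →
                    pure u ≈⊗ pure v ⊕ pure w
      pure-·      : ∀ {u v} a i → u i M.≈ᴹ a M.*ₗ v i →
                    (∀ j → j ≢ i → u j M.≈ᴹ v j) →
                    pure u ≈⊗ a · pure v

    infix 9 _^⊗_
    _^⊗_ : ℕ → LeftModule K.ring (k ⊔ m) (k ⊔ ℓk ⊔ m ⊔ ℓm)
    _^⊗_ r = record
      { Carrierᴹ = Tensor M r
      ; _≈ᴹ_ = _≈⊗_
      ; _+ᴹ_ = _⊕_
      ; _*ₗ_ = _·_
      ; 0ᴹ   = 𝟘
      ; -ᴹ_  = ⊖_
      ; isLeftModule = record
        { isLeftSemimodule = record
          { +ᴹ-isCommutativeMonoid = record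
            { isMonoid = record
              { isSemigroup = record
                { isMagma = record
                  { isEquivalence = record { refl = refl⊗ ; sym = sym⊗ ; trans = trans⊗ }
                  ; ∙-cong = ⊕-cong
                  }
                ; assoc = ⊕-assoc
                }
              ; identity = ⊕-identityˡ , (λ x → trans⊗ (⊕-comm x 𝟘) (⊕-identityˡ x))
              }
            ; comm = ⊕-comm
            }
          ; isPreleftSemimodule = record
            { *ₗ-cong      = ·-cong
            ; *ₗ-zeroˡ     = ·-zeroˡ
            ; *ₗ-distribʳ  = ·-distribʳ
            ; *ₗ-identityˡ = ·-identityˡ
            ; *ₗ-assoc     = ·-assoc
            ; *ₗ-zeroʳ     = ·-zeroʳ
            ; *ₗ-distribˡ  = ·-distribˡ
            }
          }
        ; -ᴹ‿cong    = ⊖-cong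
        ; -ᴹ‿inverse = ⊖-inverseˡ , (λ x → trans⊗ (⊕-comm x (⊖ x)) (⊖-inverseˡ x))
        }
      }

  module _ {m ℓm n ℓn} {M : LeftModule K.ring m ℓm} {N : LeftModule K.ring n ℓn} where

    Tensor-map : (LeftModule.Carrierᴹ M → LeftModule.Carrierᴹ N) → ∀ {r} → Tensor M r → Tensor N r
    Tensor-map f (pure v) = pure (f ∘ v)
    Tensor-map f (x ⊕ y)  = Tensor-map f x ⊕ Tensor-map f y
    Tensor-map f (a · x)  = a · Tensor-map f x
    Tensor-map f 𝟘        = 𝟘
    Tensor-map f (⊖ x)    = ⊖ Tensor-map f x

    module _ {f : LeftModule.Carrierᴹ M → LeftModule.Carrierᴹ N} where
      private
        module M = LeftModule M
        module N = LeftModule N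

      Tensor-map-cong : (∀ {x y} → x M.≈ᴹ y → f x N.≈ᴹ f y) →
                        (∀ x y → f (x M.+ᴹ y) N.≈ᴹ f x N.+ᴹ f y) →
                        (∀ a x → f (a M.*ₗ x) N.≈ᴹ a N.*ₗ f x) →
                        ∀ {r} {x y : Tensor M r} → _≈⊗_ M x y → _≈⊗_ N (Tensor-map f x) (Tensor-map f y)
      Tensor-map-cong f-cong f-+ f-* = go
        where
        go : ∀ {r} {x y : Tensor M r} → _≈⊗_ M x y → _≈⊗_ N (Tensor-map f x) (Tensor-map f y)
        go refl⊗ = refl⊗
        go (sym⊗ e) = sym⊗ (go e)
        go (trans⊗ e e′) = trans⊗ (go e) (go e′)
        go (⊕-cong e e′) = ⊕-cong (go e) (go e′)
        go (⊕-assoc _ _ _) = ⊕-assoc _ _ _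
        go (⊕-comm _ _) = ⊕-comm _ _
        go (⊕-identityˡ _) = ⊕-identityˡ _
        go (⊖-cong e) = ⊖-cong (go e)
        go (⊖-inverseˡ _) = ⊖-inverseˡ _
        go (·-cong e e′) = ·-cong e (go e′)
        go (·-assoc a b _) = ·-assoc a b _
        go (·-identityˡ _) = ·-identityˡ _
        go (·-distribʳ _ a b) = ·-distribʳ _ a b
        go (·-distribˡ a _ _) = ·-distribˡ a _ _
        go (·-zeroˡ _) = ·-zeroˡ _
        go (·-zeroʳ a) = ·-zeroʳ a
        go (pure-cong e) = pure-cong (λ i → f-cong (e i))
        go (pure-+ i e e′) = pure-+ i (N.≈ᴹ-trans (f-cong e) (f-+ _ _))
          (λ j j≢i → f-cong (proj₁ (e′ j j≢i)) , f-cong (proj₂ (e′ j j≢i)))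
        go (pure-· a i e e′) = pure-· a i (N.≈ᴹ-trans (f-cong e) (f-* a _))
          (λ j j≢i → f-cong (e′ j j≢i))

  module _ {m ℓm} {M : LeftModule K.ring m ℓm} where

    -- The product M^⊗r × M^⊗s → M^⊗(r+s) given by concatenation of pure tensors.
    pure-⊗ : ∀ {r s} → Vector (LeftModule.Carrierᴹ M) r → Tensor M s → Tensor M (r ℕ.+ s)
    pure-⊗ v (pure w) = pure (v ++ w)
    pure-⊗ v (x ⊕ y)  = pure-⊗ v x ⊕ pure-⊗ v y
    pure-⊗ v (a · x)  = a · pure-⊗ v x
    pure-⊗ v 𝟘        = 𝟘
    pure-⊗ v (⊖ x)    = ⊖ pure-⊗ v x

    infixl 7 _⊗_
    _⊗_ : ∀ {r s} → Tensor M r → Tensor M s → Tensor M (r ℕ.+ s)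
    pure v  ⊗ y = pure-⊗ v y
    (x ⊕ z) ⊗ y = (x ⊗ y) ⊕ (z ⊗ y)
    (a · x) ⊗ y = a · (x ⊗ y)
    𝟘       ⊗ y = 𝟘
    (⊖ x)   ⊗ y = ⊖ (x ⊗ y)

    private
      module M = LeftModule M
      module ^⊗ {r} = LeftModule (_^⊗_ M r)
      open module ^⊗-props {r} = AbelianGroupProperties (^⊗.+ᴹ-abelianGroup {r}) using (⁻¹-∙-comm)
      open module ^⊗-comm {r} =
        CommutativeSemigroupProperties (AbelianGroup.commutativeSemigroup (^⊗.+ᴹ-abelianGroup {r}))
        using (interchange)
      infix 4 _≋_
      _≋_ : ∀ {r} → Rel (Tensor M r) _
      _≋_ = _≈⊗_ M

      ·-⊖ : ∀ {r} a (x : Tensor M r) → ⊖ (a · x) ≋ a · (⊖ x)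
      ·-⊖ a x = sym⊗ (^⊗-props.inverseˡ-unique _ _
        (trans⊗ (sym⊗ (·-distribˡ a (⊖ x) x)) (trans⊗ (·-cong K.refl (⊖-inverseˡ x)) (·-zeroʳ a))))

      ++-rel : ∀ {a r s} {P : M.Carrierᴹ → M.Carrierᴹ → Set a} {u v : Vector M.Carrierᴹ r} {w w′ : Vector M.Carrierᴹ s} →
               (∀ i → P (u i) (v i)) → (∀ i → P (w i) (w′ i)) → ∀ j → P ((u ++ w) j) ((v ++ w′) j)
      ++-rel {r = r} p p′ j with Fin.splitAt r j
      ... | inj₁ i = p i
      ... | inj₂ i = p′ i

    private
      pure-⊗-congˡ : ∀ {r s} {u v : Vector M.Carrierᴹ r} (y : Tensor M s) →
                     (∀ i → u i M.≈ᴹ v i) → pure-⊗ u y ≋ pure-⊗ v y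
      pure-⊗-congˡ (pure w) e = pure-cong (++-rel {P = M._≈ᴹ_} e (λ _ → M.≈ᴹ-refl))
      pure-⊗-congˡ (x ⊕ y) e = ⊕-cong (pure-⊗-congˡ x e) (pure-⊗-congˡ y e)
      pure-⊗-congˡ (a · x) e = ·-cong K.refl (pure-⊗-congˡ x e)
      pure-⊗-congˡ 𝟘 e = refl⊗
      pure-⊗-congˡ (⊖ x) e = ⊖-cong (pure-⊗-congˡ x e)

      pure-⊗-+ˡ : ∀ {r s} {u v w : Vector M.Carrierᴹ r} (y : Tensor M s) i → u i M.≈ᴹ v i M.+ᴹ w i →
                  (∀ j → j ≢ i → u j M.≈ᴹ v j × u j M.≈ᴹ w j) → pure-⊗ u y ≋ pure-⊗ v y ⊕ pure-⊗ w y
      pure-⊗-+ˡ {r} {s} {u} {v} {w} (pure z) i e e′ = pure-+ (i ↑ˡ s) at-i off-i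
        where
        at-i : (u ++ z) (i ↑ˡ s) M.≈ᴹ (v ++ z) (i ↑ˡ s) M.+ᴹ (w ++ z) (i ↑ˡ s)
        at-i rewrite Fin.splitAt-↑ˡ r i s = e
        off-i : ∀ j → j ≢ i ↑ˡ s → (u ++ z) j M.≈ᴹ (v ++ z) j × (u ++ z) j M.≈ᴹ (w ++ z) j
        off-i j j≢ with Fin.splitAt r j in eq
        ... | inj₁ k = e′ k (λ { ≡.refl → j≢ (≡.sym (Fin.splitAt⁻¹-↑ˡ eq)) })
        ... | inj₂ k = M.≈ᴹ-refl , M.≈ᴹ-refl
      pure-⊗-+ˡ (x ⊕ y) i e e′ = trans⊗ (⊕-cong (pure-⊗-+ˡ x i e e′) (pure-⊗-+ˡ y i e e′)) (interchange _ _ _ _)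
      pure-⊗-+ˡ (a · x) i e e′ = trans⊗ (·-cong K.refl (pure-⊗-+ˡ x i e e′)) (·-distribˡ a _ _)
      pure-⊗-+ˡ 𝟘 i e e′ = sym⊗ (⊕-identityˡ 𝟘)
      pure-⊗-+ˡ (⊖ x) i e e′ = trans⊗ (⊖-cong (pure-⊗-+ˡ x i e e′)) (sym⊗ (⁻¹-∙-comm _ _))

      pure-⊗-·ˡ : ∀ {r s} {u v : Vector M.Carrierᴹ r} (y : Tensor M s) a i → u i M.≈ᴹ a M.*ₗ v i →
                  (∀ j → j ≢ i → u j M.≈ᴹ v j) → pure-⊗ u y ≋ a · pure-⊗ v y
      pure-⊗-·ˡ {r} {s} {u} {v} (pure z) a i e e′ = pure-· a (i ↑ˡ s) at-i off-i
        where
        at-i : (u ++ z) (i ↑ˡ s) M.≈ᴹ a M.*ₗ (v ++ z) (i ↑ˡ s)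
        at-i rewrite Fin.splitAt-↑ˡ r i s = e
        off-i : ∀ j → j ≢ i ↑ˡ s → (u ++ z) j M.≈ᴹ (v ++ z) j
        off-i j j≢ with Fin.splitAt r j in eq
        ... | inj₁ k = e′ k (λ { ≡.refl → j≢ (≡.sym (Fin.splitAt⁻¹-↑ˡ eq)) })
        ... | inj₂ k = M.≈ᴹ-refl
      pure-⊗-·ˡ (x ⊕ y) a i e e′ = trans⊗ (⊕-cong (pure-⊗-·ˡ x a i e e′) (pure-⊗-·ˡ y a i e e′)) (sym⊗ (·-distribˡ a _ _))
      pure-⊗-·ˡ (b · x) a i e e′ = trans⊗ (·-cong K.refl (pure-⊗-·ˡ x a i e e′))
        (trans⊗ (sym⊗ (·-assoc b a _)) (trans⊗ (·-cong (K.*-comm b a) refl⊗) (·-assoc a b _)))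
      pure-⊗-·ˡ 𝟘 a i e e′ = sym⊗ (·-zeroʳ a)
      pure-⊗-·ˡ (⊖ x) a i e e′ = trans⊗ (⊖-cong (pure-⊗-·ˡ x a i e e′)) (·-⊖ a _)

      pure-⊗-congʳ : ∀ {r s} (v : Vector M.Carrierᴹ r) {x y : Tensor M s} → x ≋ y → pure-⊗ v x ≋ pure-⊗ v y
      pure-⊗-congʳ v refl⊗ = refl⊗
      pure-⊗-congʳ v (sym⊗ e) = sym⊗ (pure-⊗-congʳ v e)
      pure-⊗-congʳ v (trans⊗ e e′) = trans⊗ (pure-⊗-congʳ v e) (pure-⊗-congʳ v e′)
      pure-⊗-congʳ v (⊕-cong e e′) = ⊕-cong (pure-⊗-congʳ v e) (pure-⊗-congʳ v e′)
      pure-⊗-congʳ v (⊕-assoc x y z) = ⊕-assoc _ _ _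
      pure-⊗-congʳ v (⊕-comm x y) = ⊕-comm _ _
      pure-⊗-congʳ v (⊕-identityˡ x) = ⊕-identityˡ _
      pure-⊗-congʳ v (⊖-cong e) = ⊖-cong (pure-⊗-congʳ v e)
      pure-⊗-congʳ v (⊖-inverseˡ x) = ⊖-inverseˡ _
      pure-⊗-congʳ v (·-cong e e′) = ·-cong e (pure-⊗-congʳ v e′)
      pure-⊗-congʳ v (·-assoc a b x) = ·-assoc _ _ _
      pure-⊗-congʳ v (·-identityˡ x) = ·-identityˡ _
      pure-⊗-congʳ v (·-distribʳ x a b) = ·-distribʳ _ _ _
      pure-⊗-congʳ v (·-distribˡ a x y) = ·-distribˡ _ _ _
      pure-⊗-congʳ v (·-zeroˡ x) = ·-zeroˡ _
      pure-⊗-congʳ v (·-zeroʳ a) = ·-zeroʳ _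
      pure-⊗-congʳ v (pure-cong e) = pure-cong (++-rel {P = M._≈ᴹ_} (λ _ → M.≈ᴹ-refl) e)
      pure-⊗-congʳ {r} {s} z (pure-+ {u} {v} {w} i e e′) = pure-+ (r ↑ʳ i) at-i off-i
        where
        at-i : (z ++ u) (r ↑ʳ i) M.≈ᴹ (z ++ v) (r ↑ʳ i) M.+ᴹ (z ++ w) (r ↑ʳ i)
        at-i rewrite Fin.splitAt-↑ʳ r s i = e
        off-i : ∀ j → j ≢ r ↑ʳ i → (z ++ u) j M.≈ᴹ (z ++ v) j × (z ++ u) j M.≈ᴹ (z ++ w) j
        off-i j j≢ with Fin.splitAt r j in eq
        ... | inj₁ k = M.≈ᴹ-refl , M.≈ᴹ-refl
        ... | inj₂ k = e′ k (λ { ≡.refl → j≢ (≡.sym (Fin.splitAt⁻¹-↑ʳ {r} eq)) })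
      pure-⊗-congʳ {r} {s} z (pure-· {u} {v} a i e e′) = pure-· a (r ↑ʳ i) at-i off-i
        where
        at-i : (z ++ u) (r ↑ʳ i) M.≈ᴹ a M.*ₗ (z ++ v) (r ↑ʳ i)
        at-i rewrite Fin.splitAt-↑ʳ r s i = e
        off-i : ∀ j → j ≢ r ↑ʳ i → (z ++ u) j M.≈ᴹ (z ++ v) j
        off-i j j≢ with Fin.splitAt r j in eq
        ... | inj₁ k = M.≈ᴹ-refl
        ... | inj₂ k = e′ k (λ { ≡.refl → j≢ (≡.sym (Fin.splitAt⁻¹-↑ʳ {r} eq)) })

    ⊗-congʳ : ∀ {r s} (x : Tensor M r) {y z : Tensor M s} → y ≋ z → x ⊗ y ≋ x ⊗ z
    ⊗-congʳ (pure v) e = pure-⊗-congʳ v e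
    ⊗-congʳ (x ⊕ y) e = ⊕-cong (⊗-congʳ x e) (⊗-congʳ y e)
    ⊗-congʳ (a · x) e = ·-cong K.refl (⊗-congʳ x e)
    ⊗-congʳ 𝟘 e = refl⊗
    ⊗-congʳ (⊖ x) e = ⊖-cong (⊗-congʳ x e)

    ⊗-congˡ : ∀ {r s} {x z : Tensor M r} (y : Tensor M s) → x ≋ z → x ⊗ y ≋ z ⊗ y
    ⊗-congˡ y refl⊗ = refl⊗
    ⊗-congˡ y (sym⊗ e) = sym⊗ (⊗-congˡ y e)
    ⊗-congˡ y (trans⊗ e e′) = trans⊗ (⊗-congˡ y e) (⊗-congˡ y e′)
    ⊗-congˡ y (⊕-cong e e′) = ⊕-cong (⊗-congˡ y e) (⊗-congˡ y e′)
    ⊗-congˡ y (⊕-assoc _ _ _) = ⊕-assoc _ _ _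
    ⊗-congˡ y (⊕-comm _ _) = ⊕-comm _ _
    ⊗-congˡ y (⊕-identityˡ _) = ⊕-identityˡ _
    ⊗-congˡ y (⊖-cong e) = ⊖-cong (⊗-congˡ y e)
    ⊗-congˡ y (⊖-inverseˡ _) = ⊖-inverseˡ _
    ⊗-congˡ y (·-cong e e′) = ·-cong e (⊗-congˡ y e′)
    ⊗-congˡ y (·-assoc a b x) = ·-assoc _ _ _
    ⊗-congˡ y (·-identityˡ x) = ·-identityˡ _
    ⊗-congˡ y (·-distribʳ x a b) = ·-distribʳ _ _ _
    ⊗-congˡ y (·-distribˡ a _ _) = ·-distribˡ _ _ _
    ⊗-congˡ y (·-zeroˡ x) = ·-zeroˡ _
    ⊗-congˡ y (·-zeroʳ a) = ·-zeroʳ _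
    ⊗-congˡ y (pure-cong e) = pure-⊗-congˡ y e
    ⊗-congˡ y (pure-+ i e e′) = pure-⊗-+ˡ y i e e′
    ⊗-congˡ y (pure-· a i e e′) = pure-⊗-·ˡ y a i e e′

    ⊗-⊕ʳ : ∀ {r s} (x : Tensor M r) (y z : Tensor M s) → x ⊗ (y ⊕ z) ≋ (x ⊗ y) ⊕ (x ⊗ z)
    ⊗-⊕ʳ (pure v) y z = refl⊗
    ⊗-⊕ʳ (x ⊕ x′) y z = trans⊗ (⊕-cong (⊗-⊕ʳ x y z) (⊗-⊕ʳ x′ y z)) (interchange _ _ _ _)
    ⊗-⊕ʳ (a · x) y z = trans⊗ (·-cong K.refl (⊗-⊕ʳ x y z)) (·-distribˡ a _ _)
    ⊗-⊕ʳ 𝟘 y z = sym⊗ (⊕-identityˡ 𝟘)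
    ⊗-⊕ʳ (⊖ x) y z = trans⊗ (⊖-cong (⊗-⊕ʳ x y z)) (sym⊗ (⁻¹-∙-comm _ _))

    ⊗-·ʳ : ∀ {r s} (x : Tensor M r) a (y : Tensor M s) → x ⊗ (a · y) ≋ a · (x ⊗ y)
    ⊗-·ʳ (pure v) a y = refl⊗
    ⊗-·ʳ (x ⊕ x′) a y = trans⊗ (⊕-cong (⊗-·ʳ x a y) (⊗-·ʳ x′ a y)) (sym⊗ (·-distribˡ a _ _))
    ⊗-·ʳ (b · x) a y = trans⊗ (·-cong K.refl (⊗-·ʳ x a y))
      (trans⊗ (sym⊗ (·-assoc b a _)) (trans⊗ (·-cong (K.*-comm b a) refl⊗) (·-assoc a b _)))
    ⊗-·ʳ 𝟘 a y = sym⊗ (·-zeroʳ a)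
    ⊗-·ʳ (⊖ x) a y = trans⊗ (⊖-cong (⊗-·ʳ x a y)) (·-⊖ a _)

    ⊗-𝟘ʳ : ∀ {r} s (x : Tensor M r) → x ⊗ 𝟘 {r = s} ≋ 𝟘
    ⊗-𝟘ʳ s (pure v) = refl⊗
    ⊗-𝟘ʳ s (x ⊕ x′) = trans⊗ (⊕-cong (⊗-𝟘ʳ s x) (⊗-𝟘ʳ s x′)) (⊕-identityˡ 𝟘)
    ⊗-𝟘ʳ s (a · x) = trans⊗ (·-cong K.refl (⊗-𝟘ʳ s x)) (·-zeroʳ a)
    ⊗-𝟘ʳ s 𝟘 = refl⊗
    ⊗-𝟘ʳ s (⊖ x) = trans⊗ (⊖-cong (⊗-𝟘ʳ s x)) (^⊗-props.ε⁻¹≈ε)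

    ⊗-⊖ʳ : ∀ {r s} (x : Tensor M r) (y : Tensor M s) → x ⊗ (⊖ y) ≋ ⊖ (x ⊗ y)
    ⊗-⊖ʳ (pure v) y = refl⊗
    ⊗-⊖ʳ (x ⊕ x′) y = trans⊗ (⊕-cong (⊗-⊖ʳ x y) (⊗-⊖ʳ x′ y)) (⁻¹-∙-comm _ _)
    ⊗-⊖ʳ (a · x) y = trans⊗ (·-cong K.refl (⊗-⊖ʳ x y)) (sym⊗ (·-⊖ a _))
    ⊗-⊖ʳ 𝟘 y = sym⊗ (^⊗-props.ε⁻¹≈ε)
    ⊗-⊖ʳ (⊖ x) y = ⊖-cong (⊗-⊖ʳ x y)

module _ {k ℓk} {K : Ring k ℓk} {m ℓm} (M : LeftModule K m ℓm) where
  private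
    module K = Ring K
    module M = LeftModule M
    open M using (_≈ᴹ_; _+ᴹ_; -ᴹ_; _*ₗ_; 0ᴹ)
    open AbelianGroupProperties M.+ᴹ-abelianGroup
    open CommutativeSemigroupProperties
      (AbelianGroup.commutativeSemigroup M.+ᴹ-abelianGroup) using (interchange)

  -- -∈ is implied by *∈.
  data Span {p} (P : Pred M.Carrierᴹ p) : Pred M.Carrierᴹ (k ⊔ m ⊔ ℓm ⊔ p) where
    gen  : ∀ {x} → P x → Span P x
    resp : ∀ {x y} → x ≈ᴹ y → Span P x → Span P y
    0∈   : Span P 0ᴹ
    +∈   : ∀ {x y} → Span P x → Span P y → Span P (x +ᴹ y)
    -∈   : ∀ {x} → Span P x → Span P (-ᴹ x)
    *∈   : ∀ a {x} → Span P x → Span P (a *ₗ x)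

  module _ {p} (P : Pred M.Carrierᴹ p) where
    private
      infix 4 _∼ᴹ_
      _∼ᴹ_ : Rel M.Carrierᴹ _
      x ∼ᴹ y = Span P (x +ᴹ (-ᴹ y))

      ≈⇒∼ᴹ : ∀ {x y} → x ≈ᴹ y → x ∼ᴹ y
      ≈⇒∼ᴹ e = resp (M.≈ᴹ-sym (x≈y⇒x∙y⁻¹≈ε e)) 0∈

      ∼ᴹ-trans : ∀ {x y z} → x ∼ᴹ y → y ∼ᴹ z → x ∼ᴹ z
      ∼ᴹ-trans {x} {y} {z} d d′ = resp eq (+∈ d d′)
        where
        open SetoidReasoning M.≈ᴹ-setoid
        eq : (x +ᴹ (-ᴹ y)) +ᴹ (y +ᴹ (-ᴹ z)) ≈ᴹ x +ᴹ (-ᴹ z)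
        eq = begin
          (x +ᴹ (-ᴹ y)) +ᴹ (y +ᴹ (-ᴹ z)) ≈⟨ M.+ᴹ-assoc _ _ _ ⟩
          x +ᴹ ((-ᴹ y) +ᴹ (y +ᴹ (-ᴹ z))) ≈⟨ M.+ᴹ-congˡ (\\-leftDividesʳ y (-ᴹ z)) ⟩
          x +ᴹ (-ᴹ z)                    ∎

      *-neg : ∀ a y → a *ₗ (-ᴹ y) ≈ᴹ -ᴹ (a *ₗ y)
      *-neg a y = inverseˡ-unique _ _
        (M.≈ᴹ-trans (M.≈ᴹ-sym (M.*ₗ-distribˡ a (-ᴹ y) y))
          (M.≈ᴹ-trans (M.*ₗ-congˡ (M.-ᴹ‿inverseˡ y)) (M.*ₗ-zeroʳ a)))

    quotientModule : LeftModule K m (k ⊔ m ⊔ ℓm ⊔ p)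
    quotientModule = record
      { Carrierᴹ = M.Carrierᴹ
      ; _≈ᴹ_ = _∼ᴹ_
      ; _+ᴹ_ = _+ᴹ_
      ; _*ₗ_ = _*ₗ_
      ; 0ᴹ   = 0ᴹ
      ; -ᴹ_  = -ᴹ_
      ; isLeftModule = record
        { isLeftSemimodule = record
          { +ᴹ-isCommutativeMonoid = record
            { isMonoid = record
              { isSemigroup = record
                { isMagma = record
                  { isEquivalence = record
                    { refl  = ≈⇒∼ᴹ M.≈ᴹ-refl
                    ; sym   = λ {x} {y} d → resp (⁻¹-anti-homo‿- x y) (-∈ d)
                    ; trans = ∼ᴹ-trans
                    }
                  ; ∙-cong = λ d d′ → resp
                      (M.≈ᴹ-trans (interchange _ _ _ _) (M.+ᴹ-congˡ (⁻¹-∙-comm _ _))) (+∈ d d′)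
                  }
                ; assoc = λ x y z → ≈⇒∼ᴹ (M.+ᴹ-assoc x y z)
                }
              ; identity = (λ x → ≈⇒∼ᴹ (M.+ᴹ-identityˡ x)) , (λ x → ≈⇒∼ᴹ (M.+ᴹ-identityʳ x))
              }
            ; comm = λ x y → ≈⇒∼ᴹ (M.+ᴹ-comm x y)
            }
          ; isPreleftSemimodule = record
            { *ₗ-cong      = λ {a} {b} {x} {y} e d → resp
                (M.≈ᴹ-trans (M.*ₗ-distribˡ a x (-ᴹ y))
                  (M.+ᴹ-congˡ (M.≈ᴹ-trans (*-neg a y) (M.-ᴹ‿cong (M.*ₗ-congʳ e)))))
                (*∈ a d)
            ; *ₗ-zeroˡ     = λ x → ≈⇒∼ᴹ (M.*ₗ-zeroˡ x)
            ; *ₗ-distribʳ  = λ x a b → ≈⇒∼ᴹ (M.*ₗ-distribʳ x a b)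
            ; *ₗ-identityˡ = λ x → ≈⇒∼ᴹ (M.*ₗ-identityˡ x)
            ; *ₗ-assoc     = λ a b x → ≈⇒∼ᴹ (M.*ₗ-assoc a b x)
            ; *ₗ-zeroʳ     = λ a → ≈⇒∼ᴹ (M.*ₗ-zeroʳ a)
            ; *ₗ-distribˡ  = λ a x y → ≈⇒∼ᴹ (M.*ₗ-distribˡ a x y)
            }
          }
        ; -ᴹ‿cong    = λ d → resp (M.≈ᴹ-sym (⁻¹-∙-comm _ _)) (-∈ d)
        ; -ᴹ‿inverse = (λ x → ≈⇒∼ᴹ (M.-ᴹ‿inverseˡ x)) , (λ x → ≈⇒∼ᴹ (M.-ᴹ‿inverseʳ x))
        }
      }

    ∼0⇒∈ : ∀ {x} → x ∼ᴹ 0ᴹ → Span P x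
    ∼0⇒∈ {x} = resp (M.≈ᴹ-trans (M.+ᴹ-congˡ ε⁻¹≈ε) (M.+ᴹ-identityʳ x))

    ∈⇒∼0 : ∀ {x} → Span P x → x ∼ᴹ 0ᴹ
    ∈⇒∼0 {x} = resp (M.≈ᴹ-sym (M.≈ᴹ-trans (M.+ᴹ-congˡ ε⁻¹≈ε) (M.+ᴹ-identityʳ x)))

module DirectSum {a ℓa} (A : ℕ → AbelianGroup a ℓa) where
  private module A {r} = AbelianGroup (A r)

  record ⨁ : Set (a ⊔ ℓa) where
    no-eta-equality
    field
      component : ∀ r → A.Carrier {r}
      bound     : ℕ
      vanishes  : ∀ r → bound ℕ.≤ r → component r A.≈ A.ε
  open ⨁ public

  infixl 6 _+⨁_
  _+⨁_ : ⨁ → ⨁ → ⨁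
  (x +⨁ y) .component r = component x r A.∙ component y r
  (x +⨁ y) .bound = bound x ℕ.⊔ bound y
  (x +⨁ y) .vanishes r b≤r = A.trans
    (A.∙-cong (vanishes x r (ℕ.≤-trans (ℕ.m≤m⊔n (bound x) (bound y)) b≤r))
              (vanishes y r (ℕ.≤-trans (ℕ.m≤n⊔m (bound x) (bound y)) b≤r)))
    (A.identityˡ A.ε)

  0⨁ : ⨁
  0⨁ .component _ = A.ε
  0⨁ .bound = 0
  0⨁ .vanishes _ _ = A.refl

  -⨁_ : ⨁ → ⨁
  (-⨁ x) .component r = component x r A.⁻¹
  (-⨁ x) .bound = bound x
  (-⨁ x) .vanishes r b≤r = A.trans (A.⁻¹-cong (vanishes x r b≤r)) (GroupProperties.ε⁻¹≈ε A.group)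

  infix 4 _≈⨁_
  record _≈⨁_ (x y : ⨁) : Set ℓa where
    constructor componentwise
    field
      at : ∀ r → component x r A.≈ component y r
  open _≈⨁_ public

  ⨁-abelianGroup : AbelianGroup (a ⊔ ℓa) ℓa
  ⨁-abelianGroup = record
    { Carrier = ⨁
    ; _≈_ = _≈⨁_
    ; _∙_ = _+⨁_
    ; ε   = 0⨁
    ; _⁻¹ = -⨁_
    ; isAbelianGroup = record
      { isGroup = record
        { isMonoid = record
          { isSemigroup = record
            { isMagma = record
              { isEquivalence = record
                { refl  = componentwise λ _ → A.refl
                ; sym   = λ e → componentwise λ r → A.sym (at e r)
                ; trans = λ e e′ → componentwise λ r → A.trans (at e r) (at e′ r)
                }
              ; ∙-cong = λ e e′ → componentwise λ r → A.∙-cong (at e r) (at e′ r)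
              }
            ; assoc = λ _ _ _ → componentwise λ _ → A.assoc _ _ _
            }
          ; identity = (λ _ → componentwise λ _ → A.identityˡ _) , (λ _ → componentwise λ _ → A.identityʳ _)
          }
        ; inverse = (λ _ → componentwise λ _ → A.inverseˡ _) , (λ _ → componentwise λ _ → A.inverseʳ _)
        ; ⁻¹-cong = λ e → componentwise λ r → A.⁻¹-cong (at e r)
        }
      ; comm = λ _ _ → componentwise λ _ → A.comm _ _
      }
    }

  single-component : ∀ r → A.Carrier {r} → ∀ n → A.Carrier {n}
  single-component r x n with r ℕ.≟ n
  ... | yes ≡.refl = x
  ... | no  _      = A.ε

  -- The inclusion of the degree r part.
  single : ∀ r → A.Carrier {r} → ⨁
  single r x .component = single-component r x
  single r x .bound = suc r
  single r x .vanishes n r<n with r ℕ.≟ n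
  ... | yes ≡.refl = contradiction r<n (ℕ.<-irrefl ≡.refl)
  ... | no  _      = A.refl

  single-component-cong : ∀ r {x y} → x A.≈ y → ∀ n → single-component r x n A.≈ single-component r y n
  single-component-cong r e n with r ℕ.≟ n
  ... | yes ≡.refl = e
  ... | no  _      = A.refl

  single-cong : ∀ r {x y} → x A.≈ y → single r x ≈⨁ single r y
  single-cong r e = componentwise (single-component-cong r e)

  -- The ring structure on ⨁ extending products A r × A s → A (r + s).
  module Product
    (_·_ : ∀ {r s} → A.Carrier {r} → A.Carrier {s} → A.Carrier {r ℕ.+ s})
    (one : A.Carrier {0})
    (zeroˡ : ∀ {r s} {x : A.Carrier {r}} (y : A.Carrier {s}) → x A.≈ A.ε → x · y A.≈ A.ε)
    (zeroʳ : ∀ {r s} (x : A.Carrier {r}) {y : A.Carrier {s}} → y A.≈ A.ε → x · y A.≈ A.ε)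
    where

    private
      ∑ : ∀ {n k} → Vector (A.Carrier {n}) k → A.Carrier {n}
      ∑ {n} = Sum.sum (AbelianGroup.commutativeMonoid (A n))

      i+[n-i] : ∀ {n} (i : Fin (suc n)) → toℕ i ℕ.+ (n ℕ.∸ toℕ i) ≡ n
      i+[n-i] i = ℕ.m+[n∸m]≡n (Fin.toℕ≤pred[n] i)

      subst-ε : ∀ {m n} (e : m ≡ n) {x : A.Carrier {m}} → x A.≈ A.ε → subst (λ r → A.Carrier {r}) e x A.≈ A.ε
      subst-ε ≡.refl p = p

      ∑-ε : ∀ {n k} (v : Vector (A.Carrier {n}) k) → (∀ i → v i A.≈ A.ε) → ∑ v A.≈ A.ε
      ∑-ε {k = zero}  v e = A.refl
      ∑-ε {k = suc k} v e = A.trans (A.∙-cong (e Fin.zero) (∑-ε (v ∘ Fin.suc) (e ∘ Fin.suc))) (A.identityˡ A.ε)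

    term : ⨁ → ⨁ → ∀ {n} → Fin (suc n) → A.Carrier {n}
    term x y {n} i =
      subst (λ r → A.Carrier {r}) (i+[n-i] i) (component x (toℕ i) · component y (n ℕ.∸ toℕ i))

    infixl 7 _⋆_
    _⋆_ : ⨁ → ⨁ → ⨁
    (x ⋆ y) .component n = ∑ (term x y {n})
    (x ⋆ y) .bound = bound x ℕ.+ bound y
    (x ⋆ y) .vanishes n b≤n = ∑-ε (term x y) (λ i → subst-ε (i+[n-i] i) (vanish i))
      where
      vanish : ∀ (i : Fin (suc n)) → component x (toℕ i) · component y (n ℕ.∸ toℕ i) A.≈ A.ε
      vanish i with bound x ℕ.≤? toℕ i
      ... | yes p = zeroˡ _ (vanishes x (toℕ i) p)
      ... | no ¬p = zeroʳ _ (vanishes y (n ℕ.∸ toℕ i)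
            (ℕ.m+n≤o⇒m≤o∸n (bound y)
              (ℕ.≤-trans (ℕ.+-monoʳ-≤ (bound y) (ℕ.<⇒≤ (ℕ.≰⇒> ¬p)))
                (ℕ.≤-trans (ℕ.≤-reflexive (ℕ.+-comm (bound y) (bound x))) b≤n))))

    rawRing : RawRing (a ⊔ ℓa) ℓa
    rawRing = record
      { Carrier = ⨁
      ; _≈_ = _≈⨁_
      ; _+_ = _+⨁_
      ; _*_ = _⋆_
      ; -_  = -⨁_
      ; 0#  = 0⨁
      ; 1#  = single 0 one
      }

module _ {a ℓa b ℓb} (A : ℕ → AbelianGroup a ℓa) (B : ℕ → AbelianGroup b ℓb) where
  private
    module A {r} = AbelianGroup (A r)
    module B {r} = AbelianGroup (B r)

  single-component-map : (f : ∀ r → A.Carrier {r} → B.Carrier {r}) →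
                         (∀ r → f r A.ε B.≈ B.ε) → ∀ r (x : A.Carrier {r}) n →
                         DirectSum.single-component B r (f r x) n B.≈ f n (DirectSum.single-component A r x n)
  single-component-map f f-ε r x n with r ℕ.≟ n
  ... | yes ≡.refl = B.refl
  ... | no  _      = B.sym (f-ε n)

module Duality (q : ℕ) where

  open Cohomology (ℤ/ q) public
  open TensorPower (ℤ/ q) public

  private
    module K = CommutativeRing (ℤ/ q)
    open K using (_≈_)
    top : ∀ {ℓ} → ProfiniteGroup ℓ → TopologicalGroup ℓ
    top = ProfiniteGroup.topologicalGroup

  module _ {ℓ} (G : ProfiniteGroup ℓ) where

    H¹⊗ : ℕ → LeftModule K.ring (lsuc ℓ) (lsuc ℓ)
    H¹⊗ = _^⊗_ (H¹ (top G))

    open DirectSum (λ r → LeftModule.+ᴹ-abelianGroup (H¹⊗ r)) public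
      using () renaming (⨁ to H⊗*; ⨁-abelianGroup to H⊗*-abelianGroup; single to homogeneous)

  module _ {ℓ} {G₁ G₂ : ProfiniteGroup ℓ} (π : G₁ ⇒ G₂) where

    H¹⊗-map : ∀ {r} → Tensor (H¹ (top G₂)) r → Tensor (H¹ (top G₁)) r
    H¹⊗-map = Tensor-map (H¹-map π)

    H¹⊗-map-cong : ∀ {r} {x y : Tensor (H¹ (top G₂)) r} →
                   _≈⊗_ (H¹ (top G₂)) x y → _≈⊗_ (H¹ (top G₁)) (H¹⊗-map x) (H¹⊗-map y)
    H¹⊗-map-cong = Tensor-map-cong (λ e x → e _) (λ _ _ _ → K.refl) (λ _ _ _ → K.refl)

    H⊗*-map : H⊗* G₂ → H⊗* G₁
    H⊗*-map x .DirectSum.component r = H¹⊗-map (DirectSum.component x r)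
    H⊗*-map x .DirectSum.bound = DirectSum.bound x
    H⊗*-map x .DirectSum.vanishes r b≤r = H¹⊗-map-cong (DirectSum.vanishes x r b≤r)

    H⊗*-map-homogeneous : ∀ t (x : Tensor (H¹ (top G₂)) t) →
      AbelianGroup._≈_ (H⊗*-abelianGroup G₁)
        (homogeneous G₁ t (H¹⊗-map x)) (H⊗*-map (homogeneous G₂ t x))
    H⊗*-map-homogeneous t x = DirectSum.componentwise (single-component-map
      (λ r → LeftModule.+ᴹ-abelianGroup (H¹⊗ G₂ r)) (λ r → LeftModule.+ᴹ-abelianGroup (H¹⊗ G₁ r))
      (λ r → H¹⊗-map {r}) (λ r → refl⊗) t x)

  -- The transgression H¹(T)^G → H²(G/T): φ is sent to the class c
  -- represented by f when some continuous cochain y on G extends φ and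
  -- ∂y is the inflation of f.  IsTransgression is the graph of this map; see
  -- transgression-unique and transgression-exists.

  module _ {ℓ} (G : ProfiniteGroup ℓ) (T : ClosedSubgroup G) where
    open ProfiniteGroup G using (Carrier; _∙_; _⁻¹)
    open ClosedSubgroup T

    IsInvariant : Hom¹ (subspace subgroup) → Set ℓ
    IsInvariant φ = ∀ g {t t′ : Σ Carrier Mem} →
      ProfiniteGroup._≈_ G (proj₁ t′) ((g ⁻¹ ∙ proj₁ t) ∙ g) → Hom¹.fun φ t′ ≈ Hom¹.fun φ t

    IsTransgression : (T-normal : Normal) → Hom¹ (subspace subgroup) →
                      Cocycle² (top (G / (T , T-normal))) → Set (lsuc ℓ)
    IsTransgression T-normal φ c =
      Σ[ y ∈ Cochain¹ (top G) ] Σ[ f ∈ Cocycle² (top (G / (T , T-normal))) ]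
        (∀ t → Cochain¹.fun y (proj₁ t) ≈ Hom¹.fun φ t) ×
        (∀ g h → ∂ (top G) y g h ≈ Cocycle².fun f g h) ×
        _≈²_ (top (G / (T , T-normal))) f c

    -- A ≤ H²(G/T) is dual to (T,T₀): for φ in H¹(T)^G, res φ = 0 in H¹(T₀)
    -- if and only if trg φ ∈ A.
    IsDual : ∀ {a} (T-normal : Normal) (T₀ : ClosedSubgroup G) → ClosedSubgroup.Mem T₀ ⊆ Mem →
             Pred (Cocycle² (top (G / (T , T-normal)))) a → Set (lsuc ℓ ⊔ a)
    IsDual T-normal T₀ T₀≤T A =
      ∀ φ → IsInvariant φ →
        (H¹-map (inclusion (ClosedSubgroup.subgroup T₀) subgroup T₀≤T) φ ≈ᴹ 0ᴹ)
        ⇔ (∃[ c ] A c × IsTransgression T-normal φ c)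
      where open LeftModule (H¹ (subspace (ClosedSubgroup.subgroup T₀))) using (_≈ᴹ_; 0ᴹ)

  -- The transgression is a well-defined function of φ: any two values
  -- agree in H², and (classically) a value always exists.

  module _ {ℓ} (G : ProfiniteGroup ℓ) (T : ClosedSubgroup G) (T-normal : ClosedSubgroup.Normal T) where
    private
      module G = ProfiniteGroup G
      module T = ClosedSubgroup T
      G/T = G / (T , T-normal)
      module G/T = ProfiniteGroup G/T
      open GroupProperties G.group

      -- y (g t) = y g + φ t
      Equivariant : Hom¹ (subspace T.subgroup) → Cochain¹ (top G) → Set ℓ
      Equivariant φ y = ∀ g (t : Σ G.Carrier T.Mem) →
        Cochain¹.fun y (g G.∙ proj₁ t) ≈ Cochain¹.fun y g K.+ Hom¹.fun φ t

      φ-ε : (φ : Hom¹ (subspace T.subgroup)) → ∀ {t} → proj₁ t G.≈ G.ε → Hom¹.fun φ t ≈ K.0#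
      φ-ε φ {t} t≈ε = begin
        φ.fun t                              ≡⟨ solve₁ (φ.fun t) ⟩
        (φ.fun t K.+ φ.fun t) K.- φ.fun t     ≈⟨ K.+-congʳ (φ.homo t t) ⟨
        φ.fun (t ∙ t) K.- φ.fun t             ≈⟨ K.+-congʳ (φ.cong (G.trans (G.∙-congʳ t≈ε) (G.identityˡ _))) ⟩
        φ.fun t K.- φ.fun t                   ≈⟨ K.-‿inverseʳ (φ.fun t) ⟩
        K.0#                                  ∎
        where
        module φ = Hom¹ φ
        open TopologicalGroup (subspace T.subgroup) using (_∙_)
        open SetoidReasoning K.setoid
        solve₁ : ∀ a → a ≡ (a ℤ.+ a) ℤ.- a
        solve₁ = solve-∀

      descend : (b : Cochain¹ (top G)) → (∀ g (t : Σ G.Carrier T.Mem) →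
                Cochain¹.fun b (g G.∙ proj₁ t) ≈ Cochain¹.fun b g) → Cochain¹ (top G/T)
      descend b inv .Cochain¹.fun = Cochain¹.fun b
      descend b inv .Cochain¹.cong {x} {y} m = K.sym (K.trans
        (Cochain¹.cong b (G.sym (\\-leftDividesˡ x y))) (inv x (_ , m)))
      descend b inv .Cochain¹.continuous x =
        let (U , U-open , ux , u) = Cochain¹.continuous b x in
        saturate (top G) T.subgroup T-normal U ,
        (saturate-open (top G) T.subgroup T-normal U-open , saturate-resp (top G) T.subgroup T-normal U-open) ,
        ⊆-saturate (top G) T.subgroup T-normal U-open ux ,
        (λ { {x′} (t , ut) → K.trans (K.sym (inv x′ t)) (u ut) })

      equivariant : ∀ {φ c} ((y , _) : IsTransgression G T T-normal φ c) → Equivariant φ y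
      equivariant {φ} (y , f , y≈φ , ∂y≈f , _) g (t , mt) = begin
        y.fun (g G.∙ t)                                    ≡⟨ solve₂ (y.fun (g G.∙ t)) (y.fun g) (y.fun t) ⟩
        y.fun g K.+ y.fun t K.- ∂ (top G) y g t             ≈⟨ K.+-cong (K.+-congˡ {y.fun g} (y≈φ (t , mt))) (K.-‿cong ∂y≈0) ⟩
        (y.fun g K.+ Hom¹.fun φ (t , mt)) K.- K.0#          ≈⟨ K.+-identityʳ _ ⟩
        y.fun g K.+ Hom¹.fun φ (t , mt)                     ∎
        where
        module y = Cochain¹ y
        module f = Cocycle² f
        open SetoidReasoning K.setoid
        solve₂ : ∀ a b c → a ≡ b ℤ.+ c ℤ.- ((c ℤ.+ ℤ.- a) ℤ.+ b)
        solve₂ = solve-∀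
        solve₃ : ∀ a b → (a ℤ.+ ℤ.- b) ℤ.+ b ≡ a
        solve₃ = solve-∀
        t∼ε : t G/T.≈ G.ε
        t∼ε = T.resp (G.sym (G.identityʳ _)) (T.⁻¹∈ mt)
        ∂y≈0 : ∂ (top G) y g t ≈ K.0#
        ∂y≈0 = begin
          ∂ (top G) y g t                              ≈⟨ ∂y≈f g t ⟩
          f.fun g t                                    ≈⟨ f.cong G/T.refl t∼ε ⟩
          f.fun g G.ε                                  ≈⟨ ∂y≈f g G.ε ⟨
          (y.fun G.ε K.+ K.- y.fun (g G.∙ G.ε)) K.+ y.fun g
            ≈⟨ K.+-congʳ {y.fun g} (K.+-congˡ {y.fun G.ε} (K.-‿cong (y.cong (G.identityʳ g)))) ⟩
          (y.fun G.ε K.+ K.- y.fun g) K.+ y.fun g      ≡⟨ solve₃ (y.fun G.ε) (y.fun g) ⟩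
          y.fun G.ε                                    ≈⟨ y≈φ (G.ε , T.ε∈) ⟩
          Hom¹.fun φ (G.ε , T.ε∈)                      ≈⟨ φ-ε φ G.refl ⟩
          K.0#                                         ∎

    transgression-unique : ∀ {φ c c′} → IsTransgression G T T-normal φ c →
                           IsTransgression G T T-normal φ c′ → _≈²_ (top G/T) c c′
    transgression-unique {φ} {c} {c′} p@(y , f , y≈φ , ∂y≈f , f≈c) p′@(y′ , f′ , y′≈φ , ∂y′≈f′ , f′≈c′) =
      H²G/T.trans (H²G/T.sym f≈c) (H²G/T.trans (cobounds (descend b b-inv) f≈f′+∂b) f′≈c′)
      where
      module H²G/T = AbelianGroup (H² (top G/T))
      b = add¹ (top G) y (neg¹ (top G) y′)
      solve₄ : ∀ u v w → (u ℤ.+ w) ℤ.+ ℤ.- (v ℤ.+ w) ≡ u ℤ.+ ℤ.- v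
      solve₄ = solve-∀
      solve₅ : ∀ a b c a′ b′ c′ → (a ℤ.+ ℤ.- b) ℤ.+ c ≡
        ((a′ ℤ.+ ℤ.- b′) ℤ.+ c′) ℤ.+ (((a ℤ.+ ℤ.- a′) ℤ.+ ℤ.- (b ℤ.+ ℤ.- b′)) ℤ.+ (c ℤ.+ ℤ.- c′))
      solve₅ = solve-∀
      b-inv : ∀ g (t : Σ G.Carrier T.Mem) → Cochain¹.fun b (g G.∙ proj₁ t) ≈ Cochain¹.fun b g
      b-inv g t = K.trans
        (K.+-cong (equivariant {φ} {c} p g t) (K.-‿cong (equivariant {φ} {c′} p′ g t)))
        (K.reflexive (solve₄ (Cochain¹.fun y g) (Cochain¹.fun y′ g) (Hom¹.fun φ t)))
      f≈f′+∂b : ∀ x z → Cocycle².fun f x z ≈ Cocycle².fun f′ x z K.+ ∂ (top G/T) (descend b b-inv) x z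
      f≈f′+∂b x z = K.trans (K.sym (∂y≈f x z)) (K.trans
        (K.reflexive (solve₅ (Y z) (Y (x G.∙ z)) (Y x) (Y′ z) (Y′ (x G.∙ z)) (Y′ x)))
        (K.+-congʳ {∂ (top G/T) (descend b b-inv) x z} (∂y′≈f′ x z)))
        where
        Y = Cochain¹.fun y
        Y′ = Cochain¹.fun y′

    transgression-exists : ExcludedMiddle ℓ → ∀ φ → IsInvariant G T φ → ∃[ c ] IsTransgression G T T-normal φ c
    transgression-exists em φ φ-inv = f , y , f , y-extends , (λ _ _ → K.refl) , pointwise (top G/T) (λ _ _ → K.refl)
      where
      module φ = Hom¹ φ
      open SetoidReasoning K.setoid

      ε̂ : Σ G.Carrier T.Mem
      ε̂ = G.ε , T.ε∈

      nbhd = φ.continuous ε̂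
      W = proj₁ (proj₁ (proj₂ nbhd))
      W-open : G.IsOpen W
      W-open = proj₁ (proj₂ (proj₁ (proj₂ nbhd)))
      W-ε : W G.ε
      W-ε = proj₁ (proj₂ (proj₂ (proj₁ (proj₂ nbhd)))) (proj₁ (proj₂ (proj₂ nbhd)))
      φ-W : ∀ t → W (proj₁ t) → φ.fun t ≈ K.0#
      φ-W t w = K.trans (proj₂ (proj₂ (proj₂ nbhd)) (proj₂ (proj₂ (proj₂ (proj₁ (proj₂ nbhd)))) {t} w))
                        (φ-ε φ G.refl)

      H = proj₁ (G.open-subgroups W-open W-ε)
      module H = Subgroup H
      H-open : G.IsOpen H.Mem
      H-open = proj₁ (proj₂ (G.open-subgroups W-open W-ε))
      H⊆W : H.Mem ⊆ W
      H⊆W = proj₂ (proj₂ (G.open-subgroups W-open W-ε))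

      HT = saturateSubgroup (top G) T.subgroup T-normal H H-open
      module HT = Subgroup HT

      HT-resp : HT.Mem Respects G._≈_
      HT-resp e = HT.resp (T.resp (G.trans (G.sym (G.inverseˡ _)) (G.∙-congˡ e)) T.ε∈)

      T⊆HT : ∀ {t} → T.Mem t → HT.Mem t
      T⊆HT {t} mt = (t G.⁻¹ , T.⁻¹∈ mt) , H.resp (G.sym (G.inverseʳ t)) H.ε∈

      cosets = G.compact (λ r x → H.Mem (r G.⁻¹ G.∙ x)) (λ r → G.open-translateˡ (r G.⁻¹) H-open)
                 (λ x → x , H.resp (G.sym (G.inverseˡ x)) H.ε∈)

      find : List G.Carrier → G.Carrier → G.Carrier
      find []ᴸ g = G.ε
      find (r ∷ᴸ rs) g with em {HT.Mem (r G.⁻¹ G.∙ g)}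
      ... | yes _ = r
      ... | no  _ = find rs g

      find-∈ : ∀ rs g → Any (λ r → H.Mem (r G.⁻¹ G.∙ g)) rs → HT.Mem (find rs g G.⁻¹ G.∙ g)
      find-∈ (r ∷ᴸ rs) g a with em {HT.Mem (r G.⁻¹ G.∙ g)}
      ... | yes p = p
      find-∈ (r ∷ᴸ rs) g (here h)  | no ¬p =
        contradiction (⊆-saturate (top G) T.subgroup T-normal H-open h) ¬p
      find-∈ (r ∷ᴸ rs) g (there a) | no ¬p = find-∈ rs g a

      move : ∀ r {g g′} → HT.Mem (g G.⁻¹ G.∙ g′) → HT.Mem (r G.⁻¹ G.∙ g) → HT.Mem (r G.⁻¹ G.∙ g′)
      move r {g} {g′} m p = HT-resp (G.cancel-mid (r G.⁻¹) g g′) (HT.∙∈ p m)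

      find-cong : ∀ rs {g g′} → HT.Mem (g G.⁻¹ G.∙ g′) → find rs g ≡ find rs g′
      find-cong []ᴸ m = ≡.refl
      find-cong (r ∷ᴸ rs) {g} {g′} m with em {HT.Mem (r G.⁻¹ G.∙ g)} | em {HT.Mem (r G.⁻¹ G.∙ g′)}
      ... | yes _ | yes _ = ≡.refl
      ... | yes p | no ¬p = contradiction (move r m p) ¬p
      ... | no ¬p | yes p = contradiction
            (move r (HT-resp (⁻¹-anti-homo-\\ g g′) (HT.⁻¹∈ m)) p) ¬p
      ... | no _  | no _  = find-cong rs m

      rep : G.Carrier → G.Carrier
      rep = find (proj₁ cosets)

      rep-∈ : ∀ g → HT.Mem (rep g G.⁻¹ G.∙ g)
      rep-∈ g = find-∈ (proj₁ cosets) g (proj₂ cosets g)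

      n : G.Carrier → Σ G.Carrier T.Mem
      n g = proj₁ (rep-∈ g)

      z : G.Carrier → ℤ
      z g = K.- φ.fun (n g)

      -- The value of z at g = r h t⁻¹, with r = rep g and h ∈ H, is - φ t.
      z-value : ∀ {r} g → rep g ≡ r → ∀ t → H.Mem ((r G.⁻¹ G.∙ g) G.∙ proj₁ t) → z g ≈ K.- φ.fun t
      z-value g ≡.refl t h = K.-‿cong (begin
        φ.fun (n g)                                        ≡⟨ solve₆ (φ.fun (n g)) (φ.fun d) ⟩
        (φ.fun (n g) K.+ φ.fun d) K.- φ.fun d               ≈⟨ K.+-cong (φ.homo (n g) d) (K.-‿cong (K.sym (φ-W d (H⊆W d∈H)))) ⟨
        φ.fun (n g ∙ d) K.- K.0#                            ≈⟨ K.+-identityʳ _ ⟩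
        φ.fun (n g ∙ d)                                     ≈⟨ φ.cong (\\-leftDividesˡ _ _) ⟩
        φ.fun t                                             ∎)
        where
        open TopologicalGroup (subspace T.subgroup) using (_∙_)
        solve₆ : ∀ a b → a ≡ (a ℤ.+ b) ℤ.- b
        solve₆ = solve-∀
        a = rep g G.⁻¹ G.∙ g
        d : Σ G.Carrier T.Mem
        d = (proj₁ (n g) G.⁻¹ G.∙ proj₁ t) , T.∙∈ (T.⁻¹∈ (proj₂ (n g))) (proj₂ t)
        d∈H : H.Mem (proj₁ d)
        d∈H = H.resp
          (G.trans (G.∙-congʳ (⁻¹-anti-homo-∙ a (proj₁ (n g))))
            (G.trans (G.assoc _ _ _) (G.∙-congˡ (\\-leftDividesʳ a (proj₁ t)))))
          (H.∙∈ (H.⁻¹∈ (proj₂ (rep-∈ g))) h)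

      z-cochain : Cochain¹ (top G)
      z-cochain .Cochain¹.fun = z
      z-cochain .Cochain¹.cong {g} {g′} e = z-value g
        (find-cong (proj₁ cosets) (HT-resp (G.trans (G.sym (G.inverseˡ g)) (G.∙-congˡ e)) HT.ε∈))
        (n g′) (H.resp (G.∙-congʳ (G.∙-congˡ (G.sym e))) (proj₂ (rep-∈ g′)))
      z-cochain .Cochain¹.continuous g =
        (λ g′ → H.Mem ((rep g G.⁻¹ G.∙ g′) G.∙ proj₁ (n g))) ,
        G.open-translateˡ (rep g G.⁻¹) (G.open-translateʳ (proj₁ (n g)) H-open) ,
        proj₂ (rep-∈ g) ,
        (λ {g′} h → z-value g′ (≡.sym (find-cong (proj₁ cosets) (same-coset g′ h))) (n g) h)
        where
        same-coset : ∀ g′ → H.Mem ((rep g G.⁻¹ G.∙ g′) G.∙ proj₁ (n g)) → HT.Mem (g G.⁻¹ G.∙ g′)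
        same-coset g′ h = HT-resp
          (G.trans (G.∙-congʳ (⁻¹-anti-homo-\\ (rep g) g)) (G.cancel-mid _ _ _))
          (HT.∙∈ (HT.⁻¹∈ (rep-∈ g)) (n g , h))

      z-equivariant : Equivariant φ z-cochain
      z-equivariant g t = begin
        z (g G.∙ proj₁ t)              ≈⟨ z-value (g G.∙ proj₁ t) rep≡ (t ⁻¹ ∙ n g) h ⟩
        K.- φ.fun (t ⁻¹ ∙ n g)         ≈⟨ K.-‿cong φ-eq ⟩
        K.- (φ.fun (n g) K.- φ.fun t)  ≡⟨ solve₇ (φ.fun (n g)) (φ.fun t) ⟩
        z g K.+ φ.fun t                ∎
        where
        open TopologicalGroup (subspace T.subgroup) using (_∙_; _⁻¹)
        solve₇ : ∀ a b → ℤ.- (a ℤ.- b) ≡ (ℤ.- a) ℤ.+ b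
        solve₇ = solve-∀
        solve₈ : ∀ a b → a ≡ (b ℤ.+ a) ℤ.- b
        solve₈ = solve-∀
        rep≡ : rep (g G.∙ proj₁ t) ≡ rep g
        rep≡ = ≡.sym (find-cong (proj₁ cosets) (HT-resp (G.sym (\\-leftDividesʳ g (proj₁ t))) (T⊆HT (proj₂ t))))
        h : H.Mem ((rep g G.⁻¹ G.∙ (g G.∙ proj₁ t)) G.∙ (proj₁ t G.⁻¹ G.∙ proj₁ (n g)))
        h = H.resp (G.sym (G.trans (G.∙-congʳ (G.sym (G.assoc _ _ _))) (G.cancel-mid _ _ _))) (proj₂ (rep-∈ g))
        φ-eq : φ.fun (t ⁻¹ ∙ n g) ≈ φ.fun (n g) K.- φ.fun t
        φ-eq = begin
          φ.fun (t ⁻¹ ∙ n g)                            ≡⟨ solve₈ (φ.fun (t ⁻¹ ∙ n g)) (φ.fun t) ⟩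
          (φ.fun t K.+ φ.fun (t ⁻¹ ∙ n g)) K.- φ.fun t  ≈⟨ K.+-congʳ (φ.homo t (t ⁻¹ ∙ n g)) ⟨
          φ.fun (t ∙ (t ⁻¹ ∙ n g)) K.- φ.fun t          ≈⟨ K.+-congʳ (φ.cong (\\-leftDividesˡ _ _)) ⟩
          φ.fun (n g) K.- φ.fun t                       ∎

      const¹ : ℤ → Cochain¹ (top G)
      const¹ a .Cochain¹.fun _ = a
      const¹ a .Cochain¹.cong _ = K.refl
      const¹ a .Cochain¹.continuous _ = (λ _ → ⊤) , G.open-⊤ , tt , (λ _ → K.refl)

      y : Cochain¹ (top G)
      y = add¹ (top G) z-cochain (const¹ (K.- z G.ε))

      Y : G.Carrier → ℤ
      Y = Cochain¹.fun y

      y-equivariant : Equivariant φ y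
      y-equivariant g t = K.trans (K.+-congʳ (z-equivariant g t)) (K.reflexive (solve₉ (z g) (φ.fun t) (z G.ε)))
        where
        solve₉ : ∀ a b c → (a ℤ.+ b) ℤ.+ ℤ.- c ≡ (a ℤ.+ ℤ.- c) ℤ.+ b
        solve₉ = solve-∀

      y-extends : ∀ t → Y (proj₁ t) ≈ φ.fun t
      y-extends t = begin
        Y (proj₁ t)                       ≈⟨ Cochain¹.cong y (G.identityˡ _) ⟨
        Y (G.ε G.∙ proj₁ t)               ≈⟨ y-equivariant G.ε t ⟩
        (z G.ε K.+ K.- z G.ε) K.+ φ.fun t ≈⟨ K.+-congʳ {φ.fun t} (K.-‿inverseʳ (z G.ε)) ⟩
        K.0# K.+ φ.fun t                  ≈⟨ K.+-identityˡ _ ⟩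
        φ.fun t                           ∎

      ∂y-shift : ∀ g h (s t : Σ G.Carrier T.Mem) →
                 ∂ (top G) y (g G.∙ proj₁ s) (h G.∙ proj₁ t) ≈ ∂ (top G) y g h
      ∂y-shift g h s t = begin
        (Y (h G.∙ proj₁ t) K.+ K.- Y ((g G.∙ proj₁ s) G.∙ (h G.∙ proj₁ t))) K.+ Y (g G.∙ proj₁ s)
          ≈⟨ K.+-cong (K.+-cong (y-equivariant h t) (K.-‿cong gsht)) (y-equivariant g s) ⟩
        ((Y h K.+ φ.fun t) K.+ K.- ((Y (g G.∙ h) K.+ φ.fun s) K.+ φ.fun t)) K.+ (Y g K.+ φ.fun s)
          ≡⟨ solve₁₀ (Y h) (φ.fun t) (Y (g G.∙ h)) (φ.fun s) (Y g) ⟩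
        ∂ (top G) y g h ∎
        where
        solve₁₀ : ∀ a b c d e → ((a ℤ.+ b) ℤ.+ ℤ.- ((c ℤ.+ d) ℤ.+ b)) ℤ.+ (e ℤ.+ d) ≡ (a ℤ.+ ℤ.- c) ℤ.+ e
        solve₁₀ = solve-∀
        sʰ : Σ G.Carrier T.Mem
        sʰ = (h G.⁻¹ G.∙ proj₁ s) G.∙ h ,
             T.resp (G.∙-congˡ (⁻¹-involutive h)) (T-normal (h G.⁻¹) (proj₂ s))
        eq : (g G.∙ proj₁ s) G.∙ (h G.∙ proj₁ t) G.≈ ((g G.∙ h) G.∙ proj₁ sʰ) G.∙ proj₁ t
        eq = G.trans (G.sym (G.assoc _ _ _)) (G.∙-congʳ
          (G.sym (G.trans (G.sym (G.assoc _ _ _)) (G.∙-congʳ (G.cancel-mid g h (proj₁ s))))))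
        gsht : Y ((g G.∙ proj₁ s) G.∙ (h G.∙ proj₁ t)) ≈ (Y (g G.∙ h) K.+ φ.fun s) K.+ φ.fun t
        gsht = begin
          Y ((g G.∙ proj₁ s) G.∙ (h G.∙ proj₁ t))           ≈⟨ Cochain¹.cong y eq ⟩
          Y (((g G.∙ h) G.∙ proj₁ sʰ) G.∙ proj₁ t)          ≈⟨ y-equivariant _ t ⟩
          Y ((g G.∙ h) G.∙ proj₁ sʰ) K.+ φ.fun t            ≈⟨ K.+-congʳ (y-equivariant _ sʰ) ⟩
          (Y (g G.∙ h) K.+ φ.fun sʰ) K.+ φ.fun t            ≈⟨ K.+-congʳ {φ.fun t} (K.+-congˡ {Y (g G.∙ h)} (φ-inv h {s} {sʰ} G.refl)) ⟩
          (Y (g G.∙ h) K.+ φ.fun s) K.+ φ.fun t             ∎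

      ∂-cong : ∀ {g g′ h h′} → g G.≈ g′ → h G.≈ h′ → ∂ (top G) y g h ≈ ∂ (top G) y g′ h′
      ∂-cong e e′ = K.+-cong (K.+-cong (Cochain¹.cong y e′) (K.-‿cong (Cochain¹.cong y (G.∙-cong e e′)))) (Cochain¹.cong y e)

      f : Cocycle² (top G/T)
      f .Cocycle².fun = ∂ (top G) y
      f .Cocycle².cong {g} {g′} {h} {h′} m m′ = K.sym (K.trans
        (∂-cong (G.sym (\\-leftDividesˡ g g′)) (G.sym (\\-leftDividesˡ h h′)))
        (∂y-shift g h (_ , m) (_ , m′)))
      f .Cocycle².continuous g h =
        let (U₁ , U₁o , u₁ , k₁) = Cochain¹.continuous y g
            (U₂ , U₂o , u₂ , k₂) = Cochain¹.continuous y h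
            (U₃ , U₃o , u₃ , k₃) = Cochain¹.continuous y (g G.∙ h)
            (V , V′ , Vo , V′o , v , v′ , k) = G.∙-continuous U₃o u₃
            sat = saturate (top G) T.subgroup T-normal
        in sat (U₁ ∩ V) , sat (U₂ ∩ V′) ,
           (saturate-open (top G) T.subgroup T-normal (G.open-∩ U₁o Vo) ,
            saturate-resp (top G) T.subgroup T-normal (G.open-∩ U₁o Vo)) ,
           (saturate-open (top G) T.subgroup T-normal (G.open-∩ U₂o V′o) ,
            saturate-resp (top G) T.subgroup T-normal (G.open-∩ U₂o V′o)) ,
           ⊆-saturate (top G) T.subgroup T-normal (G.open-∩ U₁o Vo) (u₁ , v) ,
           ⊆-saturate (top G) T.subgroup T-normal (G.open-∩ U₂o V′o) (u₂ , v′) ,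
           (λ { {g′} {h′} (s , (p , q)) (t , (p′ , q′)) → K.trans (K.sym (∂y-shift g′ h′ s t))
             (K.+-cong (K.+-cong (k₂ p′) (K.-‿cong (k₃ (k q q′)))) (k₁ p)) })
      f .Cocycle².cocycle a b c = K.trans
        (K.+-congˡ {∂ (top G) y b c} (K.+-congʳ {Y a} (K.+-congˡ {Y (b G.∙ c)} (K.-‿cong (Cochain¹.cong y (G.sym (G.assoc a b c)))))))
        (K.reflexive (solve₁₁ (Y a) (Y b) (Y c) (Y (b G.∙ c)) (Y (a G.∙ b)) (Y ((a G.∙ b) G.∙ c))))
        where
        solve₁₁ : ∀ a b c bc ab abc →
          ((c ℤ.+ ℤ.- bc) ℤ.+ b) ℤ.+ ((bc ℤ.+ ℤ.- abc) ℤ.+ a) ≡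
          ((c ℤ.+ ℤ.- abc) ℤ.+ ab) ℤ.+ ((b ℤ.+ ℤ.- ab) ℤ.+ a)
        solve₁₁ = solve-∀

  record TripleData (ℓ : Level) : Set (lsuc (lsuc ℓ)) where
    field
      T T₀ : (G : ProfiniteGroup ℓ) → ClosedSubgroup G
      α    : (G : ProfiniteGroup ℓ) → H⊗* G → Cocycle² (top G)

      α-isHomomorphism : ∀ G → GroupMorphisms.IsGroupHomomorphism
        (AbelianGroup.rawGroup (H⊗*-abelianGroup G)) (AbelianGroup.rawGroup (H² (top G))) (α G)

      T-functorial  : ∀ {G₁ G₂} (π : G₁ ⇒ G₂) {x} → ClosedSubgroup.Mem (T G₁) x →
                      ClosedSubgroup.Mem (T G₂) (ContinuousHom.⟦_⟧ π x)
      T₀-functorial : ∀ {G₁ G₂} (π : G₁ ⇒ G₂) {x} → ClosedSubgroup.Mem (T₀ G₁) x →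
                      ClosedSubgroup.Mem (T₀ G₂) (ContinuousHom.⟦_⟧ π x)
      α-functorial  : ∀ {G₁ G₂} (π : G₁ ⇒ G₂) x →
                      _≈²_ (top G₁) (H²-map π (α G₂ x)) (α G₁ (H⊗*-map {G₁ = G₁} {G₂} π x))

      T-normal  : ∀ G → ClosedSubgroup.Normal (T G)
      T₀-normal : ∀ G → ClosedSubgroup.Normal (T₀ G)

    _/T : ProfiniteGroup ℓ → ProfiniteGroup ℓ
    G /T = G / (T G , T-normal G)

  module TripleNotions {ℓ} (tripleData : TripleData ℓ) where
    open TripleData tripleData

    record Cover (G : ProfiniteGroup ℓ) : Set (lsuc (lsuc ℓ)) where
      field
        S          : ProfiniteGroup ℓ
        π          : S ⇒ G
        surjective : ContinuousHom.IsSurjective π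
        H²[S]≈0    : ∀ c → _≈²_ (top S) c (zero² (top S))
        S/T≅G/T    : ContinuousHom.IsIsomorphism
                       (induced {G = S} {G} π (T S , T-normal S) (T G , T-normal G) (T-functorial {S} {G} π))

    -- The image of α, as a subset of H².
    InA : (G : ProfiniteGroup ℓ) → Pred (Cocycle² (top G)) (lsuc ℓ)
    InA G c = ∃[ x ] _≈²_ (top G) (α G x) c

    private
      module α (G : ProfiniteGroup ℓ) = GroupMorphisms.IsGroupHomomorphism (α-isHomomorphism G)
      module H² (G : ProfiniteGroup ℓ) = AbelianGroup (H² (top G))

    A : ProfiniteGroup ℓ → RawGroup (lsuc ℓ) (lsuc ℓ)
    A G = record
      { Carrier = Σ (Cocycle² (top G)) (InA G)
      ; _≈_ = λ c d → _≈²_ (top G) (proj₁ c) (proj₁ d)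
      ; _∙_ = λ (c , x , e) (d , y , e′) → add² (top G) c d , x ∙ y ,
          H².trans G (α.homo G x y)
            (H².∙-cong G e e′)
      ; ε = zero² (top G) , ε , α.ε-homo G
      ; _⁻¹ = λ (c , x , e) → neg² (top G) c , x ⁻¹ ,
          H².trans G (α.⁻¹-homo G x)
            (H².⁻¹-cong G e)
      }
      where open AbelianGroup (H⊗*-abelianGroup G) using (_∙_; ε; _⁻¹)

    A-map : ∀ {G₁ G₂} → G₁ ⇒ G₂ → RawGroup.Carrier (A G₂) → RawGroup.Carrier (A G₁)
    A-map {G₁} {G₂} π (c , x , e) = H²-map π c , H⊗*-map {G₁ = G₁} {G₂} π x ,
      H².trans G₁
        (H².sym G₁ (α-functorial {G₁} {G₂} π x))
        (H²-map-cong π e)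

    module _ (t : ℕ) (G : ProfiniteGroup ℓ) where

      data CGenerator (r : ℕ) : Pred (Tensor (H¹ (top G)) r) (lsuc ℓ) where
        generator : (ψ : Vector (Hom¹ (top G)) r) (i : Fin t → Fin r) →
                    (∀ {j k} → j Fin.< k → i j Fin.< i k) →
                    _≈²_ (top G) (α G (homogeneous G t (pure (ψ ∘ i)))) (zero² (top G)) →
                    CGenerator r (pure ψ)

      C : (r : ℕ) → Pred (Tensor (H¹ (top G)) r) (lsuc ℓ)
      C r = Span (H¹⊗ G r) (CGenerator r)

      -- Hᵗ r is H^r_{t,α}(G); elements of H¹(G)^⊗r are kept as representatives.
      Hᵗ : ℕ → LeftModule K.ring (lsuc ℓ) (lsuc ℓ)
      Hᵗ r = quotientModule (H¹⊗ G r) (CGenerator r)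

      private
        ψ-cong : ∀ {u v : Vector (Hom¹ (top G)) t} → (∀ j → u j ≡ v j) →
                 _≈²_ (top G) (α G (homogeneous G t (pure v))) (zero² (top G)) →
                 _≈²_ (top G) (α G (homogeneous G t (pure u))) (zero² (top G))
        ψ-cong {u} {v} e e′ =
          H².trans G
            (α.⟦⟧-cong G {homogeneous G t (pure u)} {homogeneous G t (pure v)} (DirectSum.single-cong (λ r → LeftModule.+ᴹ-abelianGroup (H¹⊗ G r)) t {pure u} {pure v}
              (pure-cong (λ j → LeftModule.≈ᴹ-reflexive (H¹ (top G)) (e j)))))
            e′

      C-⊗ˡ : ∀ {r s} {x : Tensor (H¹ (top G)) r} → C r x → (y : Tensor (H¹ (top G)) s) → C (r ℕ.+ s) (x ⊗ y)
      C-⊗ˡ {r} {s} (gen (generator ψ i i-mono e)) = go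
        where
        go : (y : Tensor (H¹ (top G)) s) → C (r ℕ.+ s) (pure-⊗ ψ y)
        go (pure w) = gen (generator (ψ ++ w) (λ j → i j ↑ˡ s)
          (λ {j} {k} j<k → ≡.subst₂ ℕ._<_ (≡.sym (Fin.toℕ-↑ˡ (i j) s)) (≡.sym (Fin.toℕ-↑ˡ (i k) s)) (i-mono j<k))
          (ψ-cong (λ j → lookup-++ˡ ψ w (i j)) e))
        go (x ⊕ y) = +∈ (go x) (go y)
        go (a · x) = *∈ a (go x)
        go 𝟘 = 0∈
        go (⊖ x) = -∈ (go x)
      C-⊗ˡ (resp e c) y = resp (⊗-congˡ y e) (C-⊗ˡ c y)
      C-⊗ˡ 0∈ y = 0∈
      C-⊗ˡ (+∈ c d) y = +∈ (C-⊗ˡ c y) (C-⊗ˡ d y)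
      C-⊗ˡ (-∈ c) y = -∈ (C-⊗ˡ c y)
      C-⊗ˡ (*∈ a c) y = *∈ a (C-⊗ˡ c y)

      C-⊗ʳ : ∀ {r s} (x : Tensor (H¹ (top G)) r) {y : Tensor (H¹ (top G)) s} → C s y → C (r ℕ.+ s) (x ⊗ y)
      C-⊗ʳ {r} {s} x (gen (generator ψ i i-mono e)) = go x
        where
        go : (x : Tensor (H¹ (top G)) r) → C (r ℕ.+ s) (x ⊗ pure ψ)
        go (pure v) = gen (generator (v ++ ψ) (λ j → r ↑ʳ i j)
          (λ {j} {k} j<k → ≡.subst₂ ℕ._<_ (≡.sym (Fin.toℕ-↑ʳ r (i j))) (≡.sym (Fin.toℕ-↑ʳ r (i k)))
            (ℕ.+-monoʳ-< r (i-mono j<k)))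
          (ψ-cong (λ j → lookup-++ʳ v ψ (i j)) e))
        go (x ⊕ y) = +∈ (go x) (go y)
        go (a · x) = *∈ a (go x)
        go 𝟘 = 0∈
        go (⊖ x) = -∈ (go x)
      C-⊗ʳ x (resp e c) = resp (⊗-congʳ x e) (C-⊗ʳ x c)
      C-⊗ʳ {s = s} x 0∈ = resp (sym⊗ (⊗-𝟘ʳ s x)) 0∈
      C-⊗ʳ x (+∈ c d) = resp (sym⊗ (⊗-⊕ʳ x _ _)) (+∈ (C-⊗ʳ x c) (C-⊗ʳ x d))
      C-⊗ʳ x (-∈ c) = resp (sym⊗ (⊗-⊖ʳ x _)) (-∈ (C-⊗ʳ x c))
      C-⊗ʳ x (*∈ a c) = resp (sym⊗ (⊗-·ʳ x a _)) (*∈ a (C-⊗ʳ x c))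

      private
        module ⨁Hᵗ = DirectSum (λ r → LeftModule.+ᴹ-abelianGroup (Hᵗ r))
        module ⨁Hᵗ-product = ⨁Hᵗ.Product _⊗_ (pure (λ ()))
          (λ {r} {s} y d → ∈⇒∼0 (H¹⊗ G (r ℕ.+ s)) (CGenerator (r ℕ.+ s))
                             (C-⊗ˡ (∼0⇒∈ (H¹⊗ G r) (CGenerator r) d) y))
          (λ {r} {s} x d → ∈⇒∼0 (H¹⊗ G (r ℕ.+ s)) (CGenerator (r ℕ.+ s))
                             (C-⊗ʳ x (∼0⇒∈ (H¹⊗ G s) (CGenerator s) d)))

      -- H*_{t,α}(G)
      H* : RawRing (lsuc ℓ) (lsuc ℓ)
      H* = ⨁Hᵗ-product.rawRing

      -- The map H^t_{t,α}(G) → A(G) induced by α.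
      ᾱ : LeftModule.Carrierᴹ (Hᵗ t) → RawGroup.Carrier (A G)
      ᾱ x = α G (homogeneous G t x) , homogeneous G t x , H².refl G

    C-map : ∀ {G₁ G₂} t (π : G₁ ⇒ G₂) {r} {x : Tensor (H¹ (top G₂)) r} →
            C t G₂ r x → C t G₁ r (H¹⊗-map {G₁ = G₁} {G₂} π x)
    C-map {G₁} {G₂} t π (gen (generator ψ i i-mono e)) =
      gen (generator (H¹-map π ∘ ψ) i i-mono
        (H².trans G₁
          (α.⟦⟧-cong G₁ {homogeneous G₁ t (pure (H¹-map π ∘ ψ ∘ i))} {H⊗*-map {G₁ = G₁} {G₂} π z}
            (H⊗*-map-homogeneous {G₁ = G₁} {G₂} π t (pure (ψ ∘ i))))
          (H².trans G₁
            (H².sym G₁ (α-functorial {G₁} {G₂} π z))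
            (H².trans G₁ (H²-map-cong π e) (H²-map-zero π)))))
      where z = homogeneous G₂ t (pure (ψ ∘ i))
    C-map {G₁} {G₂} t π (resp e c) = resp (H¹⊗-map-cong {G₁ = G₁} {G₂} π e) (C-map {G₁} {G₂} t π c)
    C-map t π 0∈ = 0∈
    C-map {G₁} {G₂} t π (+∈ c d) = +∈ (C-map {G₁} {G₂} t π c) (C-map {G₁} {G₂} t π d)
    C-map {G₁} {G₂} t π (-∈ c) = -∈ (C-map {G₁} {G₂} t π c)
    C-map {G₁} {G₂} t π (*∈ a c) = *∈ a (C-map {G₁} {G₂} t π c)

    H*-map : ∀ {G₁ G₂} t → G₁ ⇒ G₂ → RawRing.Carrier (H* t G₂) → RawRing.Carrier (H* t G₁)
    H*-map {G₁} {G₂} t π x .DirectSum.component r = H¹⊗-map {G₁ = G₁} {G₂} π (DirectSum.component x r)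
    H*-map {G₁} {G₂} t π x .DirectSum.bound = DirectSum.bound x
    H*-map {G₁} {G₂} t π x .DirectSum.vanishes r b≤r = C-map {G₁} {G₂} t π (DirectSum.vanishes x r b≤r)

  record DualityTriple (ℓ : Level) : Set (lsuc (lsuc ℓ)) where
    field
      tripleData : TripleData ℓ

    open TripleData tripleData public
    open TripleNotions tripleData public

    field
      T^q[T,G]≤T₀ : ∀ G → powerCommutator (top G) q (ClosedSubgroup.Mem (T G)) ⊆ ClosedSubgroup.Mem (T₀ G)
      T₀≤T        : ∀ G → ClosedSubgroup.Mem (T₀ G) ⊆ ClosedSubgroup.Mem (T G)
      T≤G⁽²⁾      : ∀ G → ClosedSubgroup.Mem (T G) ⊆ qCentral² (top G) q

      T-image  : ∀ {G Ḡ} (π : G ⇒ Ḡ) → ContinuousHom.IsSurjective π →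
                 ClosedSubgroup.Mem (T Ḡ) ≐ ContinuousHom.image π (ClosedSubgroup.Mem (T G))
      T₀-image : ∀ {G Ḡ} (π : G ⇒ Ḡ) → ContinuousHom.IsSurjective π →
                 ClosedSubgroup.Mem (T₀ Ḡ) ≐ ContinuousHom.image π (ClosedSubgroup.Mem (T₀ G))

      duality : ∀ G → Cover G → IsDual G (T G) (T-normal G) (T₀ G) (T₀≤T G) (InA (G /T))

{-# OPTIONS --safe #-}
-- Since N ≤ T = T(G) ≤ G^(2), the groups H¹(G/T), H¹(G/N) and H¹(G) coincide, so
-- inflation A(G/N) → A(G) is always surjective and (b) says that it is injective.
--
-- (a) ⇒ (b): a class of A(G/N) dying in H²(G) is inflated from some c ∈ A(G/T) with
-- inf c = ∂y on G.  If y(1) = 0, then φ = y|T is G-invariant with trg φ = c, so φ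
-- vanishes on T₀ by duality.  If N ≤ T₀, then y is constant on the cosets of N, and c
-- already dies in H²(G/N).
--
-- (b) ⇒ (a): if x ∈ N lies outside T₀, then some φ ∈ H¹(T)^G vanishes on T₀ but not at x.
-- By duality trg φ ∈ A(G/T); it dies in H²(G), hence by (b) in H²(G/N).  The two cochains
-- bounding it on G and on G/N differ by a homomorphism, which vanishes on T ≤ G^(2),
-- so that φ vanishes on N.
--
-- (b) ⇒ (c): the relations C_{r,t} of G and G/N correspond when A(G/N) → A(G) is injective.
-- (c) ⇒ (b): under the extra hypotheses A(G/N) → A(G) is determined by H^r_{r,α}.
module Submission where

open import Defs
open import Algebra.Bundles using (AbelianGroup; CommutativeRing; Group; RawGroup; RawRing)
open import Algebra.Module.Bundles using (LeftModule)
open import Algebra.Morphism.Structures using (module GroupMorphisms; module RingMorphisms)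
import Algebra.Properties.AbelianGroup as AbelianGroupProperties
import Algebra.Properties.CommutativeMonoid.Sum as Sum
import Algebra.Properties.CommutativeSemigroup as CommutativeSemigroupProperties
import Algebra.Properties.Group as GroupProperties
import Algebra.Properties.Monoid.Mult as Mult
open import Axiom.ExcludedMiddle using (ExcludedMiddle)
open import Data.Fin.Base as Fin using (Fin; toℕ)
import Data.Fin.Properties as Fin
open import Data.Integer.Base as ℤ using (ℤ; +_)
import Data.Integer.Divisibility.Signed as ℤ∣
import Data.Integer.Properties as ℤ
open import Data.Integer.Tactic.RingSolver using (solve-∀)
open import Data.List.Base using (List; []; _∷_)
open import Data.List.Relation.Unary.Any using (Any; here; there)
open import Data.Nat.Base as ℕ using (ℕ; zero; suc; _^_; _≤_; NonZero)
open import Data.Nat.Divisibility as ℕ∣ using (divides)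
open import Data.Nat.DivMod using (_%_; m≡m%n+[m/n]*n; m%n<n) renaming (_/_ to _div_)
open import Data.Nat.Primality using (Prime; prime⇒nonZero)
import Data.Nat.Properties as ℕ
open import Data.Product.Base using (Σ; Σ-syntax; ∃-syntax; _×_; _,_; proj₁; proj₂)
open import Data.Sum.Base using (inj₁; inj₂)
open import Data.Unit.Polymorphic.Base using (⊤; tt)
open import Data.Vec.Functional using (Vector; _++_)
open import Function.Base using (id; _∘_)
open import Function.Bundles using (_⇔_; mk⇔; Equivalence)
open import Function.Definitions using (Injective; Surjective)
open import Level using () renaming (suc to lsuc)
open import Relation.Binary.Definitions using (_Respects_)
open import Relation.Binary.PropositionalEquality as ≡ using (_≡_; subst)
import Relation.Binary.Reasoning.Setoid as SetoidReasoning
open import Relation.Nullary using (¬_; yes; no; contradiction)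
open import Relation.Unary using (Pred; _⊆_)

-- Characters with values in Z/q of abelian groups of exponent dividing q.

least : ∀ {ℓ} → ExcludedMiddle ℓ → (P : Pred ℕ ℓ) → ∀ n → P n →
        ∃[ m ] P m × (∀ {r} → r ℕ.< m → ¬ P r)
least em P zero p = zero , p , λ ()
least em P (suc n) p with em {P zero}
... | yes p₀ = zero , p₀ , λ ()
... | no ¬p₀ =
  let (m , pm , below) = least em (λ k → P (suc k)) n p in
  suc m , pm , λ { {zero} _ → ¬p₀ ; {suc r} (ℕ.s≤s r<m) → below r<m }

module Characters {ℓ} (em : ExcludedMiddle ℓ) (Q : AbelianGroup ℓ ℓ)
                  (q : ℕ) .{{_ : NonZero q}} where
  private
    module K = CommutativeRing (ℤ/ q)
    open AbelianGroup Q
    open Mult monoid using (×-homo-+; ×-homo-1; ×-assocˡ) renaming (_×_ to _times_; ×-congˡ to times-congˡ)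
    open AbelianGroupProperties Q using (inverseʳ-unique; ∙-cancelˡ)
    open CommutativeSemigroupProperties commutativeSemigroup using (interchange)

  -- The values depend on a proof of membership, so `χ-cong` also asserts independence of that
  -- proof. Closure of the domain under inverses is derived from torsion, in `Dom-⁻¹`.
  record PartialCharacter : Set (lsuc ℓ) where
    field
      Dom      : Pred Carrier ℓ
      Dom-resp : Dom Respects _≈_
      Dom-ε    : Dom ε
      Dom-∙    : ∀ {x y} → Dom x → Dom y → Dom (x ∙ y)
      χ        : ∀ {x} → Dom x → ℤ
      χ-cong   : ∀ {x y} (a : Dom x) (b : Dom y) → x ≈ y → χ a K.≈ χ b
      χ-homo   : ∀ {x y} (a : Dom x) (b : Dom y) → χ (Dom-∙ a b) K.≈ χ a K.+ χ b

    χ-ε : ∀ {x} (a : Dom x) → x ≈ ε → χ a K.≈ K.0#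
    χ-ε {x} a x≈ε = begin
      χ a                       ≡⟨ solve₁ (χ a) ⟩
      (χ a K.+ χ a) K.- χ a     ≈⟨ K.+-congʳ (χ-homo a a) ⟨
      χ (Dom-∙ a a) K.- χ a        ≈⟨ K.+-congʳ (χ-cong (Dom-∙ a a) a (trans (∙-congʳ x≈ε) (identityˡ x))) ⟩
      χ a K.- χ a               ≈⟨ K.-‿inverseʳ (χ a) ⟩
      K.0#                      ∎
      where
      open SetoidReasoning K.setoid
      solve₁ : ∀ a → a ≡ (a ℤ.+ a) ℤ.- a
      solve₁ = solve-∀

    times∈ : ∀ n {x} → Dom x → Dom (n times x)
    times∈ zero    a = Dom-ε
    times∈ (suc n) a = Dom-∙ a (times∈ n a)

    χ-times∈ : ∀ n {x} (a : Dom x) → χ (times∈ n a) K.≈ + n K.* χ a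
    χ-times∈ zero    a = K.trans (χ-ε Dom-ε refl) (K.reflexive (≡.sym (ℤ.*-zeroˡ (χ a))))
    χ-times∈ (suc n) a = K.trans (χ-homo a (times∈ n a)) (K.trans (K.+-congˡ {χ a} (χ-times∈ n a))
      (K.reflexive (≡.sym (ℤ.suc-* (+ n) (χ a)))))

    χ-times : ∀ n {x y} (a : Dom x) (b : Dom y) → y ≈ n times x → χ b K.≈ + n K.* χ a
    χ-times n a b e = K.trans (χ-cong b (times∈ n a) e) (χ-times∈ n a)

  open PartialCharacter

  record _≼_ (P P′ : PartialCharacter) : Set ℓ where
    field
      dom   : ∀ {x} → Dom P x → Dom P′ x
      agree : ∀ {x} (a : Dom P x) → χ P′ (dom a) K.≈ χ P a
  open _≼_

  ≼-refl : ∀ {P} → P ≼ P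
  ≼-refl .dom a = a
  ≼-refl .agree a = K.refl

  ≼-trans : ∀ {P P′ P″} → P ≼ P′ → P′ ≼ P″ → P ≼ P″
  ≼-trans e e′ .dom a = dom e′ (dom e a)
  ≼-trans e e′ .agree a = K.trans (agree e′ (dom e a)) (agree e a)

  trivial : PartialCharacter
  trivial .Dom x = x ≈ ε
  trivial .Dom-resp e a = trans (sym e) a
  trivial .Dom-ε = refl
  trivial .Dom-∙ a b = trans (∙-cong a b) (identityˡ ε)
  trivial .χ _ = + 0
  trivial .χ-cong _ _ _ = K.refl
  trivial .χ-homo _ _ = K.refl

  module _ (torsion : ∀ x → q times x ≈ ε) where

    suc-pred-torsion : ∀ x → suc (ℕ.pred q) times x ≈ ε
    suc-pred-torsion x = trans (times-congˡ (ℕ.suc-pred q)) (torsion x)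

    -- The inverse of x is its power with exponent q - 1.
    Dom-⁻¹ : ∀ P {x} → Dom P x → Dom P (x ⁻¹)
    Dom-⁻¹ P {x} a = Dom-resp P (inverseʳ-unique x (ℕ.pred q times x) (suc-pred-torsion x)) (times∈ P (ℕ.pred q) a)

    -- Extension of P to the subgroup generated by `Dom P` and t, with value v at t. As t has finite
    -- order, natural exponents of t suffice, both in `compatible` and in the new domain.
    module Extend (P : PartialCharacter) (t : Carrier) (v : ℤ)
                  (compatible : ∀ d (a : Dom P (d times t)) → + d K.* v K.≈ χ P a) where

      value : ∀ {b} → ℕ → Dom P b → ℤ
      value k b∈ = + k K.* v K.+ χ P b∈

      -- The inequality makes d = k - k′ a natural number; then t^d equals b′ b⁻¹, an element of the
      -- domain, and `compatible` evaluates it.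
      value-cong-≤ : ∀ {k k′ b b′} (a : Dom P b) (a′ : Dom P b′) → k′ ℕ.≤ k →
                     k times t ∙ b ≈ k′ times t ∙ b′ → value k a K.≈ value k′ a′
      value-cong-≤ {k} {k′} {b} {b′} a a′ k′≤k e = begin
        + k K.* v K.+ χ P a                        ≡⟨ ≡.cong (λ i → + i K.* v K.+ χ P a) k≡ ⟨
        + (k′ ℕ.+ d) K.* v K.+ χ P a               ≡⟨ solve₂ (+ k′) (+ d) v (χ P a) ⟩
        + k′ K.* v K.+ (+ d K.* v K.+ χ P a)       ≈⟨ K.+-congˡ {+ k′ K.* v} (K.+-congʳ {χ P a} (compatible d dt∈)) ⟩
        + k′ K.* v K.+ (χ P dt∈ K.+ χ P a)         ≈⟨ K.+-congˡ {+ k′ K.* v} (χ-homo P dt∈ a) ⟨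
        + k′ K.* v K.+ χ P (Dom-∙ P dt∈ a)            ≈⟨ K.+-congˡ {+ k′ K.* v} (χ-cong P (Dom-∙ P dt∈ a) a′ dt∙b≈b′) ⟩
        + k′ K.* v K.+ χ P a′                      ∎
        where
        open SetoidReasoning K.setoid
        d = k ℕ.∸ k′
        k≡ : k′ ℕ.+ d ≡ k
        k≡ = ℕ.m+[n∸m]≡n k′≤k
        dt∙b≈b′ : d times t ∙ b ≈ b′
        dt∙b≈b′ = ∙-cancelˡ (k′ times t) _ _ (trans (sym (assoc _ _ _))
          (trans (∙-congʳ (trans (sym (×-homo-+ t k′ d)) (times-congˡ k≡))) e))
        dt∈ : Dom P (d times t)
        dt∈ = Dom-resp P (trans (∙-congʳ (sym dt∙b≈b′)) (trans (assoc _ _ _) (trans (∙-congˡ (inverseʳ b)) (identityʳ _))))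
                     (Dom-∙ P a′ (Dom-⁻¹ P a))
        solve₂ : ∀ a b v x → (a ℤ.+ b) ℤ.* v ℤ.+ x ≡ a ℤ.* v ℤ.+ (b ℤ.* v ℤ.+ x)
        solve₂ = solve-∀

      value-cong : ∀ {k k′ b b′} (a : Dom P b) (a′ : Dom P b′) →
                   k times t ∙ b ≈ k′ times t ∙ b′ → value k a K.≈ value k′ a′
      value-cong {k} {k′} a a′ e with ℕ.≤-total k′ k
      ... | inj₁ k′≤k = value-cong-≤ {k} {k′} a a′ k′≤k e
      ... | inj₂ k≤k′ = K.sym (value-cong-≤ {k′} {k} a′ a k≤k′ (sym e))

      extended : PartialCharacter
      extended .Dom x = Σ[ k ∈ ℕ ] Σ[ b ∈ Carrier ] Dom P b × x ≈ k times t ∙ b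
      extended .Dom-resp x≈y (k , b , a , e) = k , b , a , trans (sym x≈y) e
      extended .Dom-ε = 0 , ε , Dom-ε P , sym (identityˡ ε)
      extended .Dom-∙ (k , b , a , e) (k′ , b′ , a′ , e′) = k ℕ.+ k′ , b ∙ b′ , Dom-∙ P a a′ ,
        trans (∙-cong e e′) (trans (interchange _ _ _ _) (∙-congʳ (sym (×-homo-+ t k k′))))
      extended .χ (k , b , a , e) = value k a
      extended .χ-cong (k , b , a , e) (k′ , b′ , a′ , e′) x≈y =
        value-cong {k} {k′} a a′ (trans (sym e) (trans x≈y e′))
      extended .χ-homo (k , b , a , e) (k′ , b′ , a′ , e′) =
        K.trans (K.+-congˡ {+ (k ℕ.+ k′) K.* v} (χ-homo P a a′))
          (K.reflexive (solve₃ (+ k) (+ k′) v (χ P a) (χ P a′)))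
        where
        solve₃ : ∀ k k′ v x y → (k ℤ.+ k′) ℤ.* v ℤ.+ (x ℤ.+ y) ≡ (k ℤ.* v ℤ.+ x) ℤ.+ (k′ ℤ.* v ℤ.+ y)
        solve₃ = solve-∀

      P≼extended : P ≼ extended
      P≼extended .dom {x} a = 0 , x , a , sym (identityˡ x)
      P≼extended .agree a = K.reflexive (≡.trans (≡.cong (ℤ._+ χ P a) (ℤ.*-zeroˡ v)) (ℤ.+-identityˡ (χ P a)))

      t∈ : Dom extended t
      t∈ = 1 , ε , Dom-ε P , sym (trans (identityʳ _) (×-homo-1 t))

      χ-t : χ extended t∈ K.≈ v
      χ-t = K.trans (K.+-congˡ {+ 1 K.* v} (χ-ε P (Dom-ε P) refl))
        (K.trans (K.+-identityʳ _) (K.*-identityˡ v))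

    -- The order of t modulo Dom P is suc m.
    order : ∀ P t → ∃[ m ] Dom P (suc m times t) × (∀ d → Dom P (d times t) → suc m ℕ∣.∣ d)
    order P t = m , mt∈ , multiple
      where
      -- The search ends because t^q = 1 lies in the domain. It runs over `suc k`, which keeps the
      -- order positive.
      found = least em (λ k → Dom P (suc k times t)) (ℕ.pred q) (Dom-resp P (sym (suc-pred-torsion t)) (Dom-ε P))
      m = proj₁ found
      mt∈ = proj₁ (proj₂ found)
      multiple : ∀ d → Dom P (d times t) → suc m ℕ∣.∣ d
      multiple d dt∈ with d % suc m in eq
      ... | zero  = divides (d div suc m) (≡.trans (m≡m%n+[m/n]*n d (suc m)) (≡.cong (ℕ._+ (d div suc m) ℕ.* suc m) eq))
      -- A remainder `suc r` below `suc m` would put t^(suc r) in the domain, against minimality.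
      ... | suc r = contradiction
              (Dom-resp P r≈ (Dom-∙ P dt∈ (Dom-⁻¹ P (times∈ P (d div suc m) mt∈))))
              (proj₂ (proj₂ found) (ℕ.s≤s⁻¹ (≡.subst (ℕ._< suc m) eq (m%n<n d (suc m)))))
        where
        j = d div suc m
        r≈ : d times t ∙ (j times (suc m times t)) ⁻¹ ≈ suc r times t
        r≈ = trans (∙-congʳ (trans (times-congˡ (≡.trans (m≡m%n+[m/n]*n d (suc m)) (≡.cong (ℕ._+ j ℕ.* suc m) eq)))
                     (trans (×-homo-+ t (suc r) (j ℕ.* suc m)) (∙-congˡ (sym (×-assocˡ t j (suc m)))))))
               (trans (assoc _ _ _) (trans (∙-congˡ (inverseʳ _)) (identityʳ _)))

    -- Every exponent d with t^d in the domain is a multiple of the order, so the congruence at the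
    -- order implies all others.
    order-compatible : ∀ P t {m} (a : Dom P (suc m times t)) → (∀ d → Dom P (d times t) → suc m ℕ∣.∣ d) →
      ∀ v → + suc m K.* v K.≈ χ P a → ∀ d (b : Dom P (d times t)) → + d K.* v K.≈ χ P b
    order-compatible P t {m} a multiple v e d b with multiple d b
    ... | divides j ≡.refl = begin
      + (j ℕ.* suc m) K.* v       ≡⟨ ≡.cong (ℤ._* v) (ℤ.pos-* j (suc m)) ⟩
      (+ j K.* + suc m) K.* v     ≡⟨ ℤ.*-assoc (+ j) (+ suc m) v ⟩
      + j K.* (+ suc m K.* v)     ≈⟨ K.*-congˡ {+ j} e ⟩
      + j K.* χ P a               ≈⟨ χ-times P j a b (sym (×-assocˡ t j (suc m))) ⟨
      χ P b                       ∎
      where open SetoidReasoning K.setoid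

    -- With m the order of t modulo Dom P and q = j m, the value a at t^m satisfies
    -- j a ≡ 0 mod j m, so that a is divisible by m.
    extend : ∀ P t → Σ[ P′ ∈ PartialCharacter ] P ≼ P′ × Dom P′ t
    extend P t = extended , P≼extended , t∈
      where
      m = proj₁ (order P t)
      mt∈ = proj₁ (proj₂ (order P t))
      multiple = proj₂ (proj₂ (order P t))
      qt∈ : Dom P (q times t)
      qt∈ = Dom-resp P (sym (torsion t)) (Dom-ε P)

      quotient : Σ[ v ∈ ℤ ] + suc m K.* v K.≈ χ P mt∈
      quotient with multiple q qt∈
      ... | divides zero q≡0 = contradiction q≡0 (ℕ.≢-nonZero⁻¹ q)
      ... | divides j@(suc _) q≡jm =
        ℤ∣.quotient m∣a , K.reflexive (≡.trans (ℤ.*-comm (+ suc m) (ℤ∣.quotient m∣a)) (≡.sym (ℤ∣._∣_.equality m∣a)))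
        where
        ja≈0 : + j K.* χ P mt∈ K.≈ K.0#
        ja≈0 = K.trans
          (K.sym (χ-times P j mt∈ qt∈ (trans (times-congˡ q≡jm) (sym (×-assocˡ t j (suc m))))))
          (χ-ε P qt∈ (torsion t))
        m∣a : + suc m ℤ∣.∣ χ P mt∈
        m∣a = ℤ∣.*-cancelˡ-∣ (+ j)
          (≡.subst₂ ℤ∣._∣_ (≡.trans (≡.cong +_ q≡jm) (ℤ.pos-* j (suc m))) (ℤ.+-identityʳ _)
            (_≡_[mod_].divides ja≈0))

      open Extend P t (proj₁ quotient)
        (order-compatible P t mt∈ multiple (proj₁ quotient) (proj₂ quotient))

    -- If x has order m and q = j m, then x ↦ j defines a character of the cyclic group of x, since
    -- m j = q. Were j divisible by j m, then m would be 1 and x trivial.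
    nontrivial : ∀ x → ¬ x ≈ ε → Σ[ P ∈ PartialCharacter ] Σ[ a ∈ Dom P x ] ¬ χ P a K.≈ K.0#
    nontrivial x x≉ε with order trivial x
    ... | m , mx∈ , multiple with multiple q (torsion x)
    ...   | divides zero q≡0 = contradiction q≡0 (ℕ.≢-nonZero⁻¹ q)
    ...   | divides j@(suc _) q≡jm = extended , t∈ , λ χ≈0 → j≉0 (K.trans (K.sym χ-t) χ≈0)
      where
      mj≈0 : + suc m K.* + j K.≈ K.0#
      mj≈0 = mod (ℤ∣.divides (+ 1) (≡.trans (ℤ.+-identityʳ _) (≡.trans (≡.sym (ℤ.pos-* (suc m) j))
        (≡.trans (≡.cong +_ (≡.trans (ℕ.*-comm (suc m) j) (≡.sym q≡jm))) (≡.sym (ℤ.*-identityˡ (+ q)))))))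
      open Extend trivial x (+ j) (order-compatible trivial x mx∈ multiple (+ j) mj≈0)
      j≉0 : ¬ + j K.≈ K.0#
      j≉0 (mod q∣j) = x≉ε (trans (sym (×-homo-1 x)) (trans (times-congˡ (≡.sym sm≡1)) mx∈))
        where
        jm∣j : j ℕ.* suc m ℕ∣.∣ j ℕ.* 1
        jm∣j = ≡.subst₂ ℕ∣._∣_ q≡jm (≡.trans (ℕ.+-identityʳ j) (≡.sym (ℕ.*-identityʳ j))) (ℤ∣.∣⇒∣ᵤ q∣j)
        sm≡1 : suc m ≡ 1
        sm≡1 = ℕ∣.∣1⇒≡1 (ℕ∣.*-cancelˡ-∣ j jm∣j)

    -- A list of indices i whose R i cover Q expresses that Q is finite.
    module _ {I : Set ℓ} (R : I → Pred Carrier ℓ) (R-≈ : ∀ {i x y} → R i x → R i y → x ≈ y) where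

      -- All elements of one `R i` are equal, so a single extension, to any element of `R i`,
      -- settles the index i. Excluded middle decides whether `R i` is inhabited.
      extend-over : ∀ is P → Σ[ P′ ∈ PartialCharacter ] P ≼ P′ × (∀ {x} → Any (λ i → R i x) is → Dom P′ x)
      extend-over [] P = P , ≼-refl , λ ()
      extend-over (i ∷ is) P with em {∃[ t ] R i t}
      ... | no ∄t =
        let (P′ , P≼P′ , d) = extend-over is P in
        P′ , P≼P′ , λ { (here p) → contradiction (_ , p) ∄t ; (there p) → d p }
      ... | yes (t , rt) =
        let (P′ , P≼P′ , dt) = extend P t
            (P″ , P′≼P″ , d) = extend-over is P′
        in P″ , ≼-trans P≼P′ P′≼P″ , λ { (here p) → Dom-resp P″ (R-≈ rt p) (dom P′≼P″ dt) ; (there p) → d p }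

      -- A character nontrivial at x is built on the cyclic group of x and extended until its domain
      -- is all of Q.
      separating-character : (is : List I) → (∀ x → Any (λ i → R i x) is) → ∀ x → ¬ x ≈ ε →
        Σ[ χ ∈ (Carrier → ℤ) ] (∀ {y z} → y ≈ z → χ y K.≈ χ z) ×
          (∀ y z → χ (y ∙ z) K.≈ χ y K.+ χ z) × ¬ χ x K.≈ K.0#
      separating-character is cover x x≉ε =
        let (P , a , χa≉0) = nontrivial x x≉ε
            (P′ , P≼P′ , d) = extend-over is P
            total = λ y → d (cover y)
        in (λ y → χ P′ (total y)) ,
           (λ {y} {z} e → χ-cong P′ (total y) (total z) e) ,
           (λ y z → K.trans (χ-cong P′ (total (y ∙ z)) (Dom-∙ P′ (total y) (total z)) refl)
                      (χ-homo P′ (total y) (total z))) ,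
           (λ e → χa≉0 (K.trans (K.sym (agree P≼P′ a)) (K.trans (χ-cong P′ (dom P≼P′ a) (total x) refl) e)))

-- Functoriality of tensor powers.

module Tensors {k ℓk} (K : CommutativeRing k ℓk) where
  open TensorPower K
  private module K = CommutativeRing K

  Tensor-map-∘ : ∀ {a ℓa b ℓb c ℓc} {L : LeftModule K.ring a ℓa} {M : LeftModule K.ring b ℓb}
    {N : LeftModule K.ring c ℓc} {f : LeftModule.Carrierᴹ M → LeftModule.Carrierᴹ N}
    {g : LeftModule.Carrierᴹ L → LeftModule.Carrierᴹ M} {r} (x : Tensor L r) →
    Tensor-map {M = M} {N = N} f (Tensor-map g x) ≡ Tensor-map (f ∘ g) x
  Tensor-map-∘ (pure v) = ≡.refl
  Tensor-map-∘ (x ⊕ y)  = ≡.cong₂ _⊕_ (Tensor-map-∘ x) (Tensor-map-∘ y)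
  Tensor-map-∘ (a · x)  = ≡.cong (a ·_) (Tensor-map-∘ x)
  Tensor-map-∘ 𝟘        = ≡.refl
  Tensor-map-∘ (⊖ x)    = ≡.cong ⊖_ (Tensor-map-∘ x)

  Tensor-map-id : ∀ {m ℓm} {M : LeftModule K.ring m ℓm} {f : LeftModule.Carrierᴹ M → LeftModule.Carrierᴹ M} →
    (∀ x → LeftModule._≈ᴹ_ M (f x) x) → ∀ {r} (x : Tensor M r) → _≈⊗_ M (Tensor-map f x) x
  Tensor-map-id f≈id (pure v) = pure-cong (λ i → f≈id (v i))
  Tensor-map-id f≈id (x ⊕ y)  = ⊕-cong (Tensor-map-id f≈id x) (Tensor-map-id f≈id y)
  Tensor-map-id f≈id (a · x)  = ·-cong K.refl (Tensor-map-id f≈id x)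
  Tensor-map-id f≈id 𝟘        = refl⊗
  Tensor-map-id f≈id (⊖ x)    = ⊖-cong (Tensor-map-id f≈id x)

  module _ {m ℓm n ℓn} {M : LeftModule K.ring m ℓm} {N : LeftModule K.ring n ℓn}
           {f : LeftModule.Carrierᴹ M → LeftModule.Carrierᴹ N} where

    Tensor-map-pure-⊗ : ∀ {r s} (v : Vector (LeftModule.Carrierᴹ M) r) (y : Tensor M s) →
      _≈⊗_ N (Tensor-map f (pure-⊗ v y)) (pure-⊗ (f ∘ v) (Tensor-map f y))
    Tensor-map-pure-⊗ {r} v (pure w) = pure-cong (λ i → LeftModule.≈ᴹ-reflexive N (f-++ i))
      where
      f-++ : ∀ i → f ((v ++ w) i) ≡ ((f ∘ v) ++ (f ∘ w)) i
      f-++ i with Fin.splitAt r i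
      ... | inj₁ _ = ≡.refl
      ... | inj₂ _ = ≡.refl
    Tensor-map-pure-⊗ v (x ⊕ y) = ⊕-cong (Tensor-map-pure-⊗ v x) (Tensor-map-pure-⊗ v y)
    Tensor-map-pure-⊗ v (a · x) = ·-cong K.refl (Tensor-map-pure-⊗ v x)
    Tensor-map-pure-⊗ v 𝟘       = refl⊗
    Tensor-map-pure-⊗ v (⊖ x)   = ⊖-cong (Tensor-map-pure-⊗ v x)

    Tensor-map-⊗ : ∀ {r s} (x : Tensor M r) (y : Tensor M s) →
      _≈⊗_ N (Tensor-map f (x ⊗ y)) (Tensor-map f x ⊗ Tensor-map f y)
    Tensor-map-⊗ (pure v) y = Tensor-map-pure-⊗ v y
    Tensor-map-⊗ (x ⊕ z)  y = ⊕-cong (Tensor-map-⊗ x y) (Tensor-map-⊗ z y)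
    Tensor-map-⊗ (a · x)  y = ·-cong K.refl (Tensor-map-⊗ x y)
    Tensor-map-⊗ 𝟘        y = refl⊗
    Tensor-map-⊗ (⊖ x)    y = ⊖-cong (Tensor-map-⊗ x y)

-- Finite sums, graded components and direct sums under homomorphisms.

module _ {a ℓa b ℓb} (A : AbelianGroup a ℓa) (B : AbelianGroup b ℓb) where
  private
    module A = AbelianGroup A
    module B = AbelianGroup B

  sum-map : (f : A.Carrier → B.Carrier) → f A.ε B.≈ B.ε → (∀ x y → f (x A.∙ y) B.≈ f x B.∙ f y) →
    ∀ {n} (v : Vector A.Carrier n) (w : Vector B.Carrier n) → (∀ i → f (v i) B.≈ w i) →
    f (Sum.sum A.commutativeMonoid v) B.≈ Sum.sum B.commutativeMonoid w
  sum-map f f-ε f-∙ {zero}  v w e = f-ε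
  sum-map f f-ε f-∙ {suc n} v w e = B.trans (f-∙ _ _)
    (B.∙-cong (e Fin.zero) (sum-map f f-ε f-∙ (v ∘ Fin.suc) (w ∘ Fin.suc) (e ∘ Fin.suc)))

-- Products in a direct sum form terms in degree i + (n - i) and transport them to degree n;
-- relations between terms have to follow that transport.
subst-rel : ∀ {a b ℓ} {A : ℕ → Set a} {B : ℕ → Set b} (R : ∀ r → A r → B r → Set ℓ) →
  ∀ {m n} (e : m ≡ n) {x : A m} {y : B m} → R m x y → R n (subst A e x) (subst B e y)
subst-rel R ≡.refl p = p

single-component-diagonal : ∀ {a ℓa} (A : ℕ → AbelianGroup a ℓa) r (x : AbelianGroup.Carrier (A r)) →
  DirectSum.single-component A r x r ≡ x
single-component-diagonal A r x with r ℕ.≟ r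
... | yes ≡.refl = ≡.refl
... | no  r≢r    = contradiction ≡.refl r≢r

module _ {a ℓa b ℓb} (A : ℕ → AbelianGroup a ℓa) (B : ℕ → AbelianGroup b ℓb) where
  private
    module A {r} = AbelianGroup (A r)
    module B {r} = AbelianGroup (B r)

  single-component-rel : (f : ∀ r → A.Carrier {r} → B.Carrier {r}) → (∀ r → f r A.ε B.≈ B.ε) →
    ∀ r {x y} → f r x B.≈ y → ∀ n →
    f n (DirectSum.single-component A r x n) B.≈ DirectSum.single-component B r y n
  single-component-rel f f-ε r e n = B.trans (B.sym (single-component-map A B f f-ε r _ n))
    (DirectSum.single-component-cong B r e n)

top : ∀ {ℓ} → ProfiniteGroup ℓ → TopologicalGroup ℓ
top = ProfiniteGroup.topologicalGroup

-- Homomorphisms to Z/q, their vanishing on G^(2), and deflation.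

module Degree1 (q : ℕ) where
  open Duality q
  private module K = CommutativeRing (ℤ/ q)

  module _ {ℓ} (G : TopologicalGroup ℓ) (a : ℤ) where
    open TopologicalGroup G using (open-⊤)

    const¹ : Cochain¹ G
    const¹ .Cochain¹.fun _ = a
    const¹ .Cochain¹.cong _ = K.refl
    const¹ .Cochain¹.continuous _ = (λ _ → ⊤) , open-⊤ , tt , (λ _ → K.refl)

    const² : Cocycle² G
    const² .Cocycle².fun _ _ = a
    const² .Cocycle².cong _ _ = K.refl
    const² .Cocycle².continuous _ _ = (λ _ → ⊤) , (λ _ → ⊤) , open-⊤ , open-⊤ , tt , tt , (λ _ _ → K.refl)
    const² .Cocycle².cocycle _ _ _ = K.refl

  module _ {ℓ} {G : TopologicalGroup ℓ} (ψ : Hom¹ G) where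
    private
      module G = TopologicalGroup G
      open Mult G.monoid using () renaming (_×_ to _times_)
      open Hom¹ ψ using (fun; cong; homo; continuous)
      open SetoidReasoning K.setoid

    fun-ε : fun G.ε K.≈ K.0#
    fun-ε = begin
      fun G.ε                               ≡⟨ solve₁ (fun G.ε) ⟩
      (fun G.ε K.+ fun G.ε) K.- fun G.ε     ≈⟨ K.+-congʳ (homo G.ε G.ε) ⟨
      fun (G.ε G.∙ G.ε) K.- fun G.ε         ≈⟨ K.+-congʳ (cong (G.identityˡ G.ε)) ⟩
      fun G.ε K.- fun G.ε                   ≈⟨ K.-‿inverseʳ (fun G.ε) ⟩
      K.0#                                  ∎
      where
      solve₁ : ∀ a → a ≡ (a ℤ.+ a) ℤ.- a
      solve₁ = solve-∀

    fun-⁻¹ : ∀ x → fun (x G.⁻¹) K.≈ K.- fun x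
    fun-⁻¹ x = begin
      fun (x G.⁻¹)                          ≡⟨ solve₂ (fun (x G.⁻¹)) (fun x) ⟩
      (fun (x G.⁻¹) K.+ fun x) K.- fun x    ≈⟨ K.+-congʳ (homo (x G.⁻¹) x) ⟨
      fun (x G.⁻¹ G.∙ x) K.- fun x          ≈⟨ K.+-congʳ (K.trans (cong (G.inverseˡ x)) fun-ε) ⟩
      K.0# K.- fun x                        ≈⟨ K.+-identityˡ _ ⟩
      K.- fun x                             ∎
      where
      solve₂ : ∀ a b → a ≡ (a ℤ.+ b) ℤ.- b
      solve₂ = solve-∀

    fun-times : ∀ n x → fun (n times x) K.≈ + n K.* fun x
    fun-times zero    x = K.trans fun-ε (K.reflexive (≡.sym (ℤ.*-zeroˡ (fun x))))
    fun-times (suc n) x = K.trans (homo x (n times x)) (K.trans (K.+-congˡ {fun x} (fun-times n x))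
      (K.reflexive (≡.sym (ℤ.suc-* (+ n) (fun x)))))

    fun-generator : ∀ {x} → PowersAndCommutators G q (λ _ → ⊤) x → fun x K.≈ K.0#
    fun-generator (power {x} _) = K.trans (fun-times q x)
      (mod (≡.subst (+ q ℤ∣.∣_) (≡.sym (ℤ.+-identityʳ _)) (ℤ∣.∣m⇒∣m*n (fun x) ℤ∣.∣-refl)))
    fun-generator (commutator {x} _ g) = begin
      fun (((x G.⁻¹ G.∙ g G.⁻¹) G.∙ x) G.∙ g)                  ≈⟨ homo _ g ⟩
      fun ((x G.⁻¹ G.∙ g G.⁻¹) G.∙ x) K.+ fun g                ≈⟨ K.+-congʳ (homo _ x) ⟩
      (fun (x G.⁻¹ G.∙ g G.⁻¹) K.+ fun x) K.+ fun g            ≈⟨ K.+-congʳ {fun g} (K.+-congʳ {fun x} (K.trans (homo _ _) (K.+-cong (fun-⁻¹ x) (fun-⁻¹ g)))) ⟩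
      ((K.- fun x K.+ K.- fun g) K.+ fun x) K.+ fun g          ≡⟨ solve₃ (fun x) (fun g) ⟩
      K.0#                                                     ∎
      where
      solve₃ : ∀ a b → ((ℤ.- a ℤ.+ ℤ.- b) ℤ.+ a) ℤ.+ b ≡ + 0
      solve₃ = solve-∀

    fun-generated : ∀ {x} → Generated G (PowersAndCommutators G q (λ _ → ⊤)) x → fun x K.≈ K.0#
    fun-generated (gen p) = fun-generator p
    fun-generated (resp e p) = K.trans (K.sym (cong e)) (fun-generated p)
    fun-generated ε∈ = fun-ε
    fun-generated (∙∈ p p′) = K.trans (homo _ _)
      (K.trans (K.+-cong (fun-generated p) (fun-generated p′)) (K.+-identityˡ _))
    fun-generated (⁻¹∈ p) = K.trans (fun-⁻¹ _) (K.-‿cong (fun-generated p))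

    -- An open neighbourhood of x on which ψ is constant meets the subgroup generated by q-th powers
    -- and commutators, where ψ vanishes.
    fun-qCentral² : ∀ {x} → qCentral² G q x → fun x K.≈ K.0#
    fun-qCentral² {x} x∈ =
      let (U , U-open , ux , constant) = continuous x
          (y , uy , y∈) = x∈ U-open ux
      in K.trans (K.sym (constant uy)) (fun-generated y∈)

  module _ {ℓ} (G : ProfiniteGroup ℓ) (N : Σ (ClosedSubgroup G) ClosedSubgroup.Normal) where
    private
      module G = ProfiniteGroup G
      module N = ClosedSubgroup (proj₁ N)
      open GroupProperties G.group using (\\-leftDividesˡ)

    descend : (b : Cochain¹ (top G)) →
              (∀ g {n} → N.Mem n → Cochain¹.fun b (g G.∙ n) K.≈ Cochain¹.fun b g) → Cochain¹ (top (G / N))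
    descend b invariant .Cochain¹.fun = Cochain¹.fun b
    descend b invariant .Cochain¹.cong {x} {y} x∼y = K.sym (K.trans
      (Cochain¹.cong b (G.sym (\\-leftDividesˡ x y))) (invariant x x∼y))
    descend b invariant .Cochain¹.continuous x =
      let (U , U-open , ux , constant) = Cochain¹.continuous b x
          sat-open = saturate-open (top G) N.subgroup (proj₂ N) U-open
          sat-resp = saturate-resp (top G) N.subgroup (proj₂ N) U-open
      in saturate (top G) N.subgroup (proj₂ N) U , (sat-open , sat-resp) ,
         ⊆-saturate (top G) N.subgroup (proj₂ N) U-open ux ,
         (λ { {x′} ((n , n∈) , u) → K.trans (K.sym (invariant x′ n∈)) (constant u) })

    module _ (N≤G⁽²⁾ : N.Mem ⊆ qCentral² (top G) q) where

      -- The inverse of inflation in degree 1, with the same underlying function: ψ kills G^(2),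
      -- which contains N, and is therefore constant on cosets of N.
      deflate : Hom¹ (top G) → Hom¹ (top (G / N))
      deflate ψ .Hom¹.cochain = descend (Hom¹.cochain ψ) (λ g n∈ → K.trans (Hom¹.homo ψ g _)
        (K.trans (K.+-congˡ {Hom¹.fun ψ g} (fun-qCentral² ψ (N≤G⁽²⁾ n∈))) (K.+-identityʳ _)))
      deflate ψ .Hom¹.homo = Hom¹.homo ψ

      deflate⊗ : ∀ {r} → Tensor (H¹ (top G)) r → Tensor (H¹ (top (G / N))) r
      deflate⊗ = Tensor-map deflate

      deflate⊗-cong : ∀ {r} {x y : Tensor (H¹ (top G)) r} →
                      _≈⊗_ (H¹ (top G)) x y → _≈⊗_ (H¹ (top (G / N))) (deflate⊗ x) (deflate⊗ y)
      deflate⊗-cong = Tensor-map-cong (λ e → e) (λ _ _ _ → K.refl) (λ _ _ _ → K.refl)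

      deflate⊗* : H⊗* G → H⊗* (G / N)
      deflate⊗* x .DirectSum.component r = deflate⊗ (DirectSum.component x r)
      deflate⊗* x .DirectSum.bound = DirectSum.bound x
      deflate⊗* x .DirectSum.vanishes r b≤r = deflate⊗-cong (DirectSum.vanishes x r b≤r)

  -- Homomorphisms T → Z/q separating points from T₀.

  module _ {ℓ} {G : ProfiniteGroup ℓ} {T T₀ : ClosedSubgroup G} (T₀-normal : ClosedSubgroup.Normal T₀)
           (T^q[T,G]≤T₀ : powerCommutator (top G) q (ClosedSubgroup.Mem T) ⊆ ClosedSubgroup.Mem T₀) where
    private
      module G = ProfiniteGroup G
      module T = ClosedSubgroup T
      module T₀ = ClosedSubgroup T₀
      open GroupProperties G.group
      open Mult G.monoid using () renaming (_×_ to _times_)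
      T̂ = subspace T.subgroup

      generator∈T₀ : ∀ {x} → PowersAndCommutators (top G) q T.Mem x → T₀.Mem x
      generator∈T₀ {x} p = T^q[T,G]≤T₀ (λ _ ux → x , ux , gen p)

      -- M = H T₀ is an open subgroup of G. Because T^q and [T,G] lie in T₀ ≤ M, the quotient T/(T ∩
      -- M) is abelian of exponent dividing q, even when M is not normal in G. `M` is encoded as a
      -- subgroup of G/T₀, so its `resp` is about cosets of T₀.
      module Cosets (H : Subgroup (top G)) (H-open : G.IsOpen (Subgroup.Mem H)) where
        module H = Subgroup H
        M = saturateSubgroup (top G) T₀.subgroup T₀-normal H H-open
        module M = Subgroup M

        H⊆M : H.Mem ⊆ M.Mem
        H⊆M = ⊆-saturate (top G) T₀.subgroup T₀-normal H-open

        M-resp : ∀ {x y} → x G.≈ y → M.Mem x → M.Mem y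
        M-resp x≈y = M.resp (T₀.resp (G.trans (G.sym (G.inverseˡ _)) (G.∙-congˡ x≈y)) T₀.ε∈)

        T₀⊆M : T₀.Mem ⊆ M.Mem
        T₀⊆M {t} t∈ = (t G.⁻¹ , T₀.⁻¹∈ t∈) , H.resp (G.sym (G.inverseʳ t)) H.ε∈

        commutator∈M : ∀ {x} → T.Mem x → ∀ g → M.Mem (((x G.⁻¹ G.∙ g G.⁻¹) G.∙ x) G.∙ g)
        commutator∈M x∈ g = T₀⊆M (generator∈T₀ (commutator x∈ g))

        T∩M : Subgroup T̂
        T∩M .Subgroup.Mem t = M.Mem (proj₁ t)
        T∩M .Subgroup.resp = M-resp
        T∩M .Subgroup.ε∈ = M.ε∈
        T∩M .Subgroup.∙∈ = M.∙∈
        T∩M .Subgroup.⁻¹∈ = M.⁻¹∈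

        -- The second factor on the left is the commutator [x, g⁻¹], which lies in T₀ for x in T;
        -- hence the normality of T ∩ M.
        conjugate : ∀ g x → x G.∙ (((x G.⁻¹ G.∙ (g G.⁻¹) G.⁻¹) G.∙ x) G.∙ g G.⁻¹) G.≈ (g G.∙ x) G.∙ g G.⁻¹
        conjugate g x = begin
          x G.∙ (((x G.⁻¹ G.∙ (g G.⁻¹) G.⁻¹) G.∙ x) G.∙ g G.⁻¹) ≈⟨ G.∙-congˡ (G.trans (G.assoc _ _ _) (G.assoc _ _ _)) ⟩
          x G.∙ (x G.⁻¹ G.∙ ((g G.⁻¹) G.⁻¹ G.∙ (x G.∙ g G.⁻¹))) ≈⟨ \\-leftDividesˡ x _ ⟩
          (g G.⁻¹) G.⁻¹ G.∙ (x G.∙ g G.⁻¹)                      ≈⟨ G.∙-congʳ (⁻¹-involutive g) ⟩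
          g G.∙ (x G.∙ g G.⁻¹)                                  ≈⟨ G.assoc _ _ _ ⟨
          (g G.∙ x) G.∙ g G.⁻¹                                  ∎
          where open SetoidReasoning G.setoid

        T∩M-normal : IsNormal T∩M
        T∩M-normal (g , _) {x , x∈} m = M-resp (conjugate g x) (M.∙∈ m (commutator∈M x∈ (g G.⁻¹)))

        T/T∩M : AbelianGroup ℓ ℓ
        T/T∩M = record
          { isAbelianGroup = record
            { isGroup = Group.isGroup (quotientGroup T̂ T∩M T∩M-normal)
            ; comm = λ (x , x∈) (y , y∈) → M-resp
                (G.trans (G.assoc _ _ _) (G.∙-congʳ (G.sym (⁻¹-anti-homo-∙ x y))))
                (commutator∈M y∈ x)
            }
          }

        open AbelianGroup T/T∩M public using (_≈_; ε; sym)
        open Mult (AbelianGroup.monoid T/T∩M) public using () renaming (_×_ to _times′_)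

        times′-proj : ∀ n t → proj₁ (n times′ t) ≡ n times (proj₁ t)
        times′-proj zero    t = ≡.refl
        times′-proj (suc n) t = ≡.cong (proj₁ t G.∙_) (times′-proj n t)

        ≈ε : ∀ {t} → M.Mem (proj₁ t) → t ≈ ε
        ≈ε m = M-resp (G.sym (G.identityʳ _)) (M.⁻¹∈ m)

        ≈ε⇒∈M : ∀ {t} → t ≈ ε → M.Mem (proj₁ t)
        ≈ε⇒∈M {t} e = M-resp (G.trans (G.∙-congʳ ε⁻¹≈ε) (G.identityˡ _)) (sym {t} {ε} e)

        torsion : ∀ t → q times′ t ≈ ε
        torsion (t , t∈) = ≈ε {q times′ (t , t∈)} (≡.subst M.Mem (≡.sym (times′-proj q (t , t∈))) (T₀⊆M (generator∈T₀ (power t∈))))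

    -- Pontryagin duality for T/T₀.
    separating-hom : ExcludedMiddle ℓ → .{{_ : NonZero q}} → ∀ {x} (x∈ : T.Mem x) → ¬ T₀.Mem x →
      Σ[ φ ∈ Hom¹ T̂ ] IsInvariant G T φ ×
        (∀ {t} (t∈ : T.Mem t) → T₀.Mem t → Hom¹.fun φ (t , t∈) K.≈ K.0#) ×
        ¬ Hom¹.fun φ (x , x∈) K.≈ K.0#
    separating-hom em {x} x∈ x∉T₀ = φ , φ-invariant , φ-T₀ , χx≉0
      where
      -- T₀ is closed and misses x, so H can be chosen with H x disjoint from T₀; then x is not in H
      -- T₀.
      separated : G.IsOpen (λ h → ¬ T₀.Mem (h G.∙ x))
      separated = G.open-translateʳ x T₀.closed

      small = G.open-subgroups separated (λ m → x∉T₀ (T₀.resp (G.identityˡ x) m))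
      H = proj₁ small
      H-open = proj₁ (proj₂ small)
      open Cosets H H-open

      x∉M : ¬ M.Mem x
      x∉M ((n , n∈) , h) = proj₂ (proj₂ small) (H.⁻¹∈ h)
        (T₀.resp (G.sym (G.trans (G.∙-congʳ (⁻¹-anti-homo-∙ x n))
          (G.trans (G.assoc _ _ _) (G.trans (G.∙-congˡ (G.inverseˡ x)) (G.identityʳ _))))) (T₀.⁻¹∈ n∈))

      -- By compactness finitely many cosets r H cover G. Each meets T within a single class modulo
      -- T ∩ M, which is the finiteness that `separating-character` asks for.
      cosets = G.compact (λ r x → H.Mem (r G.⁻¹ G.∙ x)) (λ r → G.open-translateˡ (r G.⁻¹) H-open)
                 (λ x → x , H.resp (G.sym (G.inverseˡ x)) H.ε∈)

      character = Characters.separating-character em T/T∩M q torsion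
        (λ r t → H.Mem (r G.⁻¹ G.∙ proj₁ t))
        (λ {r} {t} {t′} h h′ → H⊆M (H.resp
          (G.trans (G.∙-congʳ (⁻¹-anti-homo-\\ r (proj₁ t))) (G.cancel-mid _ _ _)) (H.∙∈ (H.⁻¹∈ h) h′)))
        (proj₁ cosets) (λ t → proj₂ cosets (proj₁ t)) (x , x∈) (λ e → x∉M (≈ε⇒∈M {x , x∈} e))

      χ = proj₁ character
      χ-cong : ∀ {y z} → y ≈ z → χ y K.≈ χ z
      χ-cong = proj₁ (proj₂ character)
      χx≉0 = proj₂ (proj₂ (proj₂ character))

      φ : Hom¹ T̂
      φ .Hom¹.cochain .Cochain¹.fun = χ
      φ .Hom¹.cochain .Cochain¹.cong {y} {z} e =
        χ-cong {y} {z} (M-resp (G.trans (G.sym (G.inverseˡ _)) (G.∙-congˡ e)) M.ε∈)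
      φ .Hom¹.cochain .Cochain¹.continuous t =
        (λ t′ → t ≈ t′) ,
        ((λ g → M.Mem (proj₁ t G.⁻¹ G.∙ g)) ,
         G.open-translateˡ (proj₁ t G.⁻¹) (saturate-open (top G) T₀.subgroup T₀-normal H-open) ,
         (λ m → m) , (λ m → m)) ,
        M-resp (G.sym (G.inverseˡ _)) M.ε∈ ,
        (λ {t′} m → K.sym (χ-cong {t} {t′} m))
      φ .Hom¹.homo = proj₁ (proj₂ (proj₂ character))

      φ-invariant : IsInvariant G T φ
      -- The element t⁻¹ (g⁻¹ t g) is the commutator [t, g], which lies in M.
      φ-invariant g {t} {t′} e = K.sym (χ-cong {t} {t′} (M-resp
        (G.trans (G.trans (G.assoc _ _ _) (G.assoc _ _ _)) (G.∙-congˡ (G.trans (G.sym (G.assoc _ _ _)) (G.sym e))))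
        (commutator∈M (proj₂ t) g)))

      φ-T₀ : ∀ {t} (t∈ : T.Mem t) → T₀.Mem t → Hom¹.fun φ (t , t∈) K.≈ K.0#
      φ-T₀ {t} t∈ t∈T₀ = K.trans (χ-cong {t , t∈} {ε} (≈ε {t , t∈} (T₀⊆M t∈T₀))) (fun-ε φ)

-- Inflation from G/N to G on A.

module Inflation {q : ℕ} {ℓ} (𝒯 : Duality.DualityTriple q ℓ) (G : ProfiniteGroup ℓ)
                 (N : Σ (ClosedSubgroup G) ClosedSubgroup.Normal) where
  open Duality q
  open DualityTriple 𝒯
  open Degree1 q
  open Tensors (ℤ/ q)
  private
    module K = CommutativeRing (ℤ/ q)
    module G = ProfiniteGroup G
    module N = ClosedSubgroup (proj₁ N)
    module T = ClosedSubgroup (T G)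
    module T₀ = ClosedSubgroup (T₀ G)
    module G/N = ProfiniteGroup (G / N)
    module G/T = ProfiniteGroup (G /T)
    τ = projection G (T G , T-normal G)

    inf : Cocycle² (top (G / N)) → Cocycle² (top G)
    inf = H²-map (projection G N)

    inf-cong : ∀ {c d} → _≈²_ (top (G / N)) c d → _≈²_ (top G) (inf c) (inf d)
    inf-cong = H²-map-cong (projection G N)

    open GroupProperties G.group using (\\-leftDividesˡ)
    module H² (Γ : ProfiniteGroup ℓ) = AbelianGroup (H² (top Γ))
    module H⊗ (Γ : ProfiniteGroup ℓ) = AbelianGroup (H⊗*-abelianGroup Γ)
    module α (Γ : ProfiniteGroup ℓ) = GroupMorphisms.IsGroupHomomorphism (α-isHomomorphism Γ)

  -- The injectivity half of (b), phrased for arguments of α because elements of A come with such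
  -- arguments; the other half is automatic for N ≤ T, by `injective⇒isomorphism`.
  InflationInjective : Set _
  InflationInjective = ∀ x y → _≈²_ (top G) (inf (α (G / N) x)) (inf (α (G / N) y)) →
                       _≈²_ (top (G / N)) (α (G / N) x) (α (G / N) y)

  injective⇒kernel-trivial : InflationInjective → ∀ x → _≈²_ (top G) (inf (α (G / N) x)) (zero² (top G)) →
                             _≈²_ (top (G / N)) (α (G / N) x) (zero² (top (G / N)))
  injective⇒kernel-trivial inj x e = H².trans (G / N)
    (inj x (H⊗.ε (G / N)) (H².trans G e (H².sym G (H².trans G (inf-cong (α.ε-homo (G / N))) (H²-map-zero (projection G N))))))
    (α.ε-homo (G / N))

  A-map-isGroupHomomorphism : GroupMorphisms.IsGroupHomomorphism (A (G / N)) (A G) (A-map {G} {G / N} (projection G N))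
  A-map-isGroupHomomorphism = record
    { isMonoidHomomorphism = record
      { isMagmaHomomorphism = record
        { isRelHomomorphism = record { cong = inf-cong }
        ; homo = λ _ _ → pointwise (top G) (λ _ _ → K.refl)
        }
      ; ε-homo = H²-map-zero (projection G N)
      }
    ; ⁻¹-homo = λ _ → pointwise (top G) (λ _ _ → K.refl)
    }

  -- Classes of H²(G/T) that vanish in H²(G), seen as transgressions.

  module _ (N≤T : N.Mem ⊆ T.Mem) where

    ρ : G / N ⇒ G /T
    ρ = record
      { ⟦_⟧        = id
      ; cong       = N≤T
      ; homo       = λ _ _ → G/T.refl
      ; continuous = λ (U-open , U-resp) → U-open , (λ m → U-resp (N≤T m))
      }

    N≤G⁽²⁾ : N.Mem ⊆ qCentral² (top G) q
    N≤G⁽²⁾ n∈ = T≤G⁽²⁾ G (N≤T n∈)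

    -- φ is the restriction to T of a cochain y′ on G, normalised to vanish at 1, whose
    -- coboundary is the inflation of f.
    module Transgress (f : Cocycle² (top (G /T))) (f∼0 : _≈²_ (top G) (H²-map τ f) (zero² (top G))) where
      private
        y₀ = _≈²_.b f∼0
        module y₀ = Cochain¹ y₀
        k = K.- y₀.fun G.ε

      y′ : Cochain¹ (top G)
      y′ = add¹ (top G) y₀ (const¹ (top G) k)

      private
        module y = Cochain¹ y′

      -- Adding the constant k to `y₀` adds k to its coboundary, so f is shifted in the same way;
      -- its class is unchanged because the constant k is its own coboundary.
      f₁ : Cocycle² (top (G /T))
      f₁ = add² (top (G /T)) f (const² (top (G /T)) k)
      private module f₁ = Cocycle² f₁

      f₁≈f : _≈²_ (top (G /T)) f₁ f
      f₁≈f = cobounds (const¹ (top (G /T)) k) (λ g h → K.+-congˡ {Cocycle².fun f g h} (K.reflexive (solve₁ k)))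
        where
        solve₁ : ∀ a → a ≡ (a ℤ.+ ℤ.- a) ℤ.+ a
        solve₁ = solve-∀

      ∂y≈f₁ : ∀ g h → ∂ (top G) y′ g h K.≈ f₁.fun g h
      ∂y≈f₁ g h = K.sym (K.trans (K.+-congʳ {k} (_≈²_.f≈g+∂b f∼0 g h))
        (K.reflexive (solve₂ (y₀.fun h) (y₀.fun (g G.∙ h)) (y₀.fun g) k)))
        where
        solve₂ : ∀ a b c k → (+ 0 ℤ.+ ((a ℤ.+ ℤ.- b) ℤ.+ c)) ℤ.+ k ≡ ((a ℤ.+ k) ℤ.+ ℤ.- (b ℤ.+ k)) ℤ.+ (c ℤ.+ k)
        solve₂ = solve-∀

      y-ε : y.fun G.ε K.≈ K.0#
      y-ε = K.-‿inverseʳ (y₀.fun G.ε)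

      y-split : ∀ {g h} → f₁.fun g h K.≈ K.0# → y.fun (g G.∙ h) K.≈ y.fun g K.+ y.fun h
      y-split {g} {h} e = begin
        y.fun (g G.∙ h)                                  ≡⟨ solve₃ (y.fun (g G.∙ h)) (y.fun g) (y.fun h) ⟩
        (y.fun g K.+ y.fun h) K.- ∂ (top G) y′ g h        ≈⟨ K.+-congˡ {y.fun g K.+ y.fun h} (K.-‿cong (K.trans (∂y≈f₁ g h) e)) ⟩
        (y.fun g K.+ y.fun h) K.- K.0#                   ≈⟨ K.+-identityʳ _ ⟩
        y.fun g K.+ y.fun h                              ∎
        where
        open SetoidReasoning K.setoid
        solve₃ : ∀ a b c → a ≡ (b ℤ.+ c) ℤ.- ((c ℤ.+ ℤ.- a) ℤ.+ b)
        solve₃ = solve-∀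

      T∼ε : ∀ {t} → T.Mem t → t G/T.≈ G.ε
      T∼ε t∈ = T.resp (G.sym (G.identityʳ _)) (T.⁻¹∈ t∈)

      -- `f₁` is a cocycle on G/T, so f₁(g,t) = f₁(g,1) = y′(1) = 0.
      y-∙T : ∀ g {t} → T.Mem t → y.fun (g G.∙ t) K.≈ y.fun g K.+ y.fun t
      y-∙T g {t} t∈ = y-split {g} {t} (begin
        f₁.fun g t                                          ≈⟨ f₁.cong G/T.refl (T∼ε t∈) ⟩
        f₁.fun g G.ε                                        ≈⟨ ∂y≈f₁ g G.ε ⟨
        (y.fun G.ε K.+ K.- y.fun (g G.∙ G.ε)) K.+ y.fun g   ≈⟨ K.+-congʳ {y.fun g} (K.+-cong y-ε (K.-‿cong (y.cong (G.identityʳ g)))) ⟩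
        (K.0# K.+ K.- y.fun g) K.+ y.fun g                  ≡⟨ solve₄ (y.fun g) ⟩
        K.0#                                                ∎)
        where
        open SetoidReasoning K.setoid
        solve₄ : ∀ a → (+ 0 ℤ.+ ℤ.- a) ℤ.+ a ≡ + 0
        solve₄ = solve-∀

      y-T∙ : ∀ {t} g → T.Mem t → y.fun (t G.∙ g) K.≈ y.fun t K.+ y.fun g
      y-T∙ {t} g t∈ = y-split {t} {g} (begin
        f₁.fun t g                                          ≈⟨ f₁.cong (T∼ε t∈) G/T.refl ⟩
        f₁.fun G.ε g                                        ≈⟨ ∂y≈f₁ G.ε g ⟨
        (y.fun g K.+ K.- y.fun (G.ε G.∙ g)) K.+ y.fun G.ε   ≈⟨ K.+-cong (K.+-congˡ {y.fun g} (K.-‿cong (y.cong (G.identityˡ g)))) y-ε ⟩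
        (y.fun g K.+ K.- y.fun g) K.+ K.0#                  ≡⟨ solve₅ (y.fun g) ⟩
        K.0#                                                ∎)
        where
        open SetoidReasoning K.setoid
        solve₅ : ∀ a → (a ℤ.+ ℤ.- a) ℤ.+ + 0 ≡ + 0
        solve₅ = solve-∀

      φ : Hom¹ (subspace T.subgroup)
      φ .Hom¹.cochain .Cochain¹.fun t = y.fun (proj₁ t)
      φ .Hom¹.cochain .Cochain¹.cong e = y.cong e
      φ .Hom¹.cochain .Cochain¹.continuous t =
        let (U , U-open , ut , constant) = y.continuous (proj₁ t) in
        (λ t′ → U (proj₁ t′)) , (U , U-open , (λ u → u) , (λ u → u)) , ut , (λ u → constant u)
      φ .Hom¹.homo s t = y-∙T (proj₁ s) (proj₂ t)

      -- From g t′ = t g follows y′(g) + y′(t′) = y′(t) + y′(g), by additivity of `y′` when either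
      -- factor lies in T.
      φ-invariant : IsInvariant G (T G) φ
      φ-invariant g {t , t∈} {t′ , t′∈} e = begin
        y.fun t′                                 ≡⟨ solve₆ (y.fun t′) (y.fun g) ⟩
        (y.fun g K.+ y.fun t′) K.- y.fun g       ≈⟨ K.+-congʳ (y-∙T g t′∈) ⟨
        y.fun (g G.∙ t′) K.- y.fun g             ≈⟨ K.+-congʳ (y.cong gt′≈tg) ⟩
        y.fun (t G.∙ g) K.- y.fun g              ≈⟨ K.+-congʳ (y-T∙ g t∈) ⟩
        (y.fun t K.+ y.fun g) K.- y.fun g        ≡⟨ solve₇ (y.fun t) (y.fun g) ⟩
        y.fun t                                  ∎
        where
        open SetoidReasoning K.setoid
        gt′≈tg : g G.∙ t′ G.≈ t G.∙ g
        gt′≈tg = G.trans (G.∙-congˡ (G.trans e (G.assoc _ _ _))) (\\-leftDividesˡ g (t G.∙ g))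
        solve₆ : ∀ a b → a ≡ (b ℤ.+ a) ℤ.- b
        solve₆ = solve-∀
        solve₇ : ∀ a b → (a ℤ.+ b) ℤ.- b ≡ a
        solve₇ = solve-∀

      φ-transgression : IsTransgression G (T G) (T-normal G) φ f
      φ-transgression = y′ , f₁ , (λ _ → K.refl) , ∂y≈f₁ , f₁≈f

      -- If `y′` vanishes on N, it is constant on cosets of N; it then descends to G/N and bounds
      -- the inflation of `f₁` there.
      trivial-on-N : (∀ {n} → N.Mem n → y.fun n K.≈ K.0#) →
                     _≈²_ (top (G / N)) (H²-map ρ f) (zero² (top (G / N)))
      trivial-on-N y-N = H².trans (G / N) (H²-map-cong ρ (H².sym (G /T) f₁≈f))
        (cobounds (descend G N y′ invariant) (λ g h → K.trans (K.sym (∂y≈f₁ g h)) (K.sym (K.+-identityˡ _))))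
        where
        invariant : ∀ g {n} → N.Mem n → y.fun (g G.∙ n) K.≈ y.fun g
        invariant g n∈ = K.trans (y-∙T g (N≤T n∈)) (K.trans (K.+-congˡ {y.fun g} (y-N n∈)) (K.+-identityʳ _))

    -- Since H¹(G/T) = H¹(G) = H¹(G/N), inflation H^⊗*(G/T) → H^⊗*(G/N) has a section.
    lift : H⊗* (G / N) → H⊗* (G /T)
    lift x = deflate⊗* G (T G , T-normal G) (T≤G⁽²⁾ G) (H⊗*-map {G₁ = G} {G / N} (projection G N) x)

    ρ-lift : ∀ x → H⊗._≈_ (G / N) (H⊗*-map {G₁ = G / N} {G /T} ρ (lift x)) x
    ρ-lift x = DirectSum.componentwise λ r → let z = DirectSum.component x r in
      trans⊗ (LeftModule.≈ᴹ-reflexive (H¹⊗ (G / N) r)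
                (≡.trans (≡.cong (Tensor-map (H¹-map ρ)) (Tensor-map-∘ z)) (Tensor-map-∘ z)))
             (Tensor-map-id (λ _ _ → K.refl) z)

    -- From (a) to injectivity of inflation on A(G/N).

    T₀⇒injective : Cover G → N.Mem ⊆ T₀.Mem → InflationInjective
    T₀⇒injective cover N≤T₀ x y infx≈infy = x∙y⁻¹≈ε⇒x≈y (α (G / N) x) (α (G / N) y) (begin
        add² (top (G / N)) (α (G / N) x) (neg² (top (G / N)) (α (G / N) y)) ≈⟨ α-u ⟨
        α (G / N) u                                             ≈⟨ ρ-f ⟨
        H²-map ρ f                                          ≈⟨ trivial-on-N φ-N ⟩
        zero² (top (G / N))                                     ∎)
      where
      open GroupProperties (H².group (G / N)) using (x∙y⁻¹≈ε⇒x≈y)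
      open SetoidReasoning (H².setoid (G / N))
      -- With u = x - y it suffices that α(u) = 0, and α(u) is the inflation of the class f in
      -- A(G/T).
      u = H⊗._∙_ (G / N) x (H⊗._⁻¹ (G / N) y)
      f = α (G /T) (lift u)
      α-u : _≈²_ (top (G / N)) (α (G / N) u) (add² (top (G / N)) (α (G / N) x) (neg² (top (G / N)) (α (G / N) y)))
      α-u = H².trans (G / N) (α.homo (G / N) x (H⊗._⁻¹ (G / N) y)) (H².∙-congˡ (G / N) (α.⁻¹-homo (G / N) y))
      ρ-f : _≈²_ (top (G / N)) (H²-map ρ f) (α (G / N) u)
      ρ-f = H².trans (G / N) (α-functorial {G / N} {G /T} ρ (lift u)) (α.⟦⟧-cong (G / N) (ρ-lift u))
      π-zero : _≈²_ (top G) (inf (add² (top (G / N)) (α (G / N) x) (neg² (top (G / N)) (α (G / N) y)))) (zero² (top G))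
      π-zero = H².trans G (pointwise (top G) (λ _ _ → K.refl))
        (GroupProperties.x≈y⇒x∙y⁻¹≈ε (H².group G) {inf (α (G / N) x)} {inf (α (G / N) y)} infx≈infy)
      f∼0 : _≈²_ (top G) (H²-map τ f) (zero² (top G))
      f∼0 = H².trans G (pointwise (top G) {H²-map τ f} {inf (H²-map ρ f)} (λ _ _ → K.refl))
        (H².trans G (inf-cong (H².trans (G / N) ρ-f α-u)) π-zero)
      open Transgress f f∼0
      φ-N : ∀ {n} → N.Mem n → Cochain¹.fun y′ n K.≈ K.0#
      -- The transgression of φ is the class of f, which lies in A(G/T); by duality φ vanishes on T₀
      -- and thus on N.
      φ-N {n} n∈ = Equivalence.from (duality G cover φ φ-invariant)
        (f , (lift u , H².refl (G /T)) , φ-transgression) (n , N≤T₀ n∈)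

    -- From injectivity of inflation to (a).

    injective⇒T₀ : ExcludedMiddle ℓ → .{{_ : NonZero q}} → Cover G → InflationInjective → N.Mem ⊆ T₀.Mem
    injective⇒T₀ em cover inj {x} x∈ with em {T₀.Mem x}
    ... | yes x∈T₀ = x∈T₀
    ... | no  x∉T₀ = contradiction φx≈0 φx≉0
      where
      separating = separating-hom {T = T G} {T₀ G} (T₀-normal G) (T^q[T,G]≤T₀ G) em (N≤T x∈) x∉T₀
      φ = proj₁ separating
      φx≉0 = proj₂ (proj₂ (proj₂ separating))
      φ-T₀ = proj₁ (proj₂ (proj₂ separating))

      dual = Equivalence.to (duality G cover φ (proj₁ (proj₂ separating)))
               (λ (t , t∈) → φ-T₀ (T₀≤T G t∈) t∈)
      c = proj₁ dual
      u = proj₁ (proj₁ (proj₂ dual))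
      αu≈c = proj₂ (proj₁ (proj₂ dual))
      y = proj₁ (proj₂ (proj₂ dual))
      f = proj₁ (proj₂ (proj₂ (proj₂ dual)))
      y≈φ = proj₁ (proj₂ (proj₂ (proj₂ (proj₂ dual))))
      ∂y≈f = proj₁ (proj₂ (proj₂ (proj₂ (proj₂ (proj₂ dual)))))
      f≈c = proj₂ (proj₂ (proj₂ (proj₂ (proj₂ (proj₂ dual)))))

      ρu = H⊗*-map {G₁ = G / N} {G /T} ρ u

      ρf≈αρu : _≈²_ (top (G / N)) (H²-map ρ f) (α (G / N) ρu)
      ρf≈αρu = H².trans (G / N) (H²-map-cong ρ (H².trans (G /T) f≈c (H².sym (G /T) αu≈c)))
        (α-functorial {G / N} {G /T} ρ u)

      f∼0 : _≈²_ (top G) (inf (H²-map ρ f)) (zero² (top G))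
      f∼0 = cobounds y (λ g h → K.trans (K.sym (∂y≈f g h)) (K.sym (K.+-identityˡ _)))

      ρf∼0 : _≈²_ (top (G / N)) (H²-map ρ f) (zero² (top (G / N)))
      ρf∼0 = H².trans (G / N) ρf≈αρu (injective⇒kernel-trivial inj ρu
        (H².trans G (inf-cong (H².sym (G / N) ρf≈αρu)) f∼0))

      z = _≈²_.b ρf∼0
      Y = Cochain¹.fun y
      Z = Cochain¹.fun z

      -- A homomorphism because y and z have the same coboundary f.
      y-z : Hom¹ (top G)
      y-z .Hom¹.cochain = add¹ (top G) y (neg¹ (top G) (Cochain¹-map (projection G N) z))
      y-z .Hom¹.homo g h = begin
        Y (g G.∙ h) K.- Z (g G.∙ h)
          ≡⟨ solve₁ (Y (g G.∙ h)) (Z (g G.∙ h)) (Y g) (Y h) (Z g) (Z h) ⟩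
        ((Y g K.- Z g) K.+ (Y h K.- Z h)) K.+ ((K.0# K.+ ∂ (top (G / N)) z g h) K.- ∂ (top G) y g h)
          ≈⟨ K.+-congˡ {(Y g K.- Z g) K.+ (Y h K.- Z h)} (K.trans
               (K.+-cong (K.sym (_≈²_.f≈g+∂b ρf∼0 g h)) (K.-‿cong (∂y≈f g h))) (K.-‿inverseʳ (Cocycle².fun f g h))) ⟩
        ((Y g K.- Z g) K.+ (Y h K.- Z h)) K.+ K.0#
          ≈⟨ K.+-identityʳ _ ⟩
        (Y g K.- Z g) K.+ (Y h K.- Z h) ∎
        where
        open SetoidReasoning K.setoid
        solve₁ : ∀ a b c d e f → a ℤ.- b ≡
          ((c ℤ.- e) ℤ.+ (d ℤ.- f)) ℤ.+ ((+ 0 ℤ.+ ((f ℤ.+ ℤ.- b) ℤ.+ e)) ℤ.- ((d ℤ.+ ℤ.- a) ℤ.+ c))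
        solve₁ = solve-∀

      -- `y-z` vanishes at x ∈ G^(2) and at 1, while z, being a cochain on G/N, takes the same value
      -- at both; so y(x) = y(1) = φ(1) = 0.
      φx≈0 : Hom¹.fun φ (x , N≤T x∈) K.≈ K.0#
      φx≈0 = begin
        Hom¹.fun φ (x , N≤T x∈)          ≈⟨ y≈φ (x , N≤T x∈) ⟨
        Y x                              ≡⟨ solve₂ (Y x) (Z x) ⟩
        (Y x K.- Z x) K.+ Z x            ≈⟨ K.+-cong (fun-qCentral² y-z (N≤G⁽²⁾ x∈)) (Cochain¹.cong z x∼ε) ⟩
        K.0# K.+ Z G.ε                   ≈⟨ K.+-congʳ {Z G.ε} (fun-ε y-z) ⟨
        (Y G.ε K.- Z G.ε) K.+ Z G.ε      ≡⟨ solve₂ (Y G.ε) (Z G.ε) ⟨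
        Y G.ε                            ≈⟨ y≈φ (G.ε , T.ε∈) ⟩
        Hom¹.fun φ (G.ε , T.ε∈)          ≈⟨ fun-ε φ ⟩
        K.0#                             ∎
        where
        open SetoidReasoning K.setoid
        x∼ε : x G/N.≈ G.ε
        x∼ε = N.resp (G.sym (G.identityʳ _)) (N.⁻¹∈ x∈)
        solve₂ : ∀ a b → a ≡ (a ℤ.- b) ℤ.+ b
        solve₂ = solve-∀

    -- Inflation and deflation of tensors, and surjectivity on A.

    deflate* : H⊗* G → H⊗* (G / N)
    deflate* = deflate⊗* G N N≤G⁽²⁾

    defl : ∀ {r} → Tensor (H¹ (top G)) r → Tensor (H¹ (top (G / N))) r
    defl = deflate⊗ G N N≤G⁽²⁾

    infl : ∀ {r} → Tensor (H¹ (top (G / N))) r → Tensor (H¹ (top G)) r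
    infl = H¹⊗-map {G₁ = G} {G / N} (projection G N)

    infl-defl : ∀ {r} (x : Tensor (H¹ (top G)) r) → _≈⊗_ (H¹ (top G)) (infl (defl x)) x
    infl-defl {r} x = trans⊗ (LeftModule.≈ᴹ-reflexive (H¹⊗ G r) (Tensor-map-∘ x))
                             (Tensor-map-id (λ _ _ → K.refl) x)

    defl-infl : ∀ {r} (x : Tensor (H¹ (top (G / N))) r) → _≈⊗_ (H¹ (top (G / N))) (defl (infl x)) x
    defl-infl {r} x = trans⊗ (LeftModule.≈ᴹ-reflexive (H¹⊗ (G / N) r) (Tensor-map-∘ x))
                             (Tensor-map-id (λ _ _ → K.refl) x)

    injective⇒isomorphism : InflationInjective → GroupMorphisms.IsGroupIsomorphism (A (G / N)) (A G) (A-map {G} {G / N} (projection G N))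
    injective⇒isomorphism inj = record
      { isGroupMonomorphism = record
        { isGroupHomomorphism = A-map-isGroupHomomorphism
        ; injective = λ { {c , x , αx≈c} {d , y , αy≈d} e →
            H².trans (G / N) (H².sym (G / N) αx≈c) (H².trans (G / N) (inj x y
              (H².trans G (inf-cong αx≈c) (H².trans G e (inf-cong (H².sym (G / N) αy≈d))))) αy≈d) }
        }
      -- Inflating `deflate* x` gives back x, so α_G(x) is inflated from the value of α at
      -- `deflate* x`.
      ; surjective = λ (c , x , αx≈c) →
          (α (G / N) (deflate* x) , deflate* x , H².refl (G / N)) ,
          (λ e → H².trans G (inf-cong e) (H².trans G (α-functorial {G} {G / N} (projection G N) (deflate* x))
            (H².trans G (α.⟦⟧-cong G (DirectSum.componentwise λ r → infl-defl (DirectSum.component x r))) αx≈c)))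
      }

    isomorphism⇒injective : GroupMorphisms.IsGroupIsomorphism (A (G / N)) (A G) (A-map {G} {G / N} (projection G N)) → InflationInjective
    isomorphism⇒injective iso x y =
      GroupMorphisms.IsGroupIsomorphism.injective iso {α (G / N) x , x , H².refl (G / N)} {α (G / N) y , y , H².refl (G / N)}

    α-infl : ∀ t (x : Tensor (H¹ (top (G / N))) t) →
             _≈²_ (top G) (inf (α (G / N) (homogeneous (G / N) t x))) (α G (homogeneous G t (infl x)))
    α-infl t x = H².trans G (α-functorial {G} {G / N} (projection G N) (homogeneous (G / N) t x))
      (H².sym G (α.⟦⟧-cong G (H⊗*-map-homogeneous {G₁ = G} {G / N} (projection G N) t x)))

    -- The rings H*_{t,α} and the passage between (b) and (c).

    module _ (inj : InflationInjective) (t : ℕ) where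

      -- For a generator of C, α vanishes on the tensor of t of its factors. On the deflated factors
      -- α vanishes after inflation, hence already in H²(G/N) by `inj`.
      C-defl : ∀ {r} {x : Tensor (H¹ (top G)) r} → C t G r x → C t (G / N) r (defl x)
      C-defl (gen (generator ψ i i-mono e)) = gen (generator (deflate G N N≤G⁽²⁾ ∘ ψ) i i-mono
        (injective⇒kernel-trivial inj (homogeneous (G / N) t (defl (pure (ψ ∘ i))))
          (H².trans G (α-infl t (defl (pure (ψ ∘ i))))
            (H².trans G (α.⟦⟧-cong G (DirectSum.single-cong (λ r → LeftModule.+ᴹ-abelianGroup (H¹⊗ G r)) t
              (infl-defl (pure (ψ ∘ i))))) e))))
      C-defl (resp e c) = resp (deflate⊗-cong G N N≤G⁽²⁾ e) (C-defl c)
      C-defl 0∈ = 0∈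
      C-defl (+∈ c d) = +∈ (C-defl c) (C-defl d)
      C-defl (-∈ c) = -∈ (C-defl c)
      C-defl (*∈ a c) = *∈ a (C-defl c)

    H*-map-isRingHomomorphism : ∀ t → RingMorphisms.IsRingHomomorphism (H* t (G / N)) (H* t G) (H*-map {G} {G / N} t (projection G N))
    H*-map-isRingHomomorphism t = record
      { isSemiringHomomorphism = record
        { isNearSemiringHomomorphism = record
          { +-isMonoidHomomorphism = record
            { isMagmaHomomorphism = record
              { isRelHomomorphism = record { cong = λ e → DirectSum.componentwise λ r → C-map {G} {G / N} t (projection G N) (DirectSum.at e r) }
              ; homo = λ _ _ → DirectSum.componentwise λ r → Hᵗ.≈ᴹ-refl r
              }
            ; ε-homo = DirectSum.componentwise λ r → Hᵗ.≈ᴹ-refl r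
            }
          -- A component of a product is a sum over i of terms transported to degree n; additivity
          -- of `infl` reduces to single terms, and `subst-rel` to degree i + (n - i).
          ; *-homo = λ x y → DirectSum.componentwise λ n →
              sum-map (Hᵗ/N.+ᴹ-abelianGroup n) (Hᵗ.+ᴹ-abelianGroup n) infl (Hᵗ.≈ᴹ-refl n) (λ _ _ → Hᵗ.≈ᴹ-refl n)
                (λ i → subst (Tensor (H¹ (top (G / N)))) (i+[n-i] i)
                         (DirectSum.component x (toℕ i) ⊗ DirectSum.component y (n ℕ.∸ toℕ i)))
                (λ i → subst (Tensor (H¹ (top G))) (i+[n-i] i)
                         (infl (DirectSum.component x (toℕ i)) ⊗ infl (DirectSum.component y (n ℕ.∸ toℕ i))))
                (λ i → subst-rel (λ r z w → Hᵗ._≈ᴹ_ r (infl z) w) (i+[n-i] i)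
                  (≈⇒∼ (Tensor-map-⊗ (DirectSum.component x (toℕ i)) (DirectSum.component y (n ℕ.∸ toℕ i)))))
          }
        ; 1#-homo = DirectSum.componentwise (single-component-rel (λ r → Hᵗ/N.+ᴹ-abelianGroup r) (λ r → Hᵗ.+ᴹ-abelianGroup r)
            (λ r → infl {r}) (λ r → Hᵗ.≈ᴹ-refl r) 0
            {DirectSum.component (RawRing.1# (H* t (G / N))) 0} {DirectSum.component (RawRing.1# (H* t G)) 0}
            (≈⇒∼ (pure-cong (λ ()))))
        }
      ; -‿homo = λ _ → DirectSum.componentwise λ r → Hᵗ.≈ᴹ-refl r
      }
      where
      module Hᵗ r = LeftModule (Hᵗ t G r)
      module Hᵗ/N r = LeftModule (Hᵗ t (G / N) r)
      i+[n-i] : ∀ {n} (i : Fin (suc n)) → toℕ i ℕ.+ (n ℕ.∸ toℕ i) ≡ n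
      i+[n-i] i = ℕ.m+[n∸m]≡n (Fin.toℕ≤pred[n] i)
      ≈⇒∼ : ∀ {r} {x y : Tensor (H¹ (top G)) r} → _≈⊗_ (H¹ (top G)) x y → Hᵗ._≈ᴹ_ r x y
      ≈⇒∼ {r} {y = y} e = resp (trans⊗ (sym⊗ (LeftModule.-ᴹ‿inverseʳ (H¹⊗ G r) y)) (⊕-cong (sym⊗ e) refl⊗)) 0∈

    injective⇒ring-isomorphism : InflationInjective → ∀ t →
      RingMorphisms.IsRingIsomorphism (H* t (G / N)) (H* t G) (H*-map {G} {G / N} t (projection G N))
    injective⇒ring-isomorphism inj t = record
      { isRingMonomorphism = record
        { isRingHomomorphism = H*-map-isRingHomomorphism t
        -- Equality in `H*` says that a difference lies in C, which `C-defl` carries back to G/N.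
        ; injective = λ {x} {y} e → DirectSum.componentwise λ r →
            resp (defl-infl (DirectSum.component x r ⊕ ⊖ DirectSum.component y r)) (C-defl inj t (DirectSum.at e r))
        }
      ; surjective = λ x → preimage x , λ {z} e → DirectSum.componentwise λ r →
          resp (⊕-cong refl⊗ (⊖-cong (infl-defl (DirectSum.component x r)))) (C-map {G} {G / N} t (projection G N) (DirectSum.at e r))
      }
      where
      preimage : RawRing.Carrier (H* t G) → RawRing.Carrier (H* t (G / N))
      preimage x .DirectSum.component r = defl (DirectSum.component x r)
      preimage x .DirectSum.bound = DirectSum.bound x
      preimage x .DirectSum.vanishes r b≤r = C-defl inj t (DirectSum.vanishes x r b≤r)

    -- Both classes come from tensors w, z of degree r, by surjectivity for G/N. The inflations of w
    -- and z have the same image in A(G), hence agree in H^r_{r,α}(G) by injectivity for G, and w, z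
    -- agree in H^r_{r,α}(G/N) by the ring isomorphism with t = r.
    ring-isomorphism⇒injective : ∀ r →
      Injective (LeftModule._≈ᴹ_ (Hᵗ r G r)) (RawGroup._≈_ (A G)) (ᾱ r G) →
      Surjective (LeftModule._≈ᴹ_ (Hᵗ r (G / N) r)) (RawGroup._≈_ (A (G / N))) (ᾱ r (G / N)) →
      RingMorphisms.IsRingIsomorphism (H* r (G / N)) (H* r G) (H*-map {G} {G / N} r (projection G N)) → InflationInjective
    ring-isomorphism⇒injective r ᾱ-injective ᾱ-surjective iso x y infx≈infy =
      -- Surjectivity supplies α(v) = α(y) for all v equal to z in H^r_{r,α}(G/N); it is applied to
      -- v = w.
      H².trans (G / N) (H².sym (G / N) α-w) (proj₂ (preimage y) {w} w∼z)
      where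
      module Hᵗ s = LeftModule (Hᵗ r G s)
      module Hᵗ/N s = LeftModule (Hᵗ r (G / N) s)
      preimage : ∀ x → Σ[ w ∈ Tensor (H¹ (top (G / N))) r ]
        (∀ {v} → Hᵗ/N._≈ᴹ_ r v w → _≈²_ (top (G / N)) (α (G / N) (homogeneous (G / N) r v)) (α (G / N) x))
      preimage x = ᾱ-surjective (α (G / N) x , x , H².refl (G / N))
      w = proj₁ (preimage x)
      z = proj₁ (preimage y)
      α-w : _≈²_ (top (G / N)) (α (G / N) (homogeneous (G / N) r w)) (α (G / N) x)
      α-w = proj₂ (preimage x) {w} (Hᵗ/N.≈ᴹ-refl r)
      α-z : _≈²_ (top (G / N)) (α (G / N) (homogeneous (G / N) r z)) (α (G / N) y)
      α-z = proj₂ (preimage y) {z} (Hᵗ/N.≈ᴹ-refl r)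

      α-infl-w≈z : _≈²_ (top G) (α G (homogeneous G r (infl w))) (α G (homogeneous G r (infl z)))
      α-infl-w≈z = begin
        α G (homogeneous G r (infl w))          ≈⟨ α-infl r w ⟨
        inf (α (G / N) (homogeneous (G / N) r w))  ≈⟨ inf-cong α-w ⟩
        inf (α (G / N) x)                      ≈⟨ infx≈infy ⟩
        inf (α (G / N) y)                      ≈⟨ inf-cong α-z ⟨
        inf (α (G / N) (homogeneous (G / N) r z))  ≈⟨ α-infl r z ⟩
        α G (homogeneous G r (infl z))          ∎
        where open SetoidReasoning (H².setoid G)

      infl-w∼z : Hᵗ._≈ᴹ_ r (infl w) (infl z)
      infl-w∼z = ᾱ-injective {infl w} {infl z} α-infl-w≈z

      module ⨁ = DirectSum (λ s → Hᵗ.+ᴹ-abelianGroup s)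
      module ⨁/N = DirectSum (λ s → Hᵗ/N.+ᴹ-abelianGroup s)

      infl-single : ∀ v s → Hᵗ._≈ᴹ_ s (⨁.single-component r (infl v) s) (infl (⨁/N.single-component r v s))
      infl-single v = single-component-map (λ s → Hᵗ/N.+ᴹ-abelianGroup s) (λ s → Hᵗ.+ᴹ-abelianGroup s)
        (λ s → infl {s}) (λ s → Hᵗ.≈ᴹ-refl s) r v

      -- The isomorphism concerns whole rings: w and z are placed in degree r by `single`, compared
      -- there, and read off again at component r.
      w∼z : Hᵗ/N._≈ᴹ_ r w z
      w∼z = ≡.subst₂ (Hᵗ/N._≈ᴹ_ r) (single-component-diagonal (λ s → Hᵗ/N.+ᴹ-abelianGroup s) r w)
        (single-component-diagonal (λ s → Hᵗ/N.+ᴹ-abelianGroup s) r z)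
        (DirectSum.at (RingMorphisms.IsRingIsomorphism.injective iso {⨁/N.single r w} {⨁/N.single r z}
          (DirectSum.componentwise λ s → Hᵗ.≈ᴹ-trans s (Hᵗ.≈ᴹ-sym s (infl-single w s))
            (Hᵗ.≈ᴹ-trans s (⨁.single-component-cong r infl-w∼z s) (infl-single z s)))) r)

    -- The implications between (a), (b) and (c).

    module _ (cover : Cover G) where

      T₀⇒isomorphism : N.Mem ⊆ T₀.Mem → GroupMorphisms.IsGroupIsomorphism (A (G / N)) (A G) (A-map {G} {G / N} (projection G N))
      T₀⇒isomorphism N≤T₀ = injective⇒isomorphism (T₀⇒injective cover N≤T₀)

      isomorphism⇒T₀ : ExcludedMiddle ℓ → .{{_ : NonZero q}} →
                       GroupMorphisms.IsGroupIsomorphism (A (G / N)) (A G) (A-map {G} {G / N} (projection G N)) → N.Mem ⊆ T₀.Mem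
      isomorphism⇒T₀ em iso = injective⇒T₀ em cover (isomorphism⇒injective iso)

    isomorphism⇒ring-isomorphism : GroupMorphisms.IsGroupIsomorphism (A (G / N)) (A G) (A-map {G} {G / N} (projection G N)) →
      ∀ t → 1 ℕ.≤ t → RingMorphisms.IsRingIsomorphism (H* t (G / N)) (H* t G) (H*-map {G} {G / N} t (projection G N))
    isomorphism⇒ring-isomorphism iso t _ = injective⇒ring-isomorphism (isomorphism⇒injective iso) t

    ring-isomorphism⇒isomorphism :
      (∃[ r ] 1 ℕ.≤ r ×
        Injective (LeftModule._≈ᴹ_ (Hᵗ r G r)) (RawGroup._≈_ (A G)) (ᾱ r G) ×
        Surjective (LeftModule._≈ᴹ_ (Hᵗ r (G / N) r)) (RawGroup._≈_ (A (G / N))) (ᾱ r (G / N))) →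
      (∀ t → 1 ℕ.≤ t → RingMorphisms.IsRingIsomorphism (H* t (G / N)) (H* t G) (H*-map {G} {G / N} t (projection G N))) →
      GroupMorphisms.IsGroupIsomorphism (A (G / N)) (A G) (A-map {G} {G / N} (projection G N))
    ring-isomorphism⇒isomorphism (r , 1≤r , ᾱ-injective , ᾱ-surjective) iso = injective⇒isomorphism
      (ring-isomorphism⇒injective r (λ {x} {y} → ᾱ-injective {x} {y}) ᾱ-surjective (iso r 1≤r))

theorem5p1 :
  ∀ {ℓ} → ExcludedMiddle ℓ →
  (p s : ℕ) → Prime p →
  let open Duality (p ^ s) in
  (𝒯 : DualityTriple ℓ) →
  let open DualityTriple 𝒯 in
  (G : ProfiniteGroup ℓ) → Cover G →
  (N : ClosedSubgroup G) (N-normal : ClosedSubgroup.Normal N) →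
  ClosedSubgroup.Mem N ⊆ ClosedSubgroup.Mem (T G) →
  let G/N = G / (N , N-normal)
      π   = projection G (N , N-normal)
      [a] = ClosedSubgroup.Mem N ⊆ ClosedSubgroup.Mem (T₀ G)
      [b] = GroupMorphisms.IsGroupIsomorphism (A G/N) (A G) (A-map {G} {G/N} π)
      [c] = ∀ t → 1 ≤ t → RingMorphisms.IsRingIsomorphism (H* t G/N) (H* t G) (H*-map {G} {G/N} t π)
  in
  ([a] ⇔ [b]) × ([b] → [c]) ×
  ((∃[ r ] 1 ≤ r ×
     Injective (LeftModule._≈ᴹ_ (Hᵗ r G r)) (RawGroup._≈_ (A G)) (ᾱ r G) ×
     Surjective (LeftModule._≈ᴹ_ (Hᵗ r G/N r)) (RawGroup._≈_ (A G/N)) (ᾱ r G/N)) →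
   ([a] ⇔ [b]) × ([b] ⇔ [c]) × ([a] ⇔ [c]))
theorem5p1 em p s p-prime 𝒯 G cover N N-normal N≤T =
  mk⇔ a⇒b b⇒a , b⇒c , λ h →
    mk⇔ a⇒b b⇒a , mk⇔ b⇒c (c⇒b h) ,
    mk⇔ (λ (a : ClosedSubgroup.Mem N ⊆ ClosedSubgroup.Mem (T₀ G)) → b⇒c (a⇒b a)) (λ c → b⇒a (c⇒b h c))
  where
  open Duality.DualityTriple 𝒯 using (T₀)
  open Inflation 𝒯 G (N , N-normal)
  a⇒b = T₀⇒isomorphism N≤T cover
  -- q = p^s is nonzero since p is prime; the duality for T/T₀ relies on this.
  b⇒a = isomorphism⇒T₀ N≤T cover em {{ℕ.m^n≢0 p s {{prime⇒nonZero p-prime}}}}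
  b⇒c = isomorphism⇒ring-isomorphism N≤T
  c⇒b = ring-isomorphism⇒isomorphism N≤T
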